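{- Let $r\leq 1$ be an odd integer coprime with $5$. Let $p$ be an odd prime such that $p\equiv r\pmod{5}$ and $p\geq (5-3r)/2$. Then $$\sum_{k=0}^{p-1}(10k+r)\frac{(\frac{r}{5})_k^5}{(1)_k^5}\equiv\frac{p\,\Gamma_p(\frac r5)^4}{\Gamma_p(\frac{2r}5)^2\,\Gamma_p(\frac12+\frac{3r}{10})\,\Gamma_p(\frac12-\frac r{10})^3}\sum_{k=0}^{(1-r)/2}\frac{(\frac{r-1}{2})_k(\frac r5)_k^3}{(1)_k(\frac{2r}5)_k^2(\frac12+\frac{3r}{10})_k}\pmod{p^5}.$$
   Context: $(a)_0=1$ and $(a)_k=a(a+1)\cdots(a+k-1)$ for $k\ge 1$ is the Pochhammer symbol. $\mathbb{Z}_p$ is the ring of $p$-adic integers; a congruence $x\equiv y\pmod{p^n}$ means $x-y\in p^n\mathbb{Z}_p$. $\Gamma_p$ is Morita's $p$-adic Gamma function ($p$ an odd prime): $\Gamma_p(0)=1$; for integers $n\ge1$, $\Gamma_p(n)=(-1)^n\prod_{1\le k<n,\ p\nmid k}k$; and for $x\in\mathbb{Z}_p$, $\Gamma_p(x)=\lim_{n\to x}\Gamma_p(n)$, where the limit is over integers $n\geq 1$ with $|n-x|_p\to0$. -}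

module Defs where

open import Algebra.Bundles using (CommutativeRing)
open import Data.Empty using (⊥-elim)
open import Data.Integer.Base as ℤ using (ℤ; +_; -[1+_]; ∣_∣; 0ℤ; 1ℤ; -1ℤ)
import Data.Integer.DivMod as ℤD
open import Data.Integer.Divisibility.Signed as ℤS using (divides)
import Data.Integer.Properties as ℤP
open import Data.Integer.Tactic.RingSolver using (solve-∀)
open import Data.List.Base using (List; []; _∷_; _++_; [_]; filter; upTo; length)
import Data.List.Properties as ListP
open import Data.List.Membership.Propositional using (_∈_)
open import Data.List.Membership.Propositional.Properties
  using (∈-∃++; ∈-filter⁺; ∈-filter⁻; ∈-upTo⁺; ∈-upTo⁻)
open import Data.List.Relation.Binary.Permutation.Propositional
  using (_↭_; ↭-sym; ↭-reflexive; ↭⇒↭ₛ) renaming (↭-trans to _↭∘_)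
open import Data.List.Relation.Binary.Permutation.Propositional.Properties
  using (shift; ∈-resp-↭; ↭-length)
import Data.List.Relation.Binary.Permutation.Setoid.Properties as PermS
import Data.List.Relation.Unary.All as All
import Data.List.Relation.Unary.AllPairs as AllPairs
open import Data.List.Relation.Unary.Any using (here; there)
open import Data.List.Relation.Unary.Unique.Propositional using (Unique)
import Data.List.Relation.Unary.Unique.Propositional.Properties as UniqueP
open import Data.Nat.Base as ℕ using (ℕ; zero; suc; z≤n; s≤s)
import Data.Nat.Coprimality as Cop
import Data.Nat.Divisibility as ℕD
open import Data.Nat.GCD using (module Bézout)
open import Data.Nat.ListAction using (product)
open import Data.Nat.ListAction.Properties using (product-++; product-↭)
open import Data.Nat.Primality using (Prime; prime⇒irreducible; prime⇒nonZero; prime⇒nonTrivial)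
import Data.Nat.Properties as ℕP
open import Data.Product.Base using (∃; ∃-syntax; _×_; _,_; proj₁; proj₂)
open import Data.Sum.Base using (inj₁; inj₂; [_,_]′)
open import Level using (0ℓ)
open import Relation.Binary.PropositionalEquality
  using (_≡_; _≢_; refl; sym; trans; cong; cong₂; subst; setoid)
open import Relation.Nullary using (¬_; Dec; yes; no; ¬?; contradiction)

infix 4 _≡_[mod_]

record _≡_[mod_] (a b : ℤ) (N : ℕ) : Set where
  constructor mod
  field
    divides-difference : + N ℤS.∣ a ℤ.- b

open _≡_[mod_] public

module Congruence {N : ℕ} where

  ≡-to-mod : ∀ {a b} → a ≡ b → a ≡ b [mod N ]
  ≡-to-mod {a} refl = mod (divides 0ℤ (ℤP.+-inverseʳ a))

  mod-refl : ∀ {a} → a ≡ a [mod N ]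
  mod-refl = ≡-to-mod refl

  mod-sym : ∀ {a b} → a ≡ b [mod N ] → b ≡ a [mod N ]
  mod-sym {a} {b} (mod d) = mod (subst (+ N ℤS.∣_) (e a b) (ℤS.∣m⇒∣-m d))
    where
    e : ∀ a b → ℤ.- (a ℤ.- b) ≡ b ℤ.- a
    e = solve-∀

  mod-trans : ∀ {a b c} → a ≡ b [mod N ] → b ≡ c [mod N ] → a ≡ c [mod N ]
  mod-trans {a} {b} {c} (mod d) (mod d′) =
    mod (subst (+ N ℤS.∣_) (e a b c) (ℤS.∣m∣n⇒∣m+n d d′))
    where
    e : ∀ a b c → (a ℤ.- b) ℤ.+ (b ℤ.- c) ≡ a ℤ.- c
    e = solve-∀

  mod-+ : ∀ {a b c d} → a ≡ b [mod N ] → c ≡ d [mod N ] → a ℤ.+ c ≡ b ℤ.+ d [mod N ]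
  mod-+ {a} {b} {c} {d} (mod u) (mod v) =
    mod (subst (+ N ℤS.∣_) (e a b c d) (ℤS.∣m∣n⇒∣m+n u v))
    where
    e : ∀ a b c d → (a ℤ.- b) ℤ.+ (c ℤ.- d) ≡ (a ℤ.+ c) ℤ.- (b ℤ.+ d)
    e = solve-∀

  mod-neg : ∀ {a b} → a ≡ b [mod N ] → ℤ.- a ≡ ℤ.- b [mod N ]
  mod-neg {a} {b} (mod u) = mod (subst (+ N ℤS.∣_) (e a b) (ℤS.∣m⇒∣-m u))
    where
    e : ∀ a b → ℤ.- (a ℤ.- b) ≡ ℤ.- a ℤ.- (ℤ.- b)
    e = solve-∀

  mod-* : ∀ {a b c d} → a ≡ b [mod N ] → c ≡ d [mod N ] → a ℤ.* c ≡ b ℤ.* d [mod N ]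
  mod-* {a} {b} {c} {d} (mod u) (mod v) =
    mod (subst (+ N ℤS.∣_) (e a b c d) (ℤS.∣m∣n⇒∣m+n (ℤS.∣m⇒∣m*n c u) (ℤS.∣n⇒∣m*n b v)))
    where
    e : ∀ a b c d → (a ℤ.- b) ℤ.* c ℤ.+ b ℤ.* (c ℤ.- d) ≡ a ℤ.* c ℤ.- b ℤ.* d
    e = solve-∀

  mod-down : ∀ {M a b} → N ℕD.∣ M → a ≡ b [mod M ] → a ≡ b [mod N ]
  mod-down N∣M (mod d) = mod (ℤS.∣-trans (ℤS.∣ᵤ⇒∣ N∣M) d)

  mod-% : ∀ a .{{_ : ℕ.NonZero N}} → a ≡ + (a ℤD.%ℕ N) [mod N ]
  mod-% a = mod (divides (a ℤD./ℕ N) (trans (cong (ℤ._- r) (ℤD.a≡a%ℕn+[a/ℕn]*n a N)) (e r (a ℤD./ℕ N) (+ N))))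
    where
    r = + (a ℤD.%ℕ N)
    e : ∀ r q n → (r ℤ.+ q ℤ.* n) ℤ.- r ≡ q ℤ.* n
    e = solve-∀

  mod-≤ : ∀ {m n} → m ℕ.≤ n → + m ≡ + n [mod N ] → ∃[ j ] n ≡ m ℕ.+ j ℕ.* N
  mod-≤ {m} {n} m≤n c = ℕD.quotient N∣n∸m ,
    trans (sym (ℕP.m+[n∸m]≡n m≤n)) (cong (m ℕ.+_) (ℕD._∣_.equality N∣n∸m))
    where
    N∣n∸m : N ℕD.∣ n ℕ.∸ m
    N∣n∸m = subst (N ℕD.∣_) (cong ∣_∣ (trans (ℤP.[+m]-[+n]≡m⊖n n m) (ℤP.⊖-≥ m≤n)))
      (ℤS.∣⇒∣ᵤ (divides-difference (mod-sym c)))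

  mod-small-≤ : ∀ {m n} → m ℕ.≤ n → n ℕ.< N → + m ≡ + n [mod N ] → m ≡ n
  mod-small-≤ {m} {n} m≤n n<N c = shifted (mod-≤ m≤n c)
    where
    shifted : ∃[ j ] n ≡ m ℕ.+ j ℕ.* N → m ≡ n
    shifted (zero  , eq) = sym (trans eq (ℕP.+-identityʳ m))
    shifted (suc j , eq) = contradiction n<N (ℕP.≤⇒≯
      (subst (N ℕ.≤_) (sym eq) (ℕP.≤-trans (ℕP.m≤m+n N (j ℕ.* N)) (ℕP.m≤n+m _ m))))

  mod-small : ∀ {m n} → m ℕ.< N → n ℕ.< N → + m ≡ + n [mod N ] → m ≡ n
  mod-small {m} {n} m<N n<N c =
    [ (λ m≤n → mod-small-≤ m≤n n<N c)
    , (λ n≤m → sym (mod-small-≤ n≤m m<N (mod-sym c)))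
    ]′ (ℕP.≤-total m n)

open Congruence public

mod-1 : ∀ {a b} → a ≡ b [mod 1 ]
mod-1 {a} {b} = mod (divides (a ℤ.- b) (sym (ℤP.*-identityʳ _)))

opaque
  coprime-inverse : ∀ a N → Cop.Coprime ∣ a ∣ N → ∃[ b ] a ℤ.* b ≡ 1ℤ [mod N ]
  coprime-inverse (+ m) N c with Cop.coprime-Bézout c
  ... | Bézout.+- x y eq = + x , mod (divides (+ y) (trans
          (cong (λ t → + m ℤ.* + x ℤ.- t) (e₁ (+ y) (+ N)))
          (trans (cong (λ t → t ℤ.- ((1ℤ ℤ.+ + y ℤ.* + N) ℤ.- + y ℤ.* + N)) (trans (ℤP.*-comm (+ m) (+ x)) lifted)) (e₂ (+ y ℤ.* + N)))))
    where
    lifted : + x ℤ.* + m ≡ 1ℤ ℤ.+ + y ℤ.* + N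
    lifted = trans (sym (ℤP.pos-* x m)) (trans (cong +_ (sym eq)) (cong (λ t → 1ℤ ℤ.+ t) (ℤP.pos-* y N)))
    e₁ : ∀ a b → 1ℤ ≡ (1ℤ ℤ.+ a ℤ.* b) ℤ.- a ℤ.* b
    e₁ = solve-∀
    e₂ : ∀ a → (1ℤ ℤ.+ a) ℤ.- ((1ℤ ℤ.+ a) ℤ.- a) ≡ a
    e₂ = solve-∀
  ... | Bézout.-+ x y eq = ℤ.- + x , mod (divides (ℤ.- + y)
          (trans (e (+ m) (+ x)) (trans (cong ℤ.-_ lifted) (ℤP.neg-distribˡ-* (+ y) (+ N)))))
    where
    lifted : 1ℤ ℤ.+ + x ℤ.* + m ≡ + y ℤ.* + N
    lifted = trans (cong (λ t → 1ℤ ℤ.+ t) (sym (ℤP.pos-* x m))) (trans (cong +_ eq) (ℤP.pos-* y N))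
    e : ∀ a b → a ℤ.* (ℤ.- b) ℤ.- 1ℤ ≡ ℤ.- (1ℤ ℤ.+ b ℤ.* a)
    e = solve-∀
  coprime-inverse -[1+ m ] N c with coprime-inverse (+ suc m) N c
  ... | b , h = ℤ.- b , subst (_≡ 1ℤ [mod N ]) (e (+ suc m) b) h
    where
    e : ∀ a b → a ℤ.* b ≡ (ℤ.- a) ℤ.* (ℤ.- b)
    e = solve-∀

unique-inverse : ∀ {N} a a′ b b′ → a ≡ a′ [mod N ] →
                 a ℤ.* b ≡ 1ℤ [mod N ] → a′ ℤ.* b′ ≡ 1ℤ [mod N ] → b ≡ b′ [mod N ]
unique-inverse {N} a a′ b b′ a≡a′ h h′ =
  mod-trans b≡b[a′b′] (mod-trans b[a′b′]≡[ab]b′ [ab]b′≡b′)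
  where
  e : ∀ b a b′ → b ℤ.* (a ℤ.* b′) ≡ (a ℤ.* b) ℤ.* b′
  e = solve-∀
  b≡b[a′b′] : b ≡ b ℤ.* (a′ ℤ.* b′) [mod N ]
  b≡b[a′b′] = subst (_≡ b ℤ.* (a′ ℤ.* b′) [mod N ]) (ℤP.*-identityʳ b) (mod-* (mod-refl {a = b}) (mod-sym h′))
  b[a′b′]≡[ab]b′ : b ℤ.* (a′ ℤ.* b′) ≡ (a ℤ.* b) ℤ.* b′ [mod N ]
  b[a′b′]≡[ab]b′ = subst (λ t → t ≡ (a ℤ.* b) ℤ.* b′ [mod N ]) (sym (e b a′ b′))
    (mod-* (mod-* (mod-sym a≡a′) (mod-refl {a = b})) (mod-refl {a = b′}))
  [ab]b′≡b′ : (a ℤ.* b) ℤ.* b′ ≡ b′ [mod N ]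
  [ab]b′≡b′ = subst (λ t → (a ℤ.* b) ℤ.* b′ ≡ t [mod N ]) (ℤP.*-identityˡ b′) (mod-* h (mod-refl {a = b′}))

extract : ∀ {x : ℕ} {xs} → x ∈ xs → ∃[ ys ] xs ↭ x ∷ ys
extract {x} x∈xs with ∈-∃++ x∈xs
... | ys , zs , refl = ys ++ zs , shift x ys zs

unique-↭ : ∀ {xs ys : List ℕ} → xs ↭ ys → Unique xs → Unique ys
unique-↭ p = PermS.Unique-resp-↭ (setoid ℕ) (↭⇒↭ₛ p)

unique-head : ∀ {x y : ℕ} {xs} → Unique (x ∷ xs) → y ∈ xs → y ≢ x
unique-head (px AllPairs.∷ _) y∈xs refl = All.lookup px y∈xs refl

unique-tail : ∀ {x : ℕ} {xs} → Unique (x ∷ xs) → Unique xs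
unique-tail (_ AllPairs.∷ u) = u

∈-uncons : ∀ {x y : ℕ} {xs} → y ∈ x ∷ xs → y ≢ x → y ∈ xs
∈-uncons (here eq) ne = contradiction eq ne
∈-uncons (there m) _  = m

-- Pairing every element with its inverse makes the product 1.

module Pairing (N : ℕ) (inv : ℕ → ℕ) where

  Paired : List ℕ → Set
  Paired xs = ∀ {x} → x ∈ xs →
    inv x ∈ xs × inv (inv x) ≡ x × inv x ≢ x × (+ (x ℕ.* inv x) ≡ 1ℤ [mod N ])

  product-paired : ∀ n xs → length xs ℕ.≤ n → Unique xs → Paired xs → + product xs ≡ 1ℤ [mod N ]
  product-paired n [] _ _ _ = mod-refl
  product-paired (suc n) (x ∷ xs) (s≤s len) u paired
    with paired (here refl)
  ... | ix∈ , iix , ix≢x , prod with extract (∈-uncons ix∈ ix≢x)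
  ...   | ys , xs↭ =
    mod-trans (≡-to-mod (cong +_ (trans (cong (x ℕ.*_) (product-↭ xs↭)) (sym (ℕP.*-assoc x (inv x) (product ys))))))
    (mod-trans (≡-to-mod (ℤP.pos-* (x ℕ.* inv x) (product ys)))
               (mod-* prod (product-paired n ys len′ (unique-tail u′) paired′)))
    where
    u′ : Unique (inv x ∷ ys)
    u′ = unique-↭ xs↭ (unique-tail u)
    len′ : length ys ℕ.≤ n
    len′ = ℕP.≤-trans (ℕP.n≤1+n _) (subst (ℕ._≤ n) (↭-length xs↭) len)
    paired′ : Paired ys
    paired′ {y} y∈ with paired (there (∈-resp-↭ (↭-sym xs↭) (there y∈)))
    ... | iy∈ , iiy , iy≢y , prod′ =
      ∈-uncons (∈-resp-↭ xs↭ (∈-uncons iy∈ iy≢x)) iy≢ix , iiy , iy≢y , prod′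
      where
      y∈xs = ∈-resp-↭ (↭-sym xs↭) (there y∈)
      iy≢x : inv y ≢ x
      iy≢x eq = unique-head u′ y∈ (trans (sym iiy) (cong inv eq))
      iy≢ix : inv y ≢ inv x
      iy≢ix eq = unique-head u y∈xs (trans (sym iiy) (trans (cong inv eq) iix))

module Padic (p : ℕ) (p-prime : Prime p) (p-odd : 2 ℕD.∤ p) where

  instance
    p≢0 : ℕ.NonZero p
    p≢0 = prime⇒nonZero p-prime

  p^n≢0 : ∀ n → ℕ.NonZero (p ℕ.^ n)
  p^n≢0 n = ℕP.m^n≢0 p n

  -- A p-adic integer is a coherent sequence of residues: residue n represents
  -- its class modulo p ^ n, so that ℤₚ is lim ℤ/pⁿℤ.

  record ℤₚ : Set where
    constructor mkℤₚ
    field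
      residue  : ℕ → ℤ
      coherent : ∀ n → residue (suc n) ≡ residue n [mod p ℕ.^ n ]

  open ℤₚ public

  infix 4 _≈_

  record _≈_ (x y : ℤₚ) : Set where
    constructor mk≈
    field
      residue≡ : ∀ n → residue x n ≡ residue y n [mod p ℕ.^ n ]

  open _≈_ public

  ι : ℤ → ℤₚ
  ι a = mkℤₚ (λ _ → a) λ _ → mod-refl

  private
    add mul : ℤₚ → ℤₚ → ℤₚ
    add (mkℤₚ x cx) (mkℤₚ y cy) = mkℤₚ (λ n → x n ℤ.+ y n) λ n → mod-+ (cx n) (cy n)
    mul (mkℤₚ x cx) (mkℤₚ y cy) = mkℤₚ (λ n → x n ℤ.* y n) λ n → mod-* (cx n) (cy n)

    neg : ℤₚ → ℤₚ
    neg (mkℤₚ x cx) = mkℤₚ (λ n → ℤ.- x n) λ n → mod-neg (cx n)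

    pointwise : ∀ {x y} → (∀ n → residue x n ≡ residue y n) → x ≈ y
    pointwise h = mk≈ λ n → ≡-to-mod (h n)

  ℤₚ-commutativeRing : CommutativeRing 0ℓ 0ℓ
  ℤₚ-commutativeRing = record
    { Carrier = ℤₚ
    ; _≈_ = _≈_
    ; _+_ = add
    ; _*_ = mul
    ; -_ = neg
    ; 0# = ι 0ℤ
    ; 1# = ι 1ℤ
    ; isCommutativeRing = record
      { isRing = record
        { +-isAbelianGroup = record
          { isGroup = record
            { isMonoid = record
              { isSemigroup = record
                { isMagma = record
                  { isEquivalence = record
                    { refl  = mk≈ λ _ → mod-refl
                    ; sym   = λ h → mk≈ λ n → mod-sym (residue≡ h n)
                    ; trans = λ h k → mk≈ λ n → mod-trans (residue≡ h n) (residue≡ k n)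
                    }
                  ; ∙-cong = λ h k → mk≈ λ n → mod-+ (residue≡ h n) (residue≡ k n)
                  }
                ; assoc = λ x y z → pointwise λ n → ℤP.+-assoc (residue x n) (residue y n) (residue z n)
                }
              ; identity = (λ x → pointwise λ n → ℤP.+-identityˡ (residue x n))
                         , (λ x → pointwise λ n → ℤP.+-identityʳ (residue x n))
              }
            ; inverse = (λ x → pointwise λ n → ℤP.+-inverseˡ (residue x n))
                      , (λ x → pointwise λ n → ℤP.+-inverseʳ (residue x n))
            ; ⁻¹-cong = λ h → mk≈ λ n → mod-neg (residue≡ h n)
            }
          ; comm = λ x y → pointwise λ n → ℤP.+-comm (residue x n) (residue y n)
          }
        ; *-cong = λ h k → mk≈ λ n → mod-* (residue≡ h n) (residue≡ k n)
        ; *-assoc = λ x y z → pointwise λ n → ℤP.*-assoc (residue x n) (residue y n) (residue z n)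
        ; *-identity = (λ x → pointwise λ n → ℤP.*-identityˡ (residue x n))
                     , (λ x → pointwise λ n → ℤP.*-identityʳ (residue x n))
        ; distrib = (λ x y z → pointwise λ n → ℤP.*-distribˡ-+ (residue x n) (residue y n) (residue z n))
                  , (λ x y z → pointwise λ n → ℤP.*-distribʳ-+ (residue x n) (residue y n) (residue z n))
        }
      ; *-comm = λ x y → pointwise λ n → ℤP.*-comm (residue x n) (residue y n)
      }
    }

  open CommutativeRing ℤₚ-commutativeRing public
    using (_+_; _*_; -_; _-_; 0#; 1#; semiring)

  open import Algebra.Properties.Semiring.Divisibility semiring public using (_∣_)
  open import Algebra.Properties.Semiring.Exp semiring public using (_^_)
  open import Algebra.Properties.Semiring.Sum semiring public using (sum-syntax; sum⁺-syntax)

  infix 4 _≡_[mod-p^_]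

  _≡_[mod-p^_] : ℤₚ → ℤₚ → ℕ → Set
  x ≡ y [mod-p^ n ] = ι (+ p) ^ n ∣ x - y

  pochhammer : ℤₚ → ℕ → ℤₚ
  pochhammer a zero    = 1#
  pochhammer a (suc k) = pochhammer a k * (a + ι (+ k))

  p-coprime : ∀ {a} → p ℕD.∤ a → ∀ n → Cop.Coprime a (p ℕ.^ n)
  p-coprime p∤a zero (_ , d∣1) = ℕD.∣1⇒≡1 d∣1
  p-coprime {a} p∤a (suc n) {d} (d∣a , d∣pᵏ) =
    p-coprime p∤a n (d∣a , Cop.coprime-divisor d⊥p d∣pᵏ)
    where
    d⊥p : Cop.Coprime d p
    d⊥p (e∣d , e∣p) with prime⇒irreducible p-prime e∣p
    ... | inj₁ e≡1  = e≡1
    ... | inj₂ refl = contradiction (ℕD.∣-trans e∣d d∣a) p∤a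

  p∣p^1+n : ∀ n → p ℕD.∣ p ℕ.^ suc n
  p∣p^1+n n = ℕD.m∣m*n (p ℕ.^ n)

  p^n∣p^1+n : ∀ n → p ℕ.^ n ℕD.∣ p ℕ.^ suc n
  p^n∣p^1+n n = ℕD.n∣m*n p

  p∣-resp : ∀ {a b} → a ≡ b [mod p ] → p ℕD.∣ ∣ a ∣ → p ℕD.∣ ∣ b ∣
  p∣-resp {a} {b} a≡b p∣a = ℤS.∣⇒∣ᵤ (subst (+ p ℤS.∣_) (e a b)
    (ℤS.∣m∣n⇒∣m+n (divides-difference (mod-sym a≡b)) (ℤS.∣ᵤ⇒∣ p∣a)))
    where
    e : ∀ a b → (b ℤ.- a) ℤ.+ a ≡ b
    e = solve-∀

  Unit : ℤₚ → Set
  Unit x = p ℕD.∤ ∣ residue x 1 ∣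

  residue-unit : ∀ x → Unit x → ∀ n → p ℕD.∤ ∣ residue x (suc n) ∣
  residue-unit x u zero    = u
  residue-unit x u (suc n) h = residue-unit x u n
    (p∣-resp (mod-down (p∣p^1+n n) (coherent x (suc n))) h)

  inverse-mod : ∀ x → Unit x → ∀ n → ∃[ b ] residue x n ℤ.* b ≡ 1ℤ [mod p ℕ.^ n ]
  inverse-mod x u zero    = 0ℤ , mod-1
  inverse-mod x u (suc n) = coprime-inverse (residue x (suc n)) (p ℕ.^ suc n) (p-coprime (residue-unit x u n) (suc n))

  unit-inverse : ∀ x → Unit x → ℤₚ
  unit-inverse x u = mkℤₚ (λ n → proj₁ (inverse-mod x u n)) λ n →
    unique-inverse (residue x (suc n)) (residue x n) _ _ (coherent x n)
      (mod-down (p^n∣p^1+n n) (proj₂ (inverse-mod x u (suc n))))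
      (proj₂ (inverse-mod x u n))

  -- x ⁻¹ is the inverse of a unit x, and by convention 0 at a non-unit, so x / y
  -- is the p-adic quotient whenever p does not divide y.

  inverse-or-0 : ∀ x → Dec (p ℕD.∣ ∣ residue x 1 ∣) → ℤₚ
  inverse-or-0 x (yes _) = 0#
  inverse-or-0 x (no  u) = unit-inverse x u

  infix 8 _⁻¹

  opaque
    _⁻¹ : ℤₚ → ℤₚ
    x ⁻¹ = inverse-or-0 x (p ℕD.∣? ∣ residue x 1 ∣)

    ⁻¹-inverse : ∀ x → Unit x → x * x ⁻¹ ≈ 1#
    ⁻¹-inverse x u = either (p ℕD.∣? ∣ residue x 1 ∣)
      where
      either : ∀ d → x * inverse-or-0 x d ≈ 1#
      either (yes p∣x) = contradiction p∣x u
      either (no  u′)  = mk≈ λ n → proj₂ (inverse-mod x u′ n)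

  infixl 7 _/_
  _/_ : ℤₚ → ℤₚ → ℤₚ
  x / y = x * y ⁻¹

  unit? : ∀ k → Dec (p ℕD.∤ k)
  unit? k = ¬? (p ℕD.∣? k)

  -- The k < n prime to p; k = 0 is excluded because p ∣ 0. In particular Γℕ 0 is 1.

  units : ℕ → List ℕ
  units n = filter unit? (upTo n)

  Γℕ : ℕ → ℤ
  Γℕ n = -1ℤ ℤ.^ n ℤ.* + product (units n)

  2<p : 2 ℕ.< p
  2<p = ℕP.≤∧≢⇒< (ℕ.nonTrivial⇒n>1 p {{prime⇒nonTrivial p-prime}}) λ { refl → p-odd ℕD.∣-refl }

  -- The product of the units modulo p ^ n is -1 when p is odd.

  module Wilson (m : ℕ) where

    N : ℕ
    N = p ℕ.^ suc m

    instance
      N≢0 : ℕ.NonZero N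
      N≢0 = p^n≢0 (suc m)

    p≤N : p ℕ.≤ N
    p≤N = ℕD.∣⇒≤ (p∣p^1+n m)

    2<N : 2 ℕ.< N
    2<N = ℕP.<-≤-trans 2<p p≤N

    ∈-units⁺ : ∀ {x} → x ℕ.< N → p ℕD.∤ x → x ∈ units N
    ∈-units⁺ x<N u = ∈-filter⁺ unit? (∈-upTo⁺ x<N) u

    ∈-units⁻ : ∀ {x} → x ∈ units N → x ℕ.< N × p ℕD.∤ x
    ∈-units⁻ x∈ with ∈-filter⁻ unit? {xs = upTo N} x∈
    ... | x∈upTo , u = ∈-upTo⁻ x∈upTo , u

    1-unit : p ℕD.∤ 1
    1-unit p∣1 = contradiction (ℕD.∣⇒≤ p∣1) (ℕP.<⇒≱ (ℕP.<-trans (s≤s (s≤s z≤n)) 2<p))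

    inv : ℕ → ℕ
    inv x with p ℕD.∣? x
    ... | yes _ = 0
    ... | no  u = proj₁ (coprime-inverse (+ x) N (p-coprime u (suc m))) ℤD.%ℕ N

    inv<N : ∀ x → inv x ℕ.< N
    inv<N x with p ℕD.∣? x
    ... | yes _ = ℕP.<-trans (s≤s z≤n) 2<N
    ... | no  u = ℤD.n%ℕd<d (proj₁ (coprime-inverse (+ x) N (p-coprime u (suc m)))) N

    inv-inverse : ∀ x → p ℕD.∤ x → + x ℤ.* + inv x ≡ 1ℤ [mod N ]
    inv-inverse x u with p ℕD.∣? x
    ... | yes p∣x = contradiction p∣x u
    ... | no  u′ = mod-trans (mod-* (mod-refl {a = + x}) (mod-sym (mod-% (proj₁ bezout)))) (proj₂ bezout)
      where bezout = coprime-inverse (+ x) N (p-coprime u′ (suc m))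

    inv-unit : ∀ x → p ℕD.∤ x → p ℕD.∤ inv x
    inv-unit x u p∣ix = 1-unit (p∣-resp (mod-down (p∣p^1+n m) (inv-inverse x u))
      (subst (p ℕD.∣_) (sym (ℤP.abs-* (+ x) (+ inv x))) (ℕD.∣n⇒∣m*n x p∣ix)))

    inv-involutive : ∀ x → x ℕ.< N → p ℕD.∤ x → inv (inv x) ≡ x
    inv-involutive x x<N u = mod-small (inv<N (inv x)) x<N
      (unique-inverse (+ inv x) (+ inv x) (+ inv (inv x)) (+ x) mod-refl (inv-inverse (inv x) (inv-unit x u))
        (subst (_≡ 1ℤ [mod N ]) (ℤP.*-comm (+ x) (+ inv x)) (inv-inverse x u)))

    -- A self-inverse residue is 1 or -1, as p cannot divide both x - 1 and x + 1.

    inv-fixed : ∀ x → x ℕ.< N → p ℕD.∤ x → inv x ≡ x → x ≢ 1 → suc x ≡ N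
    inv-fixed zero x<N u _ _ = contradiction (p ℕD.∣0) u
    inv-fixed (suc y) x<N u fix x≢1 with p ℕD.∣? y
    ... | no p∤y = ℕP.≤-antisym x<N (ℕD.∣⇒≤ (Cop.coprime-divisor (Cop.sym (p-coprime p∤y (suc m))) N∣))
      where
      e : ∀ a → (1ℤ ℤ.+ a) ℤ.* (1ℤ ℤ.+ a) ℤ.- 1ℤ ≡ a ℤ.* (1ℤ ℤ.+ (1ℤ ℤ.+ a))
      e = solve-∀
      N∣ : N ℕD.∣ y ℕ.* suc (suc y)
      N∣ = subst (N ℕD.∣_) (ℤP.abs-* (+ y) (+ suc (suc y)))
        (ℤS.∣⇒∣ᵤ (subst (+ N ℤS.∣_) (e (+ y))
          (divides-difference (subst (λ t → + suc y ℤ.* + t ≡ 1ℤ [mod N ]) fix (inv-inverse (suc y) u)))))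
    ... | yes p∣y = ⊥-elim (y≢0 (mod-small {n = 0} (ℕP.<-trans (ℕP.n<1+n y) x<N) (ℕP.<-trans (s≤s z≤n) 2<N) y≡0))
      where
      y≢0 : y ≢ 0
      y≢0 refl = x≢1 refl
      p∤2+y : p ℕD.∤ suc (suc y)
      p∤2+y h = contradiction (ℕD.∣⇒≤ (ℕD.∣m+n∣m⇒∣n (subst (p ℕD.∣_) (ℕP.+-comm 2 y) h) p∣y)) (ℕP.<⇒≱ 2<p)
      e : ∀ a → (1ℤ ℤ.+ a) ℤ.* (1ℤ ℤ.+ a) ℤ.- 1ℤ ≡ (1ℤ ℤ.+ (1ℤ ℤ.+ a)) ℤ.* a
      e = solve-∀
      N∣ : N ℕD.∣ suc (suc y) ℕ.* y
      N∣ = subst (N ℕD.∣_) (ℤP.abs-* (+ suc (suc y)) (+ y))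
        (ℤS.∣⇒∣ᵤ (subst (+ N ℤS.∣_) (e (+ y))
          (divides-difference (subst (λ t → + suc y ℤ.* + t ≡ 1ℤ [mod N ]) fix (inv-inverse (suc y) u)))))
      y≡0 : + y ≡ 0ℤ [mod N ]
      y≡0 = mod (subst (+ N ℤS.∣_) (sym (ℤP.+-identityʳ (+ y)))
        (ℤS.∣ᵤ⇒∣ (Cop.coprime-divisor (Cop.sym (p-coprime p∤2+y (suc m))) N∣)))

    open Pairing N inv

    -1ₙ : ℕ
    -1ₙ = ℕ.pred N

    1+-1ₙ : suc -1ₙ ≡ N
    1+-1ₙ = ℕP.suc-pred N

    -1ₙ≡-1 : + -1ₙ ≡ -1ℤ [mod N ]
    -1ₙ≡-1 = mod (divides 1ℤ (trans (cong +_ (trans (ℕP.+-comm -1ₙ 1) 1+-1ₙ)) (sym (ℤP.*-identityˡ (+ N)))))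

    1≢-1ₙ : -1ₙ ≢ 1
    1≢-1ₙ eq = ℕP.<⇒≢ 2<N (trans (sym (cong suc eq)) 1+-1ₙ)

    -1ₙ<N : -1ₙ ℕ.< N
    -1ₙ<N = ℕP.≤-reflexive 1+-1ₙ

    -1ₙ-unit : p ℕD.∤ -1ₙ
    -1ₙ-unit h = 1-unit (p∣-resp {+ -1ₙ} { -1ℤ} (mod-down (p∣p^1+n m) -1ₙ≡-1) h)

    inv-1 : inv 1 ≡ 1
    inv-1 = mod-small (inv<N 1) (ℕP.<-trans (s≤s (s≤s z≤n)) 2<N)
      (mod-trans (≡-to-mod (sym (ℤP.*-identityˡ (+ inv 1)))) (inv-inverse 1 1-unit))

    inv--1ₙ : inv -1ₙ ≡ -1ₙ
    inv--1ₙ = mod-small (inv<N -1ₙ) -1ₙ<N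
      (unique-inverse (+ -1ₙ) (+ -1ₙ) (+ inv -1ₙ) (+ -1ₙ) mod-refl (inv-inverse -1ₙ -1ₙ-unit) (mod-* -1ₙ≡-1 -1ₙ≡-1))

    wilson-remove : ∀ {xs ys} → units N ↭ 1 ∷ xs → xs ↭ -1ₙ ∷ ys → + product (units N) ≡ -1ℤ [mod N ]
    wilson-remove {xs} {ys} p₁ p₂ =
      mod-trans (≡-to-mod (trans (cong +_ eq) (ℤP.pos-* -1ₙ (product ys))))
                (mod-* -1ₙ≡-1 (product-paired _ ys ℕP.≤-refl (unique-tail u₂) paired))
      where
      u₁ : Unique (1 ∷ xs)
      u₁ = unique-↭ p₁ (UniqueP.filter⁺ unit? (UniqueP.upTo⁺ N))
      u₂ : Unique (-1ₙ ∷ ys)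
      u₂ = unique-↭ p₂ (unique-tail u₁)
      eq : product (units N) ≡ -1ₙ ℕ.* product ys
      eq = trans (product-↭ p₁) (trans (ℕP.*-identityˡ (product xs)) (product-↭ p₂))
      paired : Paired ys
      paired {y} y∈ =
        ∈-uncons (∈-resp-↭ p₂ (∈-uncons (∈-resp-↭ p₁ (∈-units⁺ (inv<N y) (inv-unit y y-unit))) iy≢1)) iy≢-1 ,
        iiy ,
        (λ fix → y≢-1 (ℕP.suc-injective (trans (inv-fixed y y<N y-unit fix y≢1) (sym 1+-1ₙ)))) ,
        mod-trans (≡-to-mod (ℤP.pos-* y (inv y))) (inv-inverse y y-unit)
        where
        y∈xs = ∈-resp-↭ (↭-sym p₂) (there y∈)
        y∈units = ∈-units⁻ (∈-resp-↭ (↭-sym p₁) (there y∈xs))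
        y<N = proj₁ y∈units
        y-unit = proj₂ y∈units
        y≢1 = unique-head u₁ y∈xs
        y≢-1 = unique-head u₂ y∈
        iiy = inv-involutive y y<N y-unit
        iy≢1 : inv y ≢ 1
        iy≢1 h = y≢1 (trans (sym iiy) (trans (cong inv h) inv-1))
        iy≢-1 : inv y ≢ -1ₙ
        iy≢-1 h = y≢-1 (trans (sym iiy) (trans (cong inv h) inv--1ₙ))

    wilson : + product (units N) ≡ -1ℤ [mod N ]
    wilson = wilson-remove (proj₂ without-1)
      (proj₂ (extract (∈-uncons (∈-resp-↭ (proj₂ without-1) (∈-units⁺ -1ₙ<N -1ₙ-unit)) 1≢-1ₙ)))
      where
      without-1 = extract (∈-units⁺ (ℕP.<-trans (s≤s (s≤s z≤n)) 2<N) 1-unit)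

  -1^p^n : ∀ n → -1ℤ ℤ.^ (p ℕ.^ n) ≡ -1ℤ
  -1^p^n zero    = refl
  -1^p^n (suc n) = trans (sym (ℤP.^-*-assoc -1ℤ p (p ℕ.^ n))) (trans (cong (ℤ._^ (p ℕ.^ n)) (odd p p-odd)) (-1^p^n n))
    where
    odd : ∀ k → 2 ℕD.∤ k → -1ℤ ℤ.^ k ≡ -1ℤ
    odd zero          h = contradiction (2 ℕD.∣0) h
    odd (suc zero)    h = refl
    odd (suc (suc k)) h = trans (e (-1ℤ ℤ.^ k)) (odd k λ d → h (ℕD.∣m∣n⇒∣m+n ℕD.∣-refl d))
      where
      e : ∀ a → -1ℤ ℤ.* (-1ℤ ℤ.* a) ≡ a
      e = solve-∀

  product-units-yes : ∀ n → p ℕD.∤ n → product (units (suc n)) ≡ product (units n) ℕ.* n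
  product-units-yes n u = trans
    (cong product (trans (cong (filter unit?) (sym (ListP.upTo-∷ʳ n)))
      (trans (ListP.filter-++ unit? (upTo n) [ n ]) (cong (units n ++_) (ListP.filter-accept unit? u)))))
    (trans (product-++ (units n) [ n ]) (cong (product (units n) ℕ.*_) (ℕP.*-identityʳ n)))

  product-units-no : ∀ n → p ℕD.∣ n → product (units (suc n)) ≡ product (units n)
  product-units-no n d = cong product (trans (cong (filter unit?) (sym (ListP.upTo-∷ʳ n)))
      (trans (ListP.filter-++ unit? (upTo n) [ n ])
        (trans (cong (units n ++_) (ListP.filter-reject unit? (λ u → u d))) (ListP.++-identityʳ (units n)))))

  +-mod : ∀ n N → + (n ℕ.+ N) ≡ + n [mod N ]
  +-mod n N = mod (divides 1ℤ (e (+ n) (+ N)))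
    where
    e : ∀ a b → (a ℤ.+ b) ℤ.- a ≡ 1ℤ ℤ.* b
    e = solve-∀

  product-units-shift : ∀ m n → let N = p ℕ.^ suc m in
    + product (units (n ℕ.+ N)) ≡ -1ℤ ℤ.* + product (units n) [mod N ]
  product-units-shift m zero    = Wilson.wilson m
  product-units-shift m (suc n) with p ℕD.∣? n
  ... | yes d = mod-trans (≡-to-mod (cong +_ (product-units-no (n ℕ.+ p ℕ.^ suc m) (ℕD.∣m∣n⇒∣m+n d (p∣p^1+n m)))))
      (mod-trans (product-units-shift m n) (≡-to-mod (cong (λ t → -1ℤ ℤ.* + t) (sym (product-units-no n d)))))
  ... | no u = mod-trans (≡-to-mod (trans (cong +_ (product-units-yes (n ℕ.+ p ℕ.^ suc m) u′)) (ℤP.pos-* (product (units (n ℕ.+ p ℕ.^ suc m))) (n ℕ.+ p ℕ.^ suc m))))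
      (mod-trans (mod-* (product-units-shift m n) (+-mod n (p ℕ.^ suc m)))
        (≡-to-mod (trans (ℤP.*-assoc -1ℤ (+ product (units n)) (+ n))
          (cong (-1ℤ ℤ.*_) (trans (sym (ℤP.pos-* (product (units n)) n)) (cong +_ (sym (product-units-yes n u))))))))
    where
    u′ : p ℕD.∤ n ℕ.+ p ℕ.^ suc m
    u′ h = u (ℕD.∣m+n∣m⇒∣n (subst (p ℕD.∣_) (ℕP.+-comm n _) h) (p∣p^1+n m))

  Γℕ-shift : ∀ m n → Γℕ (n ℕ.+ p ℕ.^ m) ≡ Γℕ n [mod p ℕ.^ m ]
  Γℕ-shift zero    n = mod-1
  Γℕ-shift (suc m) n =
    mod-trans (mod-* (≡-to-mod (trans (ℤP.^-distribˡ-+-* -1ℤ n (p ℕ.^ suc m)) (cong (-1ℤ ℤ.^ n ℤ.*_) (-1^p^n (suc m)))))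
                     (product-units-shift m n))
              (≡-to-mod (e (-1ℤ ℤ.^ n) (+ product (units n))))
    where
    e : ∀ a b → (a ℤ.* -1ℤ) ℤ.* (-1ℤ ℤ.* b) ≡ a ℤ.* b
    e = solve-∀

  Γℕ-shifts : ∀ m a j → Γℕ (a ℕ.+ j ℕ.* p ℕ.^ m) ≡ Γℕ a [mod p ℕ.^ m ]
  Γℕ-shifts m a zero    = ≡-to-mod (cong Γℕ (ℕP.+-identityʳ a))
  Γℕ-shifts m a (suc j) = mod-trans
    (≡-to-mod (cong Γℕ (sym (ℕP.+-assoc a (p ℕ.^ m) (j ℕ.* p ℕ.^ m)))))
    (mod-trans (Γℕ-shifts m (a ℕ.+ p ℕ.^ m) j) (Γℕ-shift m a))

  Γℕ-cong-≤ : ∀ m {a b} → a ℕ.≤ b → + a ≡ + b [mod p ℕ.^ m ] → Γℕ a ≡ Γℕ b [mod p ℕ.^ m ]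
  Γℕ-cong-≤ m {a} {b} a≤b c = shifted (mod-≤ a≤b c)
    where
    shifted : ∃[ j ] b ≡ a ℕ.+ j ℕ.* p ℕ.^ m → Γℕ a ≡ Γℕ b [mod p ℕ.^ m ]
    shifted (j , eq) = mod-sym (subst (λ t → Γℕ t ≡ Γℕ a [mod p ℕ.^ m ]) (sym eq) (Γℕ-shifts m a j))

  Γℕ-cong : ∀ m {a b} → + a ≡ + b [mod p ℕ.^ m ] → Γℕ a ≡ Γℕ b [mod p ℕ.^ m ]
  Γℕ-cong m {a} {b} c =
    [ (λ a≤b → Γℕ-cong-≤ m a≤b c)
    , (λ b≤a → mod-sym (Γℕ-cong-≤ m b≤a (mod-sym c)))
    ]′ (ℕP.≤-total a b)

  -- Morita's Γₚ. A natural number congruent to x modulo p ^ n determines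
  -- Γₚ x modulo p ^ n; Γₚ-limit below says that Γₚ x is the p-adic limit.

  reduce : ℤ → ℕ → ℕ
  reduce a n = (a ℤD.%ℕ p ℕ.^ n) {{p^n≢0 n}}

  mod-reduce : ∀ a n → a ≡ + reduce a n [mod p ℕ.^ n ]
  mod-reduce a n = mod-% a {{p^n≢0 n}}

  Γₚ : ℤₚ → ℤₚ
  Γₚ x = mkℤₚ (λ n → Γℕ (reduce (residue x n) n)) λ n → Γℕ-cong n
    (mod-trans (mod-sym (mod-down (p^n∣p^1+n n) (mod-reduce (residue x (suc n)) (suc n))))
      (mod-trans (coherent x n) (mod-reduce (residue x n) n)))

  Γₚ-limit : ∀ x n m → residue x n ≡ + m [mod p ℕ.^ n ] → residue (Γₚ x) n ≡ Γℕ m [mod p ℕ.^ n ]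
  Γₚ-limit x n m h = Γℕ-cong n (mod-trans (mod-sym (mod-reduce (residue x n) n)) h)

  Γₚ-ℕ : ∀ m → Γₚ (ι (+ m)) ≈ ι (Γℕ m)
  Γₚ-ℕ m = mk≈ λ n → Γₚ-limit (ι (+ m)) n m mod-refl

{-# OPTIONS --safe #-}
module Submission where

open import Algebra.Bundles using (CommutativeMonoid)
import Algebra.Solver.CommutativeMonoid
open import Data.Integer.Base as ℤ using (ℤ; +_; 1ℤ; ∣_∣)
open import Data.Integer.Coprimality using (Coprime)
import Data.Integer.Divisibility as ℤU
open import Data.Integer.Divisibility.Signed as ℤS using (divides)
import Data.Integer.Properties as ℤP
open import Data.Integer.Tactic.RingSolver using (solve-∀)
open import Data.Fin.Base as Fin using (Fin; toℕ)
open import Data.Fin.Properties using (toℕ<n)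
open import Data.Nat.Base as ℕ using (ℕ; zero; suc; z≤n; s≤s)
import Data.Nat.Divisibility as ℕD
open import Data.Nat.DivMod using (_%_; m≡m%n+[m/n]*n; m%n<n) renaming (_/_ to _div_)
open import Data.Nat.ListAction using (product)
open import Data.Nat.Primality using (Prime; prime?; prime⇒irreducible; euclidsLemma)
import Data.Nat.Properties as ℕP
import Data.Nat.Tactic.RingSolver as ℕSolver
open import Data.Product.Base using (∃-syntax; _,_; proj₁; proj₂)
open import Data.Sum.Base using (inj₁; inj₂)
open import Relation.Binary.Bundles using (Setoid)
open import Relation.Binary.PropositionalEquality hiding ([_]; J)
import Relation.Binary.Reasoning.Setoid as SetoidReasoning
open import Relation.Nullary using (¬_; Dec; yes; no; contradiction)
open import Relation.Nullary.Decidable using (from-yes)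
open import Defs

-- Write a = r/5, n = (p - r)/5 and π = p/5, so that a = π - n. Replacing four of the parameters a by a ± x, a ± y
-- turns the sum into a very-well-poised series F(x, y), even in x and y, and the reversal k ↦ n - k shows
-- F(0, 0) ≡ 2 F(π, 0) - F(π, π) modulo p⁵. Since a - π = -n, the series F(π, y) terminates, and the transformations
-- of Whipple and Sears evaluate it as p H(π, y), where H is a quotient of Gamma values times a balanced ₄F₃ with
-- numerator parameter (r - 1)/2. The function H is symmetric and, modulo p⁴, affine in x² and y², because
-- Γ(m + z) Γ(m - z) is a product of factors u² - z²; hence 2 H(π, 0) - H(π, π) ≡ H(0, 0), and p H(0, 0) is the
-- right-hand side. All series identities are polynomial identities over ℤ, applied to integer lifts of r/5 etc.

-- Terminating hypergeometric identities over ℤ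

-- The summand of F(x, y) is a weight times E(x) E(y), where E(x) = (a + x)_i (a - x)_i / ((1 + x)_i
-- (1 - x)_i). So F(0, 0) - 2 F(π, 0) + F(π, π) is the weighted sum of (E(π) - E(0))². As E is even,
-- this is π⁴ times a sum that need only vanish modulo p, and that sum changes sign under reversal.
-- Whipple's transformation takes a ₇F₆, whereas F(π, y) has one parameter too few. The missing one
-- is (1 + a)/2: it is its own partner, so its factors cancel. Up to a constant, H(x, y) is J(x, y)
-- q(x + y) q(x - y) / (θ(x) θ(y)), where J is the numerator of the ₄F₃, q(z) = Γ(a + z) Γ(a - z),
-- and θ is the same with 1/2 - r/10 for a. Knowing H modulo p⁴ is enough because p stands in front.
-- The bound on p amounts to 3n < p. It guarantees that each step Γ(x + 1) = -x Γ(x) used to absorb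
-- a Pochhammer symbol starts at a unit x. Since division is possible by units only, the series
-- identities are cleared of denominators, and units are cancelled after specialisation.

module Hypergeometric where

  open import Data.Integer.Base using (0ℤ; -1ℤ; _+_; _*_; _-_; -_)
  open ≡-Reasoning

  -- Rising factorials, binomial sums and balanced series

  poch : ℤ → ℕ → ℤ
  poch x zero    = 1ℤ
  poch x (suc k) = poch x k * (x + + k)

  sgn : ℕ → ℤ
  sgn zero    = 1ℤ
  sgn (suc k) = - sgn k

  poch-cong : ∀ {x y} k → x ≡ y → poch x k ≡ poch y k
  poch-cong k = cong (λ x → poch x k)

  poch-suc : ∀ x k → poch x (suc k) ≡ x * poch (1ℤ + x) k
  poch-suc x zero    = e x
    where e : ∀ x → 1ℤ * (x + 0ℤ) ≡ x * 1ℤ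
          e = solve-∀
  poch-suc x (suc k) = begin
    poch x (suc k) * (x + (1ℤ + + k))             ≡⟨ cong (_* (x + (1ℤ + + k))) (poch-suc x k) ⟩
    x * poch (1ℤ + x) k * (x + (1ℤ + + k))        ≡⟨ e x (poch (1ℤ + x) k) (+ k) ⟩
    x * (poch (1ℤ + x) k * (1ℤ + x + + k))        ∎
    where e : ∀ x q k → x * q * (x + (1ℤ + k)) ≡ x * (q * (1ℤ + x + k))
          e = solve-∀

  poch-+ : ∀ x j k → poch x (j ℕ.+ k) ≡ poch x j * poch (x + + j) k
  poch-+ x zero    k = trans (poch-cong k (e x)) (sym (ℤP.*-identityˡ _))
    where e : ∀ x → x ≡ x + 0ℤ
          e = solve-∀
  poch-+ x (suc j) k = begin
    poch x (suc (j ℕ.+ k))                              ≡⟨ poch-suc x (j ℕ.+ k) ⟩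
    x * poch (1ℤ + x) (j ℕ.+ k)                         ≡⟨ cong (x *_) (poch-+ (1ℤ + x) j k) ⟩
    x * (poch (1ℤ + x) j * poch (1ℤ + x + + j) k)       ≡⟨ ℤP.*-assoc x _ _ ⟨
    x * poch (1ℤ + x) j * poch (1ℤ + x + + j) k         ≡⟨ cong₂ _*_ (sym (poch-suc x j)) (poch-cong k (e x (+ j))) ⟩
    poch x (suc j) * poch (x + + suc j) k               ∎
    where e : ∀ x j → 1ℤ + x + j ≡ x + (1ℤ + j)
          e = solve-∀

  poch-reflect : ∀ x k → poch (1ℤ - + k - x) k ≡ sgn k * poch x k
  poch-reflect x zero    = refl
  poch-reflect x (suc k) = begin
    poch (1ℤ - + suc k - x) (suc k)                       ≡⟨ poch-suc _ k ⟩
    (1ℤ - + suc k - x) * poch (1ℤ + (1ℤ - + suc k - x)) k ≡⟨ cong ((1ℤ - + suc k - x) *_) (poch-cong k (e₁ x (+ k))) ⟩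
    (1ℤ - + suc k - x) * poch (1ℤ - + k - x) k            ≡⟨ cong ((1ℤ - + suc k - x) *_) (poch-reflect x k) ⟩
    (1ℤ - + suc k - x) * (sgn k * poch x k)               ≡⟨ e₂ x (+ k) (sgn k) (poch x k) ⟩
    - sgn k * (poch x k * (x + + k))                      ∎
    where e₁ : ∀ x k → 1ℤ + (1ℤ - (1ℤ + k) - x) ≡ 1ℤ - k - x
          e₁ = solve-∀
          e₂ : ∀ x k s q → (1ℤ - (1ℤ + k) - x) * (s * q) ≡ - s * (q * (x + k))
          e₂ = solve-∀

  poch-reflect′ : ∀ x y k → x + y ≡ 1ℤ - + k → poch x k ≡ sgn k * poch y k
  poch-reflect′ x y k h = trans (poch-cong k (trans (e x y) (cong (_- y) h))) (poch-reflect y k)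
    where e : ∀ x y → x ≡ x + y - y
          e = solve-∀

  sgn-+ : ∀ j k → sgn (j ℕ.+ k) ≡ sgn j * sgn k
  sgn-+ zero    k = sym (ℤP.*-identityˡ _)
  sgn-+ (suc j) k = trans (cong -_ (sgn-+ j k)) (ℤP.neg-distribˡ-* (sgn j) (sgn k))

  sgn² : ∀ k → sgn k * sgn k ≡ 1ℤ
  sgn² zero    = refl
  sgn² (suc k) = trans (e (sgn k)) (sgn² k)
    where e : ∀ a → - a * - a ≡ a * a
          e = solve-∀

  -- binSum n f is the sum of binom(n, i) f(i, n - i); this recursion keeps binomial coefficients out of sight.

  binSum : ℕ → (ℕ → ℕ → ℤ) → ℤ
  binSum zero    f = f 0 0
  binSum (suc n) f = binSum n (λ i l → f (suc i) l) + binSum n (λ i l → f i (suc l))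

  binSum-cong : ∀ n {f g} → (∀ i l → i ℕ.+ l ≡ n → f i l ≡ g i l) → binSum n f ≡ binSum n g
  binSum-cong zero    h = h 0 0 refl
  binSum-cong (suc n) h = cong₂ _+_
    (binSum-cong n λ i l e → h (suc i) l (cong suc e))
    (binSum-cong n λ i l e → h i (suc l) (trans (ℕP.+-suc i l) (cong suc e)))

  binSum-+ : ∀ n f g → binSum n (λ i l → f i l + g i l) ≡ binSum n f + binSum n g
  binSum-+ zero    f g = refl
  binSum-+ (suc n) f g = trans (cong₂ _+_ (binSum-+ n _ _) (binSum-+ n _ _)) (e (binSum n _) (binSum n _) (binSum n _) (binSum n _))
    where e : ∀ a b c d → (a + b) + (c + d) ≡ (a + c) + (b + d)
          e = solve-∀

  binSum-* : ∀ n c f → binSum n (λ i l → c * f i l) ≡ c * binSum n f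
  binSum-* zero    c f = refl
  binSum-* (suc n) c f = trans (cong₂ _+_ (binSum-* n c _) (binSum-* n c _)) (sym (ℤP.*-distribˡ-+ c (binSum n _) (binSum n _)))

  binSum-suc : ∀ n f → binSum (suc n) f ≡ binSum n (λ i l → f (suc i) l + f i (suc l))
  binSum-suc n f = sym (binSum-+ n _ _)

  -- Both sides are the trinomial sum of n! / (i! m! l!) times `f i m l`; the induction raises each
  -- of the three indices once.
  binSum-assoc : ∀ n (f : ℕ → ℕ → ℕ → ℤ) →
    binSum n (λ j l → binSum j (λ i m → f i m l)) ≡ binSum n (λ i t → binSum t (λ m l → f i m l))
  binSum-assoc zero    f = refl
  binSum-assoc (suc n) f = begin
    binSum n (λ j l → binSum j (λ i m → f (suc i) m l) + binSum j (λ i m → f i (suc m) l)) + binSum n (λ j l → binSum j (λ i m → f i m (suc l)))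
      ≡⟨ cong (λ t → t + binSum n (λ j l → binSum j (λ i m → f i m (suc l)))) (binSum-+ n _ _) ⟩
    binSum n (λ j l → binSum j (λ i m → f (suc i) m l)) + binSum n (λ j l → binSum j (λ i m → f i (suc m) l)) + binSum n (λ j l → binSum j (λ i m → f i m (suc l)))
      ≡⟨ cong₂ _+_ (cong₂ _+_ (binSum-assoc n (λ i → f (suc i))) (binSum-assoc n (λ i m → f i (suc m)))) (binSum-assoc n (λ i m l → f i m (suc l))) ⟩
    binSum n (λ i t → binSum t (λ m l → f (suc i) m l)) + binSum n (λ i t → binSum t (λ m l → f i (suc m) l)) + binSum n (λ i t → binSum t (λ m l → f i m (suc l)))
      ≡⟨ ℤP.+-assoc (binSum n _) (binSum n _) (binSum n _) ⟩
    binSum n (λ i t → binSum t (λ m l → f (suc i) m l)) + (binSum n (λ i t → binSum t (λ m l → f i (suc m) l)) + binSum n (λ i t → binSum t (λ m l → f i m (suc l))))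
      ≡⟨ cong (λ t → binSum n _ + t) (binSum-+ n _ _) ⟨
    binSum n (λ i t → binSum t (λ m l → f (suc i) m l)) + binSum n (λ i t → binSum t (λ m l → f i (suc m) l) + binSum t (λ m l → f i m (suc l))) ∎

  binSum-flip : ∀ n f → binSum n f ≡ binSum n (λ i l → f l i)
  binSum-flip zero    f = refl
  binSum-flip (suc n) f = trans (ℤP.+-comm (binSum n _) (binSum n _)) (cong₂ _+_ (binSum-flip n _) (binSum-flip n _))

  binSum-last : ∀ n f → (∀ i l → f i (suc l) ≡ 0ℤ) → binSum n f ≡ f n 0
  binSum-last zero    f h = refl
  binSum-last (suc n) f h = trans (cong₂ _+_ (binSum-last n _ (λ i l → h (suc i) l)) (trans (binSum-cong n (λ i l _ → h i l)) (binSum-0 n))) (ℤP.+-identityʳ _)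
    where
    binSum-0 : ∀ n → binSum n (λ _ _ → 0ℤ) ≡ 0ℤ
    binSum-0 zero    = refl
    binSum-0 (suc n) = cong₂ _+_ (binSum-0 n) (binSum-0 n)

  -- The Pfaff-Saalschütz sum of a balanced ₃F₂. Pascal's rule makes the summand at K + 1 a
  -- combination of summands at K with `P` or `U` raised by 1, and both of these are balanced again.
  saalschütz : ∀ K P Q U V → P + Q + U + V ≡ 1ℤ - + K →
    binSum K (λ m l → sgn m * (poch P m * poch Q m) * (poch U l * poch V l)) ≡ sgn K * (poch (P + U) K * poch (Q + U) K)
  saalschütz zero    P Q U V h = refl
  saalschütz (suc K) P Q U V h = begin
    binSum (suc K) f                                         ≡⟨ binSum-suc K f ⟩
    binSum K (λ m l → f (suc m) l + f m (suc l))             ≡⟨ binSum-cong K split ⟩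
    binSum K (λ m l → α * g m l + β * g′ m l)                ≡⟨ binSum-+ K _ _ ⟩
    binSum K (λ m l → α * g m l) + binSum K (λ m l → β * g′ m l)  ≡⟨ cong₂ _+_ (binSum-* K α g) (binSum-* K β g′) ⟩
    α * binSum K g + β * binSum K g′                              ≡⟨ cong₂ (λ s t → α * s + β * t) ih ih′ ⟩
    α * (sgn K * (poch (1ℤ + P + U) K * poch w K)) + β * (sgn K * (poch (P + (1ℤ + U)) K * poch (Q + (1ℤ + U)) K))
      ≡⟨ cong₂ (λ s t → α * (sgn K * (poch (1ℤ + P + U) K * poch w K)) + β * (sgn K * (s * t))) (poch-cong K (e₁ P U)) (poch-cong K (e₂ Q U)) ⟩
    α * (sgn K * (R * poch w K)) + β * (sgn K * (R * poch (1ℤ + w) K))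
      ≡⟨ e₃ P Q U (+ K) (sgn K) R (poch w K) (poch (1ℤ + w) K) ⟩
    - sgn K * (P * R * (poch w K * (w + + K)) + U * R * (w * poch (1ℤ + w) K))
      ≡⟨ cong (λ t → - sgn K * (P * R * poch w (suc K) + U * R * t)) (sym (poch-suc w K)) ⟩
    - sgn K * (P * R * poch w (suc K) + U * R * poch w (suc K))
      ≡⟨ e₄ P U (sgn K) R (poch w (suc K)) ⟩
    - sgn K * ((P + U) * R * poch w (suc K))
      ≡⟨ cong (λ t → - sgn K * (t * poch w (suc K))) (trans (cong (λ t → (P + U) * t) (poch-cong K (ℤP.+-assoc 1ℤ P U))) (sym (poch-suc (P + U) K))) ⟩
    - sgn K * (poch (P + U) (suc K) * poch w (suc K)) ∎
    where
    w α β R : ℤ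
    w = Q + U
    α = - (w + + K) * P
    β = - w * U
    R = poch (1ℤ + P + U) K
    f g g′ : ℕ → ℕ → ℤ
    f m l = sgn m * (poch P m * poch Q m) * (poch U l * poch V l)
    g m l = sgn m * (poch (1ℤ + P) m * poch Q m) * (poch U l * poch V l)
    g′ m l = sgn m * (poch P m * poch Q m) * (poch (1ℤ + U) l * poch V l)
    V≡ : V ≡ - + K - P - Q - U
    V≡ = trans (e P Q U V) (trans (cong (_- (P + Q + U)) h) (e′ P Q U (+ K)))
      where e : ∀ P Q U V → V ≡ P + Q + U + V - (P + Q + U)
            e = solve-∀
            e′ : ∀ P Q U K → 1ℤ - (1ℤ + K) - (P + Q + U) ≡ - K - P - Q - U
            e′ = solve-∀
    ih : binSum K g ≡ sgn K * (poch (1ℤ + P + U) K * poch w K)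
    ih = saalschütz K (1ℤ + P) Q U V (trans (cong (λ t → 1ℤ + P + Q + U + t) V≡) (e P Q U (+ K)))
      where e : ∀ P Q U K → 1ℤ + P + Q + U + (- K - P - Q - U) ≡ 1ℤ - K
            e = solve-∀
    ih′ : binSum K g′ ≡ sgn K * (poch (P + (1ℤ + U)) K * poch (Q + (1ℤ + U)) K)
    ih′ = saalschütz K P Q (1ℤ + U) V (trans (cong (λ t → P + Q + (1ℤ + U) + t) V≡) (e P Q U (+ K)))
      where e : ∀ P Q U K → P + Q + (1ℤ + U) + (- K - P - Q - U) ≡ 1ℤ - K
            e = solve-∀
    e₁ : ∀ P U → P + (1ℤ + U) ≡ 1ℤ + P + U
    e₁ = solve-∀
    e₂ : ∀ Q U → Q + (1ℤ + U) ≡ 1ℤ + (Q + U)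
    e₂ = solve-∀
    e₃ : ∀ P Q U K s R x y → - (Q + U + K) * P * (s * (R * x)) + - (Q + U) * U * (s * (R * y))
         ≡ - s * (P * R * (x * (Q + U + K)) + U * R * ((Q + U) * y))
    e₃ = solve-∀
    e₄ : ∀ P U s R x → - s * (P * R * x + U * R * x) ≡ - s * ((P + U) * R * x)
    e₄ = solve-∀
    split : ∀ m l → m ℕ.+ l ≡ K → f (suc m) l + f m (suc l) ≡ α * g m l + β * g′ m l
    split m l refl = begin
      - s * (poch P m * (P + + m) * (Qm * (Q + + m))) * (poch U l * Vl) + s * (poch P m * Qm) * (poch U l * (U + + l) * (Vl * (V + + l)))
        ≡⟨ e₅ s (poch P m) Qm (poch U l) Vl P Q U (V + + l) (+ m) (+ l) ⟩
      s * (Qm * Vl) * (poch P m * poch U l) * ((U + + l) * (V + + l) - (P + + m) * (Q + + m))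
        ≡⟨ cong (λ t → s * (Qm * Vl) * (poch P m * poch U l) * ((U + + l) * t - (P + + m) * (Q + + m))) (trans (cong (λ t → t + + l) V≡) (e₆ P Q U (+ m) (+ l))) ⟩
      s * (Qm * Vl) * (poch P m * poch U l) * ((U + + l) * (- + m - P - Q - U) - (P + + m) * (Q + + m))
        -- Balance turns the bracket into a combination of P + m and U + l, exactly the factors that
        -- raise `P` and `U`.
        ≡⟨ e₇ s (poch P m) Qm (poch U l) Vl P Q U (+ m) (+ l) ⟩
      - (Q + U + (+ m + + l)) * (s * (poch P m * (P + + m) * Qm) * (poch U l * Vl)) + - (Q + U) * (s * (poch P m * Qm) * (poch U l * (U + + l) * Vl))
        ≡⟨ cong₂ (λ x y → - (w + + (m ℕ.+ l)) * (s * (x * Qm) * (poch U l * Vl)) + - w * (s * (poch P m * Qm) * (y * Vl))) (poch-suc P m) (poch-suc U l) ⟩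
      - (w + + (m ℕ.+ l)) * (s * (P * poch (1ℤ + P) m * Qm) * (poch U l * Vl)) + - w * (s * (poch P m * Qm) * (U * poch (1ℤ + U) l * Vl))
        ≡⟨ e₈ (w + + (m ℕ.+ l)) w s P U (poch (1ℤ + P) m) Qm (poch U l) Vl (poch P m) (poch (1ℤ + U) l) ⟩
      - (w + + (m ℕ.+ l)) * P * g m l + - w * U * g′ m l ∎
      where
      s Qm Vl : ℤ
      s = sgn m
      Qm = poch Q m
      Vl = poch V l
      e₅ : ∀ s a b c d P Q U V m l → - s * (a * (P + m) * (b * (Q + m))) * (c * d) + s * (a * b) * (c * (U + l) * (d * V))
           ≡ s * (b * d) * (a * c) * ((U + l) * V - (P + m) * (Q + m))
      e₅ = solve-∀
      e₆ : ∀ P Q U m l → - (m + l) - P - Q - U + l ≡ - m - P - Q - U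
      e₆ = solve-∀
      e₇ : ∀ s a b c d P Q U m l → s * (b * d) * (a * c) * ((U + l) * (- m - P - Q - U) - (P + m) * (Q + m))
           ≡ - (Q + U + (m + l)) * (s * (a * (P + m) * b) * (c * d)) + - (Q + U) * (s * (a * b) * (c * (U + l) * d))
      e₇ = solve-∀
      e₈ : ∀ z w s P U a b c d a′ c′ → - z * (s * (P * a * b) * (c * d)) + - w * (s * (a′ * b) * (U * c′ * d))
           ≡ - z * P * (s * (a * b) * (c * d)) + - w * U * (s * (a′ * b) * (c′ * d))
      e₈ = solve-∀

  -- The balanced series (a′)ₙ (b′)ₙ (c′)ₙ ₄F₃(-n, a, b, c; 1 - n - a′, 1 - n - b′, 1 - n - c′; 1), free of denominators.
  M : ℕ → (a b c a′ b′ c′ : ℤ) → ℤ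
  M n a b c a′ b′ c′ = binSum n (λ j l → poch a j * poch b j * poch c j * (poch a′ l * poch b′ l * poch c′ l))

  poch-shift : ∀ x j m k → m ≡ j ℕ.+ k → poch x m ≡ poch x j * poch (x + + j) k
  poch-shift x j m k refl = poch-+ x j k

  -- Saalschütz read backwards linearises a product. `V` is chosen so that (V)_m reflects to (D +
  -- i)_m, and the signs (-1)^i and (-1)^m are absorbed by (-1)^k.
  saalschütz-dual : ∀ k D b c →
    poch (D - b) k * poch (D - c) k ≡ binSum k (λ i m → poch b i * poch c i * (poch (D - b - c) m * poch (D + + i) m))
  saalschütz-dual k D b c = begin
    poch (D - b) k * poch (D - c) k   ≡⟨ cong₂ _*_ (poch-cong k (e₁ D b c)) (poch-cong k (e₂ D b c)) ⟩
    Y * X                             ≡⟨ sym (trans (cong (_* (Y * X)) (sgn² k)) (ℤP.*-identityˡ _)) ⟩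
    sgn k * sgn k * (Y * X)           ≡⟨ e₃ (sgn k) X Y ⟩
    sgn k * (sgn k * (X * Y))         ≡⟨ cong (sgn k *_) (sym (saalschütz k b c (D - b - c) V (e₄ D b c (+ k)))) ⟩
    sgn k * binSum k (λ i m → sgn i * (poch b i * poch c i) * (poch (D - b - c) m * poch V m)) ≡⟨ binSum-* k (sgn k) _ ⟨
    binSum k (λ i m → sgn k * (sgn i * (poch b i * poch c i) * (poch (D - b - c) m * poch V m))) ≡⟨ binSum-cong k term ⟩
    _ ∎
    where
    V X Y : ℤ
    V = 1ℤ - D - + k
    X = poch (b + (D - b - c)) k
    Y = poch (c + (D - b - c)) k
    e₁ : ∀ D b c → D - b ≡ c + (D - b - c)
    e₁ = solve-∀
    e₂ : ∀ D b c → D - c ≡ b + (D - b - c)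
    e₂ = solve-∀
    e₃ : ∀ s x y → s * s * (y * x) ≡ s * (s * (x * y))
    e₃ = solve-∀
    e₄ : ∀ D b c k → b + c + (D - b - c) + (1ℤ - D - k) ≡ 1ℤ - k
    e₄ = solve-∀
    term : ∀ i m → i ℕ.+ m ≡ k → sgn k * (sgn i * (poch b i * poch c i) * (poch (D - b - c) m * poch V m))
                                ≡ poch b i * poch c i * (poch (D - b - c) m * poch (D + + i) m)
    term i m refl = begin
      sgn (i ℕ.+ m) * (sgn i * (poch b i * poch c i) * (poch (D - b - c) m * poch V m))
        ≡⟨ cong₂ (λ s t → s * (sgn i * (poch b i * poch c i) * (poch (D - b - c) m * t))) (sgn-+ i m)
             (poch-reflect′ V (D + + i) m (e₅ D (+ i) (+ m))) ⟩
      sgn i * sgn m * (sgn i * (poch b i * poch c i) * (poch (D - b - c) m * (sgn m * poch (D + + i) m)))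
        ≡⟨ e₆ (sgn i) (sgn m) (poch b i * poch c i) (poch (D - b - c) m) (poch (D + + i) m) ⟩
      sgn i * sgn i * (sgn m * sgn m) * (poch b i * poch c i * (poch (D - b - c) m * poch (D + + i) m))
        ≡⟨ cong₂ (λ s t → s * t * (poch b i * poch c i * (poch (D - b - c) m * poch (D + + i) m))) (sgn² i) (sgn² m) ⟩
      1ℤ * (poch b i * poch c i * (poch (D - b - c) m * poch (D + + i) m))
        ≡⟨ ℤP.*-identityˡ _ ⟩
      poch b i * poch c i * (poch (D - b - c) m * poch (D + + i) m) ∎
      where
      e₅ : ∀ D i m → 1ℤ - D - (i + m) + (D + i) ≡ 1ℤ - m
      e₅ = solve-∀
      e₆ : ∀ s t x y z → s * t * (s * x * (y * (t * z))) ≡ s * s * (t * t) * (x * (y * z))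
      e₆ = solve-∀

  -- Expanding the two transformed numerator factors by `saalschütz-dual` at D = 1 - n - A′ creates
  -- (D + i)_m. This reflects to (A′ + t)_m and merges with (A′)_t into a factor depending on m + t
  -- only. For fixed i the remaining sum is balanced, and `saalschütz` evaluates it.
  sears : ∀ n A b c A′ b′ c′ → A + b + c + A′ + b′ + c′ ≡ + 2 - + 2 * + n →
    let σ = 1ℤ - + n in
    M n A b c A′ b′ c′ ≡ M n A (σ - A′ - b) (σ - A′ - c) A′ (σ - A - b′) (σ - A - c′)
  sears n A b c A′ b′ c′ h = sym (begin
    binSum n (λ j t → poch A j * poch (D - b) j * poch (D - c) j * (poch A′ t * poch U t * poch V t))
      ≡⟨ binSum-cong n expand ⟩
    binSum n (λ j t → binSum j (λ i m → poch A j * (poch b i * poch c i * (poch Q m * poch (D + + i) m)) * (poch A′ t * poch U t * poch V t)))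
      ≡⟨ binSum-cong n (λ j t e → binSum-cong j (λ i m e′ → term i m j t e′ (trans (cong (ℕ._+ t) e′) e))) ⟩
    binSum n (λ j t → binSum j (λ i m → Φ i m t)) ≡⟨ binSum-assoc n Φ ⟩
    binSum n (λ i s → binSum s (λ m t → Φ i m t)) ≡⟨ binSum-cong n inner ⟩
    M n A b c A′ b′ c′ ∎)
    where
    σ D U V Q : ℤ
    σ = 1ℤ - + n
    D = σ - A′
    U = σ - A - b′
    V = σ - A - c′
    Q = D - b - c
    Φ : ℕ → ℕ → ℕ → ℤ
    Φ i m t = poch A i * poch b i * poch c i * poch A′ (m ℕ.+ t) * (sgn m * (poch (A + + i) m * poch Q m) * (poch U t * poch V t))
    expand : ∀ j t → j ℕ.+ t ≡ n → poch A j * poch (D - b) j * poch (D - c) j * (poch A′ t * poch U t * poch V t)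
      ≡ binSum j (λ i m → poch A j * (poch b i * poch c i * (poch Q m * poch (D + + i) m)) * (poch A′ t * poch U t * poch V t))
    expand j t _ = begin
      poch A j * poch (D - b) j * poch (D - c) j * Z     ≡⟨ e (poch A j) (poch (D - b) j) (poch (D - c) j) Z ⟩
      poch A j * Z * (poch (D - b) j * poch (D - c) j)   ≡⟨ cong (poch A j * Z *_) (saalschütz-dual j D b c) ⟩
      poch A j * Z * binSum j (λ i m → poch b i * poch c i * (poch Q m * poch (D + + i) m)) ≡⟨ binSum-* j (poch A j * Z) _ ⟨
      binSum j (λ i m → poch A j * Z * (poch b i * poch c i * (poch Q m * poch (D + + i) m)))
        ≡⟨ binSum-cong j (λ i m _ → e′ (poch A j) Z (poch b i * poch c i * (poch Q m * poch (D + + i) m))) ⟩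
      _ ∎
      where
      Z = poch A′ t * poch U t * poch V t
      e : ∀ a x y z → a * x * y * z ≡ a * z * (x * y)
      e = solve-∀
      e′ : ∀ a z x → a * z * x ≡ a * x * z
      e′ = solve-∀
    term : ∀ i m j t → i ℕ.+ m ≡ j → i ℕ.+ m ℕ.+ t ≡ n →
      poch A j * (poch b i * poch c i * (poch Q m * poch (D + + i) m)) * (poch A′ t * poch U t * poch V t) ≡ Φ i m t
    term i m j t refl refl = begin
      poch A (i ℕ.+ m) * (poch b i * poch c i * (poch Q m * poch (D + + i) m)) * (poch A′ t * poch U t * poch V t)
        ≡⟨ cong₂ (λ x y → x * (poch b i * poch c i * (poch Q m * y)) * (poch A′ t * poch U t * poch V t)) (poch-+ A i m)
            (poch-reflect′ (D + + i) (A′ + + t) m (e₁ A′ (+ i) (+ m) (+ t))) ⟩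
      poch A i * poch (A + + i) m * (poch b i * poch c i * (poch Q m * (sgn m * poch (A′ + + t) m))) * (poch A′ t * poch U t * poch V t)
        ≡⟨ e₂ (poch A i) (poch (A + + i) m) (poch b i) (poch c i) (poch Q m) (sgn m) (poch (A′ + + t) m) (poch A′ t) (poch U t * poch V t) (poch U t) (poch V t) refl ⟩
      poch A i * poch b i * poch c i * (poch A′ t * poch (A′ + + t) m) * (sgn m * (poch (A + + i) m * poch Q m) * (poch U t * poch V t))
        ≡⟨ cong (λ x → poch A i * poch b i * poch c i * x * (sgn m * (poch (A + + i) m * poch Q m) * (poch U t * poch V t)))
           (sym (poch-shift A′ t (m ℕ.+ t) m (ℕP.+-comm m t))) ⟩
      Φ i m t ∎
      where
      e₁ : ∀ A′ i m t → 1ℤ - (i + m + t) - A′ + i + (A′ + t) ≡ 1ℤ - m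
      e₁ = solve-∀
      e₂ : ∀ a a′ x y q s z w uv u v → uv ≡ u * v → a * a′ * (x * y * (q * (s * z))) * (w * u * v) ≡ a * x * y * (w * z) * (s * (a′ * q) * uv)
      e₂ a a′ x y q s z w _ u v refl = e a a′ x y q s z w u v
        where e : ∀ a a′ x y q s z w u v → a * a′ * (x * y * (q * (s * z))) * (w * u * v) ≡ a * x * y * (w * z) * (s * (a′ * q) * (u * v))
              e = solve-∀
    inner : ∀ i s → i ℕ.+ s ≡ n → binSum s (λ m t → Φ i m t) ≡ poch A i * poch b i * poch c i * (poch A′ s * poch b′ s * poch c′ s)
    inner i s refl = begin
      binSum s (λ m t → Φ i m t)
        ≡⟨ binSum-cong s (λ m t e → cong (λ x → poch A i * poch b i * poch c i * poch A′ x * (sgn m * (poch (A + + i) m * poch Q m) * (poch U t * poch V t))) e) ⟩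
      binSum s (λ m t → X * (sgn m * (poch (A + + i) m * poch Q m) * (poch U t * poch V t)))
        ≡⟨ binSum-* s X _ ⟩
      X * binSum s (λ m t → sgn m * (poch (A + + i) m * poch Q m) * (poch U t * poch V t))
        ≡⟨ cong (X *_) (saalschütz s (A + + i) Q U V (trans (e₁ A b c A′ b′ c′ (+ i) (+ s)) (trans (cong (λ t → + i + + 3 - + 3 * (+ i + + s) - t) h) (e₂ (+ i) (+ s))))) ⟩
      X * (sgn s * (poch (A + + i + U) s * poch (Q + U) s))
        ≡⟨ cong₂ (λ x y → X * (sgn s * (x * y))) (poch-reflect′ (A + + i + U) b′ s (e₃ A b′ (+ i) (+ s)))
            (poch-cong s (trans (e₄ A b c A′ b′ c′ (+ i) (+ s)) (trans (cong (λ t → + 2 - + 2 * (+ i + + s) + c′ - t) h) (e₅ c′ (+ i) (+ s))))) ⟩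
      X * (sgn s * (sgn s * poch b′ s * poch c′ s))
        ≡⟨ e₆ (poch A i * poch b i * poch c i) (poch A′ s) (sgn s) (poch b′ s) (poch c′ s) ⟩
      poch A i * poch b i * poch c i * (poch A′ s * poch b′ s * poch c′ s) * (sgn s * sgn s)
        ≡⟨ trans (cong (poch A i * poch b i * poch c i * (poch A′ s * poch b′ s * poch c′ s) *_) (sgn² s)) (ℤP.*-identityʳ _) ⟩
      _ ∎
      where
      X = poch A i * poch b i * poch c i * poch A′ s
      e₁ : ∀ A b c A′ b′ c′ i s → A + i + (1ℤ - (i + s) - A′ - b - c) + (1ℤ - (i + s) - A - b′) + (1ℤ - (i + s) - A - c′)
           ≡ i + + 3 - + 3 * (i + s) - (A + b + c + A′ + b′ + c′)
      e₁ = solve-∀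
      e₂ : ∀ i s → i + + 3 - + 3 * (i + s) - (+ 2 - + 2 * (i + s)) ≡ 1ℤ - s
      e₂ = solve-∀
      e₃ : ∀ A b′ i s → A + i + (1ℤ - (i + s) - A - b′) + b′ ≡ 1ℤ - s
      e₃ = solve-∀
      e₄ : ∀ A b c A′ b′ c′ i s → 1ℤ - (i + s) - A′ - b - c + (1ℤ - (i + s) - A - b′) ≡ + 2 - + 2 * (i + s) + c′ - (A + b + c + A′ + b′ + c′)
      e₄ = solve-∀
      e₅ : ∀ c′ i s → + 2 - + 2 * (i + s) + c′ - (+ 2 - + 2 * (i + s)) ≡ c′
      e₅ = solve-∀
      e₆ : ∀ x a s b c → x * a * (s * (s * b * c)) ≡ x * (a * b * c) * (s * s)
      e₆ = solve-∀

  -- Very-well-poised series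

  binSum-weight : ∀ n (g : ℕ → ℕ → ℤ) → binSum (suc n) (λ m l → + m * g m l) ≡ + suc n * binSum n (λ m l → g (suc m) l)
  binSum-weight zero    g = ℤP.+-identityʳ (1ℤ * g 1 0)
  binSum-weight (suc n) g = begin
    binSum (suc n) (λ m l → (1ℤ + + m) * g (suc m) l) + binSum (suc n) (λ m l → + m * g m (suc l))
      ≡⟨ cong₂ _+_ (trans (binSum-cong (suc n) (λ m l _ → ℤP.*-distribʳ-+ (g (suc m) l) 1ℤ (+ m)))
           (binSum-+ (suc n) (λ m l → 1ℤ * g (suc m) l) (λ m l → + m * g (suc m) l))) (binSum-weight n (λ m l → g m (suc l))) ⟩
    binSum (suc n) (λ m l → 1ℤ * g (suc m) l) + binSum (suc n) (λ m l → + m * g (suc m) l) + + suc n * Y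
      ≡⟨ cong₂ (λ s t → s + t + + suc n * Y) (binSum-* (suc n) 1ℤ (λ m l → g (suc m) l)) (binSum-weight n (λ m l → g (suc m) l)) ⟩
    1ℤ * (X + Y) + + suc n * X + + suc n * Y
      ≡⟨ e X Y (+ suc n) ⟩
    (1ℤ + + suc n) * (X + Y) ∎
    where
    X Y : ℤ
    X = binSum n (λ m l → g (suc (suc m)) l)
    Y = binSum n (λ m l → g (suc m) (suc l))
    e : ∀ X Y n → 1ℤ * (X + Y) + n * X + n * Y ≡ (1ℤ + n) * (X + Y)
    e = solve-∀

  -- In the very-well-poised series W below, wp collects the factors coming from a and -n, and wpPair those of one
  -- further parameter, after multiplication by (1 + a + n)ₙ and by the denominators (1 + a - b)ₙ.
  wp : ℤ → ℕ → ℕ → ℤ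
  wp a m l = sgn m * (a + + 2 * + m) * poch a m * poch (a + + 2 * + m + + l + 1ℤ) l

  -- After multiplication by n + 1 = m + l, the identity (m + l)(a + 2m) = m(a + 2m + l) + l(a + m)
  -- splits the summand. The absorption rule `binSum-weight` lowers both parts to level n, where
  -- they cancel term by term.
  wp-sum : ∀ a n → binSum (suc n) (wp a) ≡ 0ℤ
  wp-sum a n = ℤP.*-cancelˡ-≡ (+ suc n) _ _ (begin
    + suc n * binSum (suc n) (wp a) ≡⟨ binSum-* (suc n) (+ suc n) (wp a) ⟨
    binSum (suc n) (λ m l → + suc n * wp a m l) ≡⟨ binSum-cong (suc n) split ⟩
    binSum (suc n) (λ m l → + m * g m l + + l * g′ m l) ≡⟨ binSum-+ (suc n) (λ m l → + m * g m l) (λ m l → + l * g′ m l) ⟩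
    binSum (suc n) (λ m l → + m * g m l) + binSum (suc n) (λ m l → + l * g′ m l)
      ≡⟨ cong₂ _+_ (binSum-weight n g) (trans (binSum-flip (suc n) (λ m l → + l * g′ m l)) (trans (binSum-weight n (λ l m → g′ m l)) (cong (+ suc n *_) (binSum-flip n (λ l m → g′ m (suc l)))))) ⟩
    + suc n * binSum n (λ m l → g (suc m) l) + + suc n * binSum n (λ m l → g′ m (suc l))
      ≡⟨ cong (λ t → + suc n * t + + suc n * binSum n (λ m l → g′ m (suc l))) (trans (binSum-cong n cancel) (binSum-* n -1ℤ (λ m l → g′ m (suc l)))) ⟩
    + suc n * (-1ℤ * Y) + + suc n * Y ≡⟨ e (+ suc n) Y ⟩
    + suc n * 0ℤ ∎)
    where
    g g′ : ℕ → ℕ → ℤ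
    g m l = sgn m * poch a m * poch (a + + 2 * + m + + l) (suc l)
    g′ m l = sgn m * poch a (suc m) * poch (a + + 2 * + m + + l + 1ℤ) l
    Y = binSum n (λ m l → g′ m (suc l))
    e : ∀ n y → n * (-1ℤ * y) + n * y ≡ n * 0ℤ
    e = solve-∀
    split : ∀ m l → m ℕ.+ l ≡ suc n → + suc n * wp a m l ≡ + m * g m l + + l * g′ m l
    split m l h = trans (cong (λ k → + k * wp a m l) (sym h)) (trans (e₁ (sgn m) a (+ m) (+ l) (poch a m) X)
        (cong (λ t → + m * (sgn m * poch a m * t) + + l * g′ m l) (trans (cong (λ t → (a + + 2 * + m + + l) * poch t l) (e₂ a (+ m) (+ l))) (sym (poch-suc (a + + 2 * + m + + l) l)))))
      where
      X = poch (a + + 2 * + m + + l + 1ℤ) l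
      e₁ : ∀ s a m l q x → (m + l) * (s * (a + + 2 * m) * q * x) ≡ m * (s * q * ((a + + 2 * m + l) * x)) + l * (s * (q * (a + m)) * x)
      e₁ = solve-∀
      e₂ : ∀ a m l → a + + 2 * m + l + 1ℤ ≡ 1ℤ + (a + + 2 * m + l)
      e₂ = solve-∀
    cancel : ∀ m l → m ℕ.+ l ≡ n → g (suc m) l ≡ -1ℤ * g′ m (suc l)
    cancel m l _ = trans (cong (λ t → - sgn m * poch a (suc m) * poch t (suc l)) (e₁ a (+ m) (+ l))) (e₂ (sgn m) (poch a (suc m)) (poch (a + + 2 * + m + + suc l + 1ℤ) (suc l)))
      where
      e₁ : ∀ a m l → a + + 2 * (1ℤ + m) + l ≡ a + + 2 * m + (1ℤ + l) + 1ℤ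
      e₁ = solve-∀
      e₂ : ∀ s x y → - s * x * y ≡ -1ℤ * (s * x * y)
      e₂ = solve-∀

  -- Saalschütz with the parameters arranged for `bailey`: (1 + a - b + j)_m continues into the
  -- factor (1 + a - b + k)_l of `wpPair`, and (a + k)_j is left to be merged with the weight.
  pair-expand : ∀ k a b c → poch b k * poch c k
    ≡ binSum k (λ j m → sgn j * (poch (a + + k) j * poch (1ℤ + a - b - c) j) * (poch (1ℤ + a - b + + j) m * poch (1ℤ + a - c + + j) m))
  pair-expand k a b c = begin
    poch b k * poch c k
      ≡⟨ sym (trans (cong (λ t → poch b k * poch c k * t) (sgn² k)) (ℤP.*-identityʳ _)) ⟩
    poch b k * poch c k * (sgn k * sgn k)
      ≡⟨ e₁ (poch b k) (poch c k) (sgn k) ⟩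
    sgn k * (poch b k * (sgn k * poch c k))
      ≡⟨ cong₂ (λ x y → sgn k * (x * y)) (poch-cong k (e₂ a b (+ k))) (sym (poch-reflect′ (1ℤ + a - b - c + U) c k (e₃ a b c (+ k)))) ⟩
    sgn k * (poch (a + + k + U) k * poch (1ℤ + a - b - c + U) k)
      ≡⟨ saalschütz k (a + + k) (1ℤ + a - b - c) U V (e₄ a b c (+ k)) ⟨
    binSum k (λ j m → sgn j * (poch (a + + k) j * poch (1ℤ + a - b - c) j) * (poch U m * poch V m))
      ≡⟨ binSum-cong k term ⟩
    _ ∎
    where
    U V : ℤ
    U = b - a - + k
    V = c - a - + k
    e₁ : ∀ x y s → x * y * (s * s) ≡ s * (x * (s * y))
    e₁ = solve-∀
    e₂ : ∀ a b k → b ≡ a + k + (b - a - k)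
    e₂ = solve-∀
    e₃ : ∀ a b c k → 1ℤ + a - b - c + (b - a - k) + c ≡ 1ℤ - k
    e₃ = solve-∀
    e₄ : ∀ a b c k → a + k + (1ℤ + a - b - c) + (b - a - k) + (c - a - k) ≡ 1ℤ - k
    e₄ = solve-∀
    term : ∀ j m → j ℕ.+ m ≡ k → sgn j * (poch (a + + k) j * poch (1ℤ + a - b - c) j) * (poch U m * poch V m)
      ≡ sgn j * (poch (a + + k) j * poch (1ℤ + a - b - c) j) * (poch (1ℤ + a - b + + j) m * poch (1ℤ + a - c + + j) m)
    term j m refl = cong (sgn j * (poch (a + + k) j * poch (1ℤ + a - b - c) j) *_) (begin
      poch U m * poch V m ≡⟨ cong₂ _*_ (poch-reflect′ U b′ m (e a b (+ j) (+ m))) (poch-reflect′ V c′ m (e a c (+ j) (+ m))) ⟩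
      sgn m * poch b′ m * (sgn m * poch c′ m) ≡⟨ e₅ (sgn m) (poch b′ m) (poch c′ m) ⟩
      sgn m * sgn m * (poch b′ m * poch c′ m) ≡⟨ trans (cong (_* (poch b′ m * poch c′ m)) (sgn² m)) (ℤP.*-identityˡ _) ⟩
      poch b′ m * poch c′ m ∎)
      where
      b′ c′ : ℤ
      b′ = 1ℤ + a - b + + j
      c′ = 1ℤ + a - c + + j
      e : ∀ a b j m → b - a - (j + m) + (1ℤ + a - b + j) ≡ 1ℤ - m
      e = solve-∀
      e₅ : ∀ s x y → s * x * (s * y) ≡ s * s * (x * y)
      e₅ = solve-∀

  wpPair : ℤ → ℤ → ℕ → ℕ → ℤ
  wpPair a b k l = poch b k * poch (1ℤ + a - b + + k) l

  -- Expand the factors of b and c by pair-expand and exchange the two summations.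
  bailey : ∀ n a b c (w : ℕ → ℕ → ℤ) → binSum n (λ k l → w k l * (wpPair a b k l * wpPair a c k l))
    ≡ binSum n (λ j t → sgn j * poch (1ℤ + a - b - c) j * (poch (1ℤ + a - b + + j) t * poch (1ℤ + a - c + + j) t)
                   * binSum t (λ m l → w (j ℕ.+ m) l * poch (a + + j + + m) j))
  bailey n a b c w = begin
    binSum n (λ k l → w k l * (wpPair a b k l * wpPair a c k l))
      ≡⟨ binSum-cong n expand ⟩
    binSum n (λ k l → binSum k (λ j m → w k l * (Ub k l * Uc k l) * S k j m))
      ≡⟨ binSum-cong n (λ k l _ → binSum-cong k (λ j m e → term k l j m e)) ⟩
    binSum n (λ k l → binSum k (λ j m → Φ j m l)) ≡⟨ binSum-assoc n Φ ⟩
    binSum n (λ j t → binSum t (λ m l → Φ j m l)) ≡⟨ binSum-cong n inner ⟩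
    _ ∎
    where
    Ub Uc : ℕ → ℕ → ℤ
    Ub k l = poch (1ℤ + a - b + + k) l
    Uc k l = poch (1ℤ + a - c + + k) l
    S : ℕ → ℕ → ℕ → ℤ
    S k j m = sgn j * (poch (a + + k) j * poch (1ℤ + a - b - c) j) * (Ub j m * Uc j m)
    Φ : ℕ → ℕ → ℕ → ℤ
    Φ j m l = sgn j * poch (1ℤ + a - b - c) j * (Ub j (m ℕ.+ l) * Uc j (m ℕ.+ l)) * (w (j ℕ.+ m) l * poch (a + + j + + m) j)
    expand : ∀ k l → k ℕ.+ l ≡ n → w k l * (wpPair a b k l * wpPair a c k l) ≡ binSum k (λ j m → w k l * (Ub k l * Uc k l) * S k j m)
    expand k l _ = trans (e (w k l) (poch b k) (Ub k l) (poch c k) (Uc k l))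
      (trans (cong (w k l * (Ub k l * Uc k l) *_) (pair-expand k a b c)) (sym (binSum-* k (w k l * (Ub k l * Uc k l)) (S k))))
      where
      e : ∀ w x u y v → w * (x * u * (y * v)) ≡ w * (u * v) * (x * y)
      e = solve-∀
    term : ∀ k l j m → j ℕ.+ m ≡ k → w k l * (Ub k l * Uc k l) * S k j m ≡ Φ j m l
    term k l j m refl = begin
      w k l * (Ub k l * Uc k l) * S k j m
        ≡⟨ e (w k l) (Ub k l) (Uc k l) (sgn j) (poch (a + + k) j) (poch (1ℤ + a - b - c) j) (Ub j m) (Uc j m) ⟩
      sgn j * poch (1ℤ + a - b - c) j * (Ub j m * Ub k l * (Uc j m * Uc k l)) * (w k l * poch (a + + k) j)
        ≡⟨ cong₂ (λ s t → sgn j * poch (1ℤ + a - b - c) j * s * (w k l * t)) (cong₂ _*_ (merge b) (merge c)) (poch-cong j (sym (ℤP.+-assoc a (+ j) (+ m)))) ⟩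
      Φ j m l ∎
      where
      e : ∀ w u v s p q x y → w * (u * v) * (s * (p * q) * (x * y)) ≡ s * q * (x * u * (y * v)) * (w * p)
      e = solve-∀
      merge : ∀ z → poch (1ℤ + a - z + + j) m * poch (1ℤ + a - z + + (j ℕ.+ m)) l ≡ poch (1ℤ + a - z + + j) (m ℕ.+ l)
      merge z = trans (cong (poch (1ℤ + a - z + + j) m *_) (poch-cong l (sym (ℤP.+-assoc (1ℤ + a - z) (+ j) (+ m))))) (sym (poch-+ (1ℤ + a - z + + j) m l))
    inner : ∀ j t → j ℕ.+ t ≡ n → binSum t (λ m l → Φ j m l)
      ≡ sgn j * poch (1ℤ + a - b - c) j * (Ub j t * Uc j t) * binSum t (λ m l → w (j ℕ.+ m) l * poch (a + + j + + m) j)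
    inner j t _ = trans
      (binSum-cong t (λ m l e → cong (λ x → sgn j * poch (1ℤ + a - b - c) j * (Ub j x * Uc j x) * (w (j ℕ.+ m) l * poch (a + + j + + m) j)) e))
      (binSum-* t (sgn j * poch (1ℤ + a - b - c) j * (Ub j t * Uc j t)) _)

  -- Since (a)_{j+m} (a + j + m)_j = (a)_{2j} (a + 2j)_m, the inner sum of `bailey` is again
  -- very-well-poised, with a + 2j for a. This allows `bailey` to be iterated.
  wp-shift : ∀ a j m l → wp a (j ℕ.+ m) l * poch (a + + j + + m) j ≡ sgn j * poch a (j ℕ.+ j) * wp (a + + 2 * + j) m l
  wp-shift a j m l = begin
    sgn (j ℕ.+ m) * (a + + 2 * (+ j + + m)) * poch a (j ℕ.+ m) * poch (a + + 2 * (+ j + + m) + + l + 1ℤ) l * poch (a + + j + + m) j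
      ≡⟨ cong₂ (λ s t → s * (a + + 2 * (+ j + + m)) * poch a (j ℕ.+ m) * t * poch (a + + j + + m) j) (sgn-+ j m) (poch-cong l (e₁ a (+ j) (+ m) (+ l))) ⟩
    sgn j * sgn m * (a + + 2 * (+ j + + m)) * poch a (j ℕ.+ m) * X * poch (a + + j + + m) j
      ≡⟨ e₂ (sgn j) (sgn m) a (+ j) (+ m) (poch a (j ℕ.+ m)) X (poch (a + + j + + m) j) ⟩
    sgn j * (sgn m * (a + + 2 * + j + + 2 * + m) * (poch a (j ℕ.+ m) * poch (a + + j + + m) j) * X)
      ≡⟨ cong (λ t → sgn j * (sgn m * (a + + 2 * + j + + 2 * + m) * t * X)) merge ⟩
    sgn j * (sgn m * (a + + 2 * + j + + 2 * + m) * (poch a (j ℕ.+ j) * poch (a + + 2 * + j) m) * X)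
      ≡⟨ e₃ (sgn j) (sgn m) (a + + 2 * + j + + 2 * + m) (poch a (j ℕ.+ j)) (poch (a + + 2 * + j) m) X ⟩
    sgn j * poch a (j ℕ.+ j) * wp (a + + 2 * + j) m l ∎
    where
    X = poch (a + + 2 * + j + + 2 * + m + + l + 1ℤ) l
    e₁ : ∀ a j m l → a + + 2 * (j + m) + l + 1ℤ ≡ a + + 2 * j + + 2 * m + l + 1ℤ
    e₁ = solve-∀
    e₂ : ∀ s s′ a j m p x q → s * s′ * (a + + 2 * (j + m)) * p * x * q ≡ s * (s′ * (a + + 2 * j + + 2 * m) * (p * q) * x)
    e₂ = solve-∀
    e₃ : ∀ s s′ z p q x → s * (s′ * z * (p * q) * x) ≡ s * p * (s′ * z * q * x)
    e₃ = solve-∀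
    merge : poch a (j ℕ.+ m) * poch (a + + j + + m) j ≡ poch a (j ℕ.+ j) * poch (a + + 2 * + j) m
    merge = begin
      poch a (j ℕ.+ m) * poch (a + + j + + m) j       ≡⟨ cong (poch a (j ℕ.+ m) *_) (poch-cong j (ℤP.+-assoc a (+ j) (+ m))) ⟩
      poch a (j ℕ.+ m) * poch (a + + (j ℕ.+ m)) j     ≡⟨ poch-+ a (j ℕ.+ m) j ⟨
      poch a (j ℕ.+ m ℕ.+ j)                          ≡⟨ cong (poch a) (trans (ℕP.+-assoc j m j) (trans (cong (j ℕ.+_) (ℕP.+-comm m j)) (sym (ℕP.+-assoc j j m)))) ⟩
      poch a (j ℕ.+ j ℕ.+ m)                          ≡⟨ poch-+ a (j ℕ.+ j) m ⟩
      poch a (j ℕ.+ j) * poch (a + + (j ℕ.+ j)) m     ≡⟨ cong (poch a (j ℕ.+ j) *_) (poch-cong m (e₄ a (+ j))) ⟩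
      poch a (j ℕ.+ j) * poch (a + + 2 * + j) m       ∎
      where
      e₄ : ∀ a j → a + (j + j) ≡ a + + 2 * j
      e₄ = solve-∀

  -- By `wp-sum` the inner sums of `bailey` vanish unless their length t is 0, so only j = n
  -- survives.
  wp₅F₄ : ∀ n a d e → binSum n (λ k l → wp a k l * (wpPair a d k l * wpPair a e k l)) ≡ poch a (suc (n ℕ.+ n)) * poch (1ℤ + a - d - e) n
  wp₅F₄ n a d e = begin
    binSum n (λ k l → wp a k l * (wpPair a d k l * wpPair a e k l)) ≡⟨ bailey n a d e (wp a) ⟩
    binSum n Ψ ≡⟨ binSum-cong n (λ j t _ → cong (X j t *_) (inner j t)) ⟩
    binSum n (λ j t → X j t * (sgn j * poch a (j ℕ.+ j) * binSum t (wp (a + + 2 * + j)))) ≡⟨ binSum-last n _ vanish ⟩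
    sgn n * poch (1ℤ + a - d - e) n * (1ℤ * 1ℤ) * (sgn n * poch a (n ℕ.+ n) * (1ℤ * (a + + 2 * + n + 0ℤ) * 1ℤ * 1ℤ))
      ≡⟨ e₁ (sgn n) (poch (1ℤ + a - d - e) n) (poch a (n ℕ.+ n)) a (+ n) ⟩
    sgn n * sgn n * (poch a (n ℕ.+ n) * (a + (+ n + + n)) * poch (1ℤ + a - d - e) n) ≡⟨ trans (cong (_* (poch a (suc (n ℕ.+ n)) * poch (1ℤ + a - d - e) n)) (sgn² n)) (ℤP.*-identityˡ (poch a (suc (n ℕ.+ n)) * poch (1ℤ + a - d - e) n)) ⟩
    poch a (suc (n ℕ.+ n)) * poch (1ℤ + a - d - e) n ∎
    where
    X Ψ : ℕ → ℕ → ℤ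
    X j t = sgn j * poch (1ℤ + a - d - e) j * (poch (1ℤ + a - d + + j) t * poch (1ℤ + a - e + + j) t)
    Ψ j t = X j t * binSum t (λ m l → wp a (j ℕ.+ m) l * poch (a + + j + + m) j)
    inner : ∀ j t → binSum t (λ m l → wp a (j ℕ.+ m) l * poch (a + + j + + m) j) ≡ sgn j * poch a (j ℕ.+ j) * binSum t (wp (a + + 2 * + j))
    inner j t = trans (binSum-cong t (λ m l _ → wp-shift a j m l)) (binSum-* t (sgn j * poch a (j ℕ.+ j)) (wp (a + + 2 * + j)))
    vanish : ∀ j t → X j (suc t) * (sgn j * poch a (j ℕ.+ j) * binSum (suc t) (wp (a + + 2 * + j))) ≡ 0ℤ
    vanish j t = trans (cong (λ z → X j (suc t) * (sgn j * poch a (j ℕ.+ j) * z)) (wp-sum (a + + 2 * + j) t)) (e₀ (X j (suc t)) (sgn j * poch a (j ℕ.+ j)))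
      where
      e₀ : ∀ x y → x * (y * 0ℤ) ≡ 0ℤ
      e₀ = solve-∀
    e₁ : ∀ s x p a n → s * x * (1ℤ * 1ℤ) * (s * p * (1ℤ * (a + + 2 * n + 0ℤ) * 1ℤ * 1ℤ)) ≡ s * s * (p * (a + (n + n)) * x)
    e₁ = solve-∀

  -- The very-well-poised ₇F₆ of argument 1 with parameters a, b, c, d, e and -n, cleared of
  -- denominators.
  W : ℕ → (a b c d e : ℤ) → ℤ
  W n a b c d e = binSum n (λ k l → wp a k l * (wpPair a d k l * wpPair a e k l) * (wpPair a b k l * wpPair a c k l))

  -- The pairs of d and e are carried along as part of the weight in `bailey`. The inner sum is then
  -- `wp₅F₄` at a + 2j, d + j, e + j, and this shift leaves 1 + a - d - e unchanged.
  whipple : ∀ n a b c d e → W n a b c d e ≡ poch a (suc (n ℕ.+ n)) * M n d e (1ℤ + a - b - c) (1ℤ + a - d - e) (b - a - + n) (c - a - + n)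
  whipple n a b c d e = begin
    W n a b c d e ≡⟨ bailey n a b c (λ k l → wp a k l * (wpPair a d k l * wpPair a e k l)) ⟩
    binSum n (λ j t → X j t * binSum t (λ m l → wp a (j ℕ.+ m) l * (wpPair a d (j ℕ.+ m) l * wpPair a e (j ℕ.+ m) l) * poch (a + + j + + m) j))
      ≡⟨ binSum-cong n (λ j t h → trans (cong (X j t *_) (inner j t h)) (outer j t h)) ⟩
    binSum n (λ j t → poch a (suc (n ℕ.+ n)) * (poch d j * poch e j * poch (1ℤ + a - b - c) j * (poch (1ℤ + a - d - e) t * poch (b - a - + n) t * poch (c - a - + n) t)))
      ≡⟨ binSum-* n (poch a (suc (n ℕ.+ n))) _ ⟩
    _ ∎
    where
    X : ℕ → ℕ → ℤ
    X j t = sgn j * poch (1ℤ + a - b - c) j * (poch (1ℤ + a - b + + j) t * poch (1ℤ + a - c + + j) t)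
    inner : ∀ j t → j ℕ.+ t ≡ n → binSum t (λ m l → wp a (j ℕ.+ m) l * (wpPair a d (j ℕ.+ m) l * wpPair a e (j ℕ.+ m) l) * poch (a + + j + + m) j)
      ≡ sgn j * poch d j * poch e j * (poch a (suc (n ℕ.+ n)) * poch (1ℤ + a - d - e) t)
    inner j t refl = begin
      binSum t (λ m l → wp a (j ℕ.+ m) l * (wpPair a d (j ℕ.+ m) l * wpPair a e (j ℕ.+ m) l) * poch (a + + j + + m) j)
        ≡⟨ binSum-cong t (λ m l _ → term m l) ⟩
      binSum t (λ m l → K * (wp a′ m l * (wpPair a′ (d + + j) m l * wpPair a′ (e + + j) m l)))
        ≡⟨ binSum-* t K _ ⟩
      K * binSum t (λ m l → wp a′ m l * (wpPair a′ (d + + j) m l * wpPair a′ (e + + j) m l))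
        ≡⟨ cong (K *_) (wp₅F₄ t a′ (d + + j) (e + + j)) ⟩
      K * (poch a′ (suc (t ℕ.+ t)) * poch (1ℤ + a′ - (d + + j) - (e + + j)) t)
        ≡⟨ cong₂ (λ x y → K * (x * y)) (poch-cong (suc (t ℕ.+ t)) (e₄ a (+ j))) (poch-cong t (e₁ a d e (+ j))) ⟩
      K * (poch (a + + (j ℕ.+ j)) (suc (t ℕ.+ t)) * poch (1ℤ + a - d - e) t)
        ≡⟨ e₂ (sgn j) (poch a (j ℕ.+ j)) (poch d j) (poch e j) (poch (a + + (j ℕ.+ j)) (suc (t ℕ.+ t))) (poch (1ℤ + a - d - e) t) ⟩
      sgn j * poch d j * poch e j * (poch a (j ℕ.+ j) * poch (a + + (j ℕ.+ j)) (suc (t ℕ.+ t)) * poch (1ℤ + a - d - e) t)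
        ≡⟨ cong (λ x → sgn j * poch d j * poch e j * (x * poch (1ℤ + a - d - e) t)) (sym (poch-shift a (j ℕ.+ j) (suc (j ℕ.+ t ℕ.+ (j ℕ.+ t))) (suc (t ℕ.+ t)) idx)) ⟩
      sgn j * poch d j * poch e j * (poch a (suc (j ℕ.+ t ℕ.+ (j ℕ.+ t))) * poch (1ℤ + a - d - e) t) ∎
      where
      a′ K : ℤ
      a′ = a + + 2 * + j
      K = sgn j * poch a (j ℕ.+ j) * (poch d j * poch e j)
      idx : suc (j ℕ.+ t ℕ.+ (j ℕ.+ t)) ≡ j ℕ.+ j ℕ.+ suc (t ℕ.+ t)
      idx = trans (cong suc (trans (ℕP.+-assoc j t (j ℕ.+ t)) (trans (cong (j ℕ.+_) (trans (sym (ℕP.+-assoc t j t)) (trans (cong (ℕ._+ t) (ℕP.+-comm t j)) (ℕP.+-assoc j t t)))) (sym (ℕP.+-assoc j j (t ℕ.+ t)))))) (sym (ℕP.+-suc (j ℕ.+ j) (t ℕ.+ t)))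
      e₁ : ∀ a d e j → 1ℤ + (a + + 2 * j) - (d + j) - (e + j) ≡ 1ℤ + a - d - e
      e₁ = solve-∀
      e₂ : ∀ s p x y q r → s * p * (x * y) * (q * r) ≡ s * x * y * (p * q * r)
      e₂ = solve-∀
      e₄ : ∀ a j → a + + 2 * j ≡ a + (j + j)
      e₄ = solve-∀
      pair : ∀ z m l → wpPair a z (j ℕ.+ m) l ≡ poch z j * wpPair a′ (z + + j) m l
      pair z m l = trans (cong₂ _*_ (poch-+ z j m) (poch-cong l (e₅ a z (+ j) (+ m)))) (ℤP.*-assoc (poch z j) _ _)
        where
        e₅ : ∀ a z j m → 1ℤ + a - z + (j + m) ≡ 1ℤ + (a + + 2 * j) - (z + j) + m
        e₅ = solve-∀
      term : ∀ m l → wp a (j ℕ.+ m) l * (wpPair a d (j ℕ.+ m) l * wpPair a e (j ℕ.+ m) l) * poch (a + + j + + m) j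
        ≡ K * (wp a′ m l * (wpPair a′ (d + + j) m l * wpPair a′ (e + + j) m l))
      term m l = begin
        wp a (j ℕ.+ m) l * (wpPair a d (j ℕ.+ m) l * wpPair a e (j ℕ.+ m) l) * P
          ≡⟨ cong₂ (λ x y → wp a (j ℕ.+ m) l * (x * y) * P) (pair d m l) (pair e m l) ⟩
        wp a (j ℕ.+ m) l * (poch d j * u * (poch e j * v)) * P
          ≡⟨ e₆ (wp a (j ℕ.+ m) l) P (poch d j) u (poch e j) v ⟩
        wp a (j ℕ.+ m) l * P * (poch d j * poch e j * (u * v))
          ≡⟨ cong (_* (poch d j * poch e j * (u * v))) (wp-shift a j m l) ⟩
        sgn j * poch a (j ℕ.+ j) * wp a′ m l * (poch d j * poch e j * (u * v))
          ≡⟨ e₇ (sgn j * poch a (j ℕ.+ j)) (wp a′ m l) (poch d j * poch e j) (u * v) ⟩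
        K * (wp a′ m l * (u * v)) ∎
        where
        P u v : ℤ
        P = poch (a + + j + + m) j
        u = wpPair a′ (d + + j) m l
        v = wpPair a′ (e + + j) m l
        e₆ : ∀ w p x u y v → w * (x * u * (y * v)) * p ≡ w * p * (x * y * (u * v))
        e₆ = solve-∀
        e₇ : ∀ s w x u → s * w * (x * u) ≡ s * x * (w * u)
        e₇ = solve-∀
    outer : ∀ j t → j ℕ.+ t ≡ n → X j t * (sgn j * poch d j * poch e j * (poch a (suc (n ℕ.+ n)) * poch (1ℤ + a - d - e) t))
      ≡ poch a (suc (n ℕ.+ n)) * (poch d j * poch e j * poch (1ℤ + a - b - c) j * (poch (1ℤ + a - d - e) t * poch (b - a - + n) t * poch (c - a - + n) t))
    outer j t refl = begin
      X j t * (sgn j * poch d j * poch e j * (P * poch (1ℤ + a - d - e) t))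
        ≡⟨ cong₂ (λ x y → sgn j * poch (1ℤ + a - b - c) j * (x * y) * (sgn j * poch d j * poch e j * (P * poch (1ℤ + a - d - e) t)))
             (poch-reflect′ (1ℤ + a - b + + j) (b - a - + n) t (e₁ a b (+ j) (+ t))) (poch-reflect′ (1ℤ + a - c + + j) (c - a - + n) t (e₁ a c (+ j) (+ t))) ⟩
      sgn j * poch (1ℤ + a - b - c) j * (sgn t * b′ * (sgn t * c′)) * (sgn j * poch d j * poch e j * (P * poch (1ℤ + a - d - e) t))
        ≡⟨ e₂ (sgn j) (sgn t) (poch (1ℤ + a - b - c) j) b′ c′ (poch d j) (poch e j) P (poch (1ℤ + a - d - e) t) ⟩
      sgn j * sgn j * (sgn t * sgn t) * Z
        ≡⟨ cong₂ (λ x y → x * y * Z) (sgn² j) (sgn² t) ⟩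
      1ℤ * Z ≡⟨ ℤP.*-identityˡ Z ⟩
      Z ∎
      where
      P b′ c′ Z : ℤ
      P = poch a (suc (n ℕ.+ n))
      b′ = poch (b - a - + n) t
      c′ = poch (c - a - + n) t
      Z = P * (poch d j * poch e j * poch (1ℤ + a - b - c) j * (poch (1ℤ + a - d - e) t * b′ * c′))
      e₁ : ∀ a b j t → 1ℤ + a - b + j + (b - a - (j + t)) ≡ 1ℤ - t
      e₁ = solve-∀
      e₂ : ∀ s r x b c d e p q → s * x * (r * b * (r * c)) * (s * d * e * (p * q)) ≡ s * s * (r * r) * (p * (d * e * x * (q * b * c)))
      e₂ = solve-∀

  M-cong : ∀ n {a a₁ b b₁ c c₁ a′ a₁′ b′ b₁′ c′ c₁′} → a ≡ a₁ → b ≡ b₁ → c ≡ c₁ → a′ ≡ a₁′ → b′ ≡ b₁′ → c′ ≡ c₁′ →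
    M n a b c a′ b′ c′ ≡ M n a₁ b₁ c₁ a₁′ b₁′ c₁′
  M-cong n refl refl refl refl refl refl = refl

  -- Of the equivalent ₄F₃ forms, this one has d - a - n and b + c + d + e - 1 - 2a - n among its
  -- numerator parameters. In the application they become A and -N, so that the series stops at N as
  -- well.
  whipple-sears : ∀ n a b c d e → W n a b c d e ≡ poch a (suc (n ℕ.+ n))
    * M n d (d - a - + n) (b + c + d + e - 1ℤ - + 2 * a - + n) (1ℤ + a - d - e) (1ℤ + a - b - d) (1ℤ + a - c - d)
  whipple-sears n a b c d e = trans (whipple n a b c d e) (cong (poch a (suc (n ℕ.+ n)) *_)
    (trans (sears n d e (1ℤ + a - b - c) (1ℤ + a - d - e) (b - a - + n) (c - a - + n) (e₀ a b c d e (+ n)))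
      (M-cong n refl (e₁ a d e (+ n)) (e₂ a b c d e (+ n)) refl (e₃ a b d (+ n)) (e₃ a c d (+ n)))))
    where
    e₀ : ∀ a b c d e n → d + e + (1ℤ + a - b - c) + (1ℤ + a - d - e) + (b - a - n) + (c - a - n) ≡ + 2 - + 2 * n
    e₀ = solve-∀
    e₁ : ∀ a d e n → 1ℤ - n - (1ℤ + a - d - e) - e ≡ d - a - n
    e₁ = solve-∀
    e₂ : ∀ a b c d e n → 1ℤ - n - (1ℤ + a - d - e) - (1ℤ + a - b - c) ≡ b + c + d + e - 1ℤ - + 2 * a - n
    e₂ = solve-∀
    e₃ : ∀ a b d n → 1ℤ - n - d - (b - a - n) ≡ 1ℤ + a - b - d
    e₃ = solve-∀

-- Congruences and finite sums

module Congruences where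

  open import Data.Integer.Base using (0ℤ; -1ℤ; _+_; _*_; _-_; -_)
  open Hypergeometric

  mod-setoid : ℕ → Setoid _ _
  mod-setoid N = record
    { Carrier = ℤ
    ; _≈_ = λ a b → a ≡ b [mod N ]
    ; isEquivalence = record { refl = mod-refl ; sym = mod-sym ; trans = mod-trans }
    }

  module _ {N : ℕ} where

    mod-*ˡ : ∀ c {a b} → a ≡ b [mod N ] → c * a ≡ c * b [mod N ]
    mod-*ˡ c h = mod-* (mod-refl {a = c}) h

    mod-*ʳ : ∀ c {a b} → a ≡ b [mod N ] → a * c ≡ b * c [mod N ]
    mod-*ʳ c h = mod-* h (mod-refl {a = c})

    mod-+ˡ : ∀ c {a b} → a ≡ b [mod N ] → c + a ≡ c + b [mod N ]
    mod-+ˡ c h = mod-+ (mod-refl {a = c}) h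

    mod-+ʳ : ∀ c {a b} → a ≡ b [mod N ] → a + c ≡ b + c [mod N ]
    mod-+ʳ c h = mod-+ h (mod-refl {a = c})

    mod-- : ∀ {a b c d} → a ≡ b [mod N ] → c ≡ d [mod N ] → a - c ≡ b - d [mod N ]
    mod-- h k = mod-+ h (mod-neg k)

    -- The identity between the differences is meant for the ring solver.
    combine : ∀ {a b x y} c → x ≡ y [mod N ] → a - b ≡ c * (x - y) → a ≡ b [mod N ]
    combine c (mod d) e = mod (subst (+ N ℤS.∣_) (sym e) (ℤS.∣n⇒∣m*n c d))

    combine₂ : ∀ {a b x y x′ y′} c c′ → x ≡ y [mod N ] → x′ ≡ y′ [mod N ] →
      a - b ≡ c * (x - y) + c′ * (x′ - y′) → a ≡ b [mod N ]
    combine₂ c c′ (mod d) (mod d′) e = mod (subst (+ N ℤS.∣_) (sym e) (ℤS.∣m∣n⇒∣m+n (ℤS.∣n⇒∣m*n c d) (ℤS.∣n⇒∣m*n c′ d′)))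

    poch-mod : ∀ {x y} k → x ≡ y [mod N ] → poch x k ≡ poch y k [mod N ]
    poch-mod zero    h = mod-refl
    poch-mod (suc k) h = mod-* (poch-mod k h) (mod-+ʳ (+ k) h)

    ∣⇒≡0 : ∀ {x} → + N ℤS.∣ x → x ≡ 0ℤ [mod N ]
    ∣⇒≡0 {x} d = mod (subst (+ N ℤS.∣_) (sym (ℤP.+-identityʳ x)) d)

    ≡0⇒∣ : ∀ {x} → x ≡ 0ℤ [mod N ] → + N ℤS.∣ x
    ≡0⇒∣ {x} (mod d) = subst (+ N ℤS.∣_) (ℤP.+-identityʳ x) d

    binSum-mod : ∀ n {f g} → (∀ i l → i ℕ.+ l ≡ n → f i l ≡ g i l [mod N ]) → binSum n f ≡ binSum n g [mod N ]
    binSum-mod zero    h = h 0 0 refl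
    binSum-mod (suc n) h = mod-+
      (binSum-mod n λ i l e → h (suc i) l (cong suc e))
      (binSum-mod n λ i l e → h i (suc l) (trans (ℕP.+-suc i l) (cong suc e)))

  mod-mul : ∀ {x y} m n → x ≡ 0ℤ [mod m ] → y ≡ 0ℤ [mod n ] → x * y ≡ 0ℤ [mod m ℕ.* n ]
  mod-mul {x} {y} m n h k with ≡0⇒∣ h | ≡0⇒∣ k
  ... | divides q refl | divides q′ refl = ∣⇒≡0 (divides (q * q′) (trans (e q (+ m) q′ (+ n)) (cong (q * q′ *_) (sym (ℤP.pos-* m n)))))
    where e : ∀ a b c d → a * b * (c * d) ≡ a * c * (b * d)
          e = solve-∀

  -- Sums without binomial weights

  diagSum : ℕ → (ℕ → ℕ → ℤ) → ℤ
  diagSum zero    f = f 0 0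
  diagSum (suc n) f = f 0 (suc n) + diagSum n (λ i l → f (suc i) l)

  diagSum-suc : ∀ n f → diagSum (suc n) f ≡ diagSum n (λ i l → f i (suc l)) + f (suc n) 0
  diagSum-suc zero    f = refl
  diagSum-suc (suc n) f = trans (cong (λ t → f 0 (suc (suc n)) + t) (diagSum-suc n (λ i l → f (suc i) l)))
    (sym (ℤP.+-assoc (f 0 (suc (suc n))) (diagSum n (λ i l → f (suc i) (suc l))) (f (suc (suc n)) 0)))

  diagSum-cong : ∀ n {f g} → (∀ i l → i ℕ.+ l ≡ n → f i l ≡ g i l) → diagSum n f ≡ diagSum n g
  diagSum-cong zero    h = h 0 0 refl
  diagSum-cong (suc n) h = cong₂ _+_ (h 0 (suc n) refl) (diagSum-cong n λ i l e → h (suc i) l (cong suc e))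

  diagSum-mod : ∀ {N} n {f g} → (∀ i l → i ℕ.+ l ≡ n → f i l ≡ g i l [mod N ]) → diagSum n f ≡ diagSum n g [mod N ]
  diagSum-mod zero    h = h 0 0 refl
  diagSum-mod (suc n) h = mod-+ (h 0 (suc n) refl) (diagSum-mod n λ i l e → h (suc i) l (cong suc e))

  diagSum-+ : ∀ n f g → diagSum n (λ i l → f i l + g i l) ≡ diagSum n f + diagSum n g
  diagSum-+ zero    f g = refl
  diagSum-+ (suc n) f g = trans (cong (λ t → f 0 (suc n) + g 0 (suc n) + t) (diagSum-+ n (λ i l → f (suc i) l) (λ i l → g (suc i) l)))
    (e (f 0 (suc n)) (g 0 (suc n)) (diagSum n (λ i l → f (suc i) l)) (diagSum n (λ i l → g (suc i) l)))
    where e : ∀ a b c d → (a + b) + (c + d) ≡ (a + c) + (b + d)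
          e = solve-∀

  diagSum-* : ∀ n c f → diagSum n (λ i l → c * f i l) ≡ c * diagSum n f
  diagSum-* zero    c f = refl
  diagSum-* (suc n) c f = trans (cong (λ t → c * f 0 (suc n) + t) (diagSum-* n c (λ i l → f (suc i) l)))
    (sym (ℤP.*-distribˡ-+ c (f 0 (suc n)) (diagSum n (λ i l → f (suc i) l))))

  diagSum-flip : ∀ n f → diagSum n f ≡ diagSum n (λ i l → f l i)
  diagSum-flip zero    f = refl
  diagSum-flip (suc n) f = trans (cong (λ t → f 0 (suc n) + t) (diagSum-flip n (λ i l → f (suc i) l)))
    (trans (ℤP.+-comm (f 0 (suc n)) (diagSum n (λ i l → f (suc l) i))) (sym (diagSum-suc n (λ i l → f l i))))

  diagSum-truncate-mod : ∀ {N} d m f → (∀ i l → f (suc (m ℕ.+ i)) l ≡ 0ℤ [mod N ]) → diagSum (m ℕ.+ d) f ≡ diagSum m (λ i l → f i (l ℕ.+ d)) [mod N ]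
  diagSum-truncate-mod zero    zero    f h = mod-refl
  diagSum-truncate-mod {N} (suc d) zero f h = mod-trans (mod-+ˡ (f 0 (suc d)) (mod-trans (diagSum-mod d (λ i l _ → h i l)) (zeros d))) (≡-to-mod (ℤP.+-identityʳ (f 0 (suc d))))
    where
    zeros : ∀ n → diagSum n (λ _ _ → 0ℤ) ≡ 0ℤ [mod N ]
    zeros zero    = mod-refl
    zeros (suc n) = mod-+ˡ 0ℤ (zeros n)
  diagSum-truncate-mod d (suc m) f h = mod-+ˡ (f 0 (suc (m ℕ.+ d))) (diagSum-truncate-mod d m (λ i l → f (suc i) l) h)

  diagSum-truncate : ∀ d m f → (∀ i l → f (suc (m ℕ.+ i)) l ≡ 0ℤ) → diagSum (m ℕ.+ d) f ≡ diagSum m (λ i l → f i (l ℕ.+ d))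
  -- A congruence modulo 0 is an equality.
  diagSum-truncate d m f h with diagSum-truncate-mod {0} d m f (λ i l → ≡-to-mod (h i l))
  ... | mod (divides c e) = ℤP.i-j≡0⇒i≡j (diagSum (m ℕ.+ d) f) (diagSum m (λ i l → f i (l ℕ.+ d))) (trans e (ℤP.*-zeroʳ c))

  -- The coefficient of i + l over i, indexed by its two parts like the summands of `binSum`.
  binom : ℕ → ℕ → ℤ
  binom zero    l       = 1ℤ
  binom (suc i) zero    = 1ℤ
  binom (suc i) (suc l) = binom i (suc l) + binom (suc i) l

  -- The recursion of `binSum` is Pascal's rule. The weights have to become explicit where a series
  -- is truncated or two lengths are compared.
  binSum-diagSum : ∀ n f → binSum n f ≡ diagSum n (λ i l → binom i l * f i l)
  binSum-diagSum zero    f = sym (ℤP.*-identityˡ (f 0 0))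
  binSum-diagSum (suc n) f = begin
    binSum n (λ i l → f (suc i) l) + binSum n (λ i l → f i (suc l))
      ≡⟨ cong₂ _+_ (binSum-diagSum n (λ i l → f (suc i) l)) (binSum-diagSum n (λ i l → f i (suc l))) ⟩
    diagSum n (λ i l → binom i l * f (suc i) l) + diagSum n (λ i l → binom i l * f i (suc l))
      ≡⟨ cong₂ _+_ (sym (ℤP.+-identityˡ (diagSum n (λ i l → binom i l * f (suc i) l)))) (sym (ℤP.+-identityʳ (diagSum n (λ i l → binom i l * f i (suc l))))) ⟩
    diagSum (suc n) (λ i l → left i l * f i l) + (diagSum n (λ i l → right i (suc l) * f i (suc l)) + right (suc n) 0 * f (suc n) 0)
      ≡⟨ cong (λ t → diagSum (suc n) (λ i l → left i l * f i l) + t) (sym (diagSum-suc n (λ i l → right i l * f i l))) ⟩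
    diagSum (suc n) (λ i l → left i l * f i l) + diagSum (suc n) (λ i l → right i l * f i l)
      ≡⟨ diagSum-+ (suc n) (λ i l → left i l * f i l) (λ i l → right i l * f i l) ⟨
    diagSum (suc n) (λ i l → left i l * f i l + right i l * f i l)
      ≡⟨ diagSum-cong (suc n) (λ i l e → trans (sym (ℤP.*-distribʳ-+ (f i l) (left i l) (right i l))) (cong (_* f i l) (pascal i l e))) ⟩
    diagSum (suc n) (λ i l → binom i l * f i l) ∎
    where
    open ≡-Reasoning
    -- The two Pascal predecessors, with 0 on the boundary so that both sums run over the whole
    -- diagonal.
    left right : ℕ → ℕ → ℤ
    left zero    l = 0ℤ
    left (suc i) l = binom i l
    right i zero    = 0ℤ
    right i (suc l) = binom i l
    pascal : ∀ i l → i ℕ.+ l ≡ suc n → left i l + right i l ≡ binom i l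
    pascal zero          (suc l) e = refl
    pascal (suc zero)    zero    e = refl
    pascal (suc (suc i)) zero    e = refl
    pascal (suc i)       (suc l) e = refl

  binom-factorial : ∀ i l → binom i l * poch 1ℤ i ≡ poch (1ℤ + + l) i
  binom-factorial zero    l       = refl
  binom-factorial (suc i) zero    = ℤP.*-identityˡ (poch 1ℤ (suc i))
  binom-factorial (suc i) (suc l) = begin
    (binom i (suc l) + binom (suc i) l) * (poch 1ℤ i * (1ℤ + + i))
      ≡⟨ e₁ (binom i (suc l)) (binom (suc i) l) (poch 1ℤ i) (1ℤ + + i) ⟩
    binom i (suc l) * poch 1ℤ i * (1ℤ + + i) + binom (suc i) l * poch 1ℤ (suc i)
      ≡⟨ cong₂ (λ s t → s * (1ℤ + + i) + t) (binom-factorial i (suc l)) (trans (binom-factorial (suc i) l) (poch-suc (1ℤ + + l) i)) ⟩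
    poch (1ℤ + (1ℤ + + l)) i * (1ℤ + + i) + (1ℤ + + l) * poch (1ℤ + (1ℤ + + l)) i
      ≡⟨ e₂ (poch (1ℤ + (1ℤ + + l)) i) (+ i) (+ l) ⟩
    poch (1ℤ + (1ℤ + + l)) i * (1ℤ + (1ℤ + + l) + + i) ∎
    where
    open ≡-Reasoning
    e₁ : ∀ x y p k → (x + y) * (p * k) ≡ x * p * k + y * (p * k)
    e₁ = solve-∀
    e₂ : ∀ p i l → p * (1ℤ + i) + (1ℤ + l) * p ≡ p * (1ℤ + (1ℤ + l) + i)
    e₂ = solve-∀

  binom-poch : ∀ i l n → i ℕ.+ l ≡ n → binom i l * poch 1ℤ i ≡ sgn i * poch (- + n) i
  binom-poch i l n refl = trans (binom-factorial i l) (poch-reflect′ (1ℤ + + l) (- + (i ℕ.+ l)) i (e (+ i) (+ l)))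
    where e : ∀ i l → 1ℤ + l + - (i + l) ≡ 1ℤ - i
          e = solve-∀

  poch-vanish : ∀ n i → poch (- + n) (suc (n ℕ.+ i)) ≡ 0ℤ
  poch-vanish n i = trans (cong (λ j → poch (- + n) j) (sym (ℕP.+-suc n i))) (trans (poch-+ (- + n) n (suc i))
    (trans (cong (poch (- + n) n *_) (trans (poch-suc (- + n + + n) i) (cong (_* poch (1ℤ + (- + n + + n)) i) (ℤP.+-inverseˡ (+ n))))) (ℤP.*-zeroʳ (poch (- + n) n))))

  poch-1-positive : ∀ i → ∃[ j ] poch 1ℤ i ≡ + suc j
  poch-1-positive zero    = 0 , refl
  poch-1-positive (suc i) with poch-1-positive i
  ... | j , e = i ℕ.+ j ℕ.* suc i , trans (cong (_* (1ℤ + + i)) e) (sym (ℤP.pos-* (suc j) (suc i)))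

  -- Both sides become (-1)^i (-m)_i (-n)_i after multiplication by i!.
  binom-exchange : ∀ i l l′ m n → i ℕ.+ l ≡ m → i ℕ.+ l′ ≡ n → binom i l * poch (- + n) i ≡ binom i l′ * poch (- + m) i
  binom-exchange i l l′ m n em en with poch-1-positive i
  ... | j , e = ℤP.*-cancelˡ-≡ (+ suc j) _ _ (begin
    + suc j * (binom i l * poch (- + n) i)  ≡⟨ e₁ (+ suc j) (binom i l) (poch (- + n) i) ⟩
    binom i l * + suc j * poch (- + n) i    ≡⟨ cong (λ t → binom i l * t * poch (- + n) i) e ⟨
    binom i l * poch 1ℤ i * poch (- + n) i  ≡⟨ cong (_* poch (- + n) i) (binom-poch i l m em) ⟩
    sgn i * poch (- + m) i * poch (- + n) i ≡⟨ e₂ (sgn i) (poch (- + m) i) (poch (- + n) i) ⟩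
    sgn i * poch (- + n) i * poch (- + m) i ≡⟨ cong (_* poch (- + m) i) (binom-poch i l′ n en) ⟨
    binom i l′ * poch 1ℤ i * poch (- + m) i ≡⟨ cong (λ t → binom i l′ * t * poch (- + m) i) e ⟩
    binom i l′ * + suc j * poch (- + m) i   ≡⟨ e₁ (+ suc j) (binom i l′) (poch (- + m) i) ⟨
    + suc j * (binom i l′ * poch (- + m) i) ∎)
    where
    open ≡-Reasoning
    e₁ : ∀ k x y → k * (x * y) ≡ x * k * y
    e₁ = solve-∀
    e₂ : ∀ s x y → s * x * y ≡ s * y * x
    e₂ = solve-∀

  -- M n (- N) … and M N (- n) … are the same terminating series up to normalisation.
  M-exchange : ∀ N d a b x y z → let n = N ℕ.+ d in
    M n (- + N) a b (x - + d) (y - + d) (z - + d) * (poch x N * poch y N * poch z N)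
    ≡ M N (- + n) a b x y z * (poch (x - + d) n * poch (y - + d) n * poch (z - + d) n)
  M-exchange N d a b x y z = begin
    M n (- + N) a b (x - + d) (y - + d) (z - + d) * X
      ≡⟨ cong (_* X) (trans (binSum-diagSum n _) (diagSum-truncate d N f supp)) ⟩
    diagSum N (λ i l → f i (l ℕ.+ d)) * X                                      ≡⟨ ℤP.*-comm (diagSum N (λ i l → f i (l ℕ.+ d))) X ⟩
    X * diagSum N (λ i l → f i (l ℕ.+ d))                                      ≡⟨ diagSum-* N X (λ i l → f i (l ℕ.+ d)) ⟨
    diagSum N (λ i l → X * f i (l ℕ.+ d))                                      ≡⟨ diagSum-cong N term ⟩
    diagSum N (λ i l → Y * g i l)                                              ≡⟨ diagSum-* N Y g ⟩
    Y * diagSum N g                                                            ≡⟨ ℤP.*-comm Y (diagSum N g) ⟩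
    diagSum N g * Y                                                            ≡⟨ cong (_* Y) (sym (binSum-diagSum N _)) ⟩
    M N (- + n) a b x y z * Y ∎
    where
    open ≡-Reasoning
    n = N ℕ.+ d
    X Y : ℤ
    X = poch x N * poch y N * poch z N
    Y = poch (x - + d) n * poch (y - + d) n * poch (z - + d) n
    f g : ℕ → ℕ → ℤ
    f i l = binom i l * (poch (- + N) i * poch a i * poch b i * (poch (x - + d) l * poch (y - + d) l * poch (z - + d) l))
    g i l = binom i l * (poch (- + n) i * poch a i * poch b i * (poch x l * poch y l * poch z l))
    supp : ∀ i l → f (suc (N ℕ.+ i)) l ≡ 0ℤ
    supp i l = trans (cong (λ t → binom k l * (t * poch a k * poch b k * Z)) (poch-vanish N i)) (e (binom k l) (poch a k) (poch b k) Z)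
      where
      k = suc (N ℕ.+ i)
      Z = poch (x - + d) l * poch (y - + d) l * poch (z - + d) l
      e : ∀ c u v w → c * (0ℤ * u * v * w) ≡ 0ℤ
      e = solve-∀
    term : ∀ i l → i ℕ.+ l ≡ N → X * f i (l ℕ.+ d) ≡ Y * g i l
    term i l refl = begin
      X * (binom i (l ℕ.+ d) * (P * poch a i * poch b i * Zd))  ≡⟨ cong (_* (binom i (l ℕ.+ d) * (P * poch a i * poch b i * Zd))) (cong₂ _*_ (cong₂ _*_ (up x) (up y)) (up z)) ⟩
      poch x l * t x * (poch y l * t y) * (poch z l * t z) * (binom i (l ℕ.+ d) * (P * poch a i * poch b i * Zd))
        ≡⟨ e₁ (poch x l) (poch y l) (poch z l) (t x) (t y) (t z) (binom i (l ℕ.+ d)) P (poch a i * poch b i) (poch a i) (poch b i) (poch (x - + d) (l ℕ.+ d)) (poch (y - + d) (l ℕ.+ d)) (poch (z - + d) (l ℕ.+ d)) refl ⟩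
      poch (x - + d) (l ℕ.+ d) * t x * (poch (y - + d) (l ℕ.+ d) * t y) * (poch (z - + d) (l ℕ.+ d) * t z) * (binom i (l ℕ.+ d) * P * (poch a i * poch b i * (poch x l * poch y l * poch z l)))
        ≡⟨ cong₂ (λ u v → u * (v * (poch a i * poch b i * (poch x l * poch y l * poch z l)))) (sym (cong₂ _*_ (cong₂ _*_ (up′ x) (up′ y)) (up′ z)))
             (binom-exchange i (l ℕ.+ d) l n N (sym (ℕP.+-assoc i l d)) refl) ⟩
      Y * (binom i l * poch (- + n) i * (poch a i * poch b i * (poch x l * poch y l * poch z l)))
        ≡⟨ cong (Y *_) (e₂ (binom i l) (poch (- + n) i) (poch a i) (poch b i) (poch x l * poch y l * poch z l)) ⟩
      Y * g i l ∎
      where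
      P Zd : ℤ
      P = poch (- + N) i
      Zd = poch (x - + d) (l ℕ.+ d) * poch (y - + d) (l ℕ.+ d) * poch (z - + d) (l ℕ.+ d)
      -- The common tail of (w)_N and (w - d)_n: both products end with the factor w + N - 1.
      t : ℤ → ℤ
      t w = poch (w + + l) i
      up : ∀ w → poch w (i ℕ.+ l) ≡ poch w l * t w
      up w = poch-shift w l (i ℕ.+ l) i (ℕP.+-comm i l)
      up′ : ∀ w → poch (w - + d) (i ℕ.+ l ℕ.+ d) ≡ poch (w - + d) (l ℕ.+ d) * t w
      up′ w = trans (poch-shift (w - + d) (l ℕ.+ d) (i ℕ.+ l ℕ.+ d) i (trans (ℕP.+-assoc i l d) (ℕP.+-comm i (l ℕ.+ d))))
        (cong (poch (w - + d) (l ℕ.+ d) *_) (poch-cong i (e w (+ l) (+ d))))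
        where e : ∀ w l d → w - d + (l + d) ≡ w + l
              e = solve-∀
      e₁ : ∀ x y z u v w c p ab a b x′ y′ z′ → ab ≡ a * b → x * u * (y * v) * (z * w) * (c * (p * a * b * (x′ * y′ * z′)))
         ≡ x′ * u * (y′ * v) * (z′ * w) * (c * p * (ab * (x * y * z)))
      e₁ x y z u v w c p _ a b x′ y′ z′ refl = e x y z u v w c p a b x′ y′ z′
        where e : ∀ x y z u v w c p a b x′ y′ z′ → x * u * (y * v) * (z * w) * (c * (p * a * b * (x′ * y′ * z′)))
                 ≡ x′ * u * (y′ * v) * (z′ * w) * (c * p * (a * b * (x * y * z)))
              e = solve-∀
      e₂ : ∀ c p a b z → c * p * (a * b * z) ≡ c * (p * a * b * z)
      e₂ = solve-∀

-- The solver runs over an abstract monoid because products of ℤ unfold during conversion checking.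

module Monomial {c ℓ} (ℳ : CommutativeMonoid c ℓ) where

  open CommutativeMonoid ℳ using (_≈_) renaming (_∙_ to infixl 7 _*_; refl to ≈-refl)
  open Algebra.Solver.CommutativeMonoid ℳ

  gather-inverses : ∀ kn pi pl mi ml ui ul vi vl z q w₁ b c w₂ s t w₃ →
    kn * (pi * pl * (mi * ml)) * (ui * ul * (vi * vl)) * (z * (q * w₁) * (b * c * w₂) * (s * t * w₃))
    ≈ kn * (pl * ml * ul * vl * z * q * b * s * t) * (c * w₁) * ((pi * mi * w₂) * (ui * vi * w₃))
  gather-inverses = solve 18 (λ kn pi pl mi ml ui ul vi vl z q w₁ b c w₂ s t w₃ →
    (((kn ⊕ ((pi ⊕ pl) ⊕ (mi ⊕ ml))) ⊕ ((ui ⊕ ul) ⊕ (vi ⊕ vl))) ⊕ (((z ⊕ (q ⊕ w₁)) ⊕ ((b ⊕ c) ⊕ w₂)) ⊕ ((s ⊕ t) ⊕ w₃)))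
    ⊜ (((kn ⊕ ((((((((pl ⊕ ml) ⊕ ul) ⊕ vl) ⊕ z) ⊕ q) ⊕ b) ⊕ s) ⊕ t)) ⊕ (c ⊕ w₁)) ⊕ (((pi ⊕ mi) ⊕ w₂) ⊕ ((ui ⊕ vi) ⊕ w₃)))) ≈-refl

  well-poised-order : ∀ k k′ pl ml ul vl z q b s t bi sg →
    k * k′ * (pl * ml * ul * vl * z * q * b * s * t) * (bi * sg)
    ≈ bi * (sg * z * q * pl * (b * ml * (k * k′)) * (s * vl * (t * ul)))
  well-poised-order = solve 13 (λ k k′ pl ml ul vl z q b s t bi sg →
    (((k ⊕ k′) ⊕ ((((((((pl ⊕ ml) ⊕ ul) ⊕ vl) ⊕ z) ⊕ q) ⊕ b) ⊕ s) ⊕ t)) ⊕ (bi ⊕ sg))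
    ⊜ (bi ⊕ (((((sg ⊕ z) ⊕ q) ⊕ pl) ⊕ ((b ⊕ ml) ⊕ (k ⊕ k′))) ⊕ ((s ⊕ vl) ⊕ (t ⊕ ul))))) ≈-refl

  gather-Γ : ∀ F GH Kn Gk Gm s Bp gp Bm gm Y aN →
    F * (GH * ((Kn * Gk) * Gm) * ((s * Bp * gp) * (s * Bm * gm))) * (Y * aN)
    ≈ GH * Gk * (s * s) * (Kn * Y * F * (aN * (Bp * Bm))) * (Gm * gp * gm)
  gather-Γ = solve 12 (λ F GH Kn Gk Gm s Bp gp Bm gm Y aN →
    ((F ⊕ ((GH ⊕ ((Kn ⊕ Gk) ⊕ Gm)) ⊕ (((s ⊕ Bp) ⊕ gp) ⊕ ((s ⊕ Bm) ⊕ gm)))) ⊕ (Y ⊕ aN))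
    ⊜ ((((GH ⊕ Gk) ⊕ (s ⊕ s)) ⊕ (((Kn ⊕ Y) ⊕ F) ⊕ (aN ⊕ (Bp ⊕ Bm)))) ⊕ ((Gm ⊕ gp) ⊕ gm))) ≈-refl

  pair-Γ : ∀ g x al Cp Cm Gm gp gm →
    g * (x * (al * (Cp * Cm))) * (Gm * gp * gm)
    ≈ g * x * (al * Gm) * ((Cp * gp) * (Cm * gm))
  pair-Γ = solve 8 (λ g x al Cp Cm Gm gp gm →
    ((g ⊕ (x ⊕ (al ⊕ (Cp ⊕ Cm)))) ⊕ ((Gm ⊕ gp) ⊕ gm))
    ⊜ (((g ⊕ x) ⊕ (al ⊕ Gm)) ⊕ ((Cp ⊕ gp) ⊕ (Cm ⊕ gm)))) ≈-refl

  spread-Γ : ∀ x g u u′ v v′ Y₁ Y₂ a →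
    x * g * (u * u′) * (v * v′) * (Y₁ * Y₂ * a)
    ≈ x * g * (u * v) * a * ((Y₂ * v′) * (Y₁ * u′))
  spread-Γ = solve 9 (λ x g u u′ v v′ Y₁ Y₂ a →
    ((((x ⊕ g) ⊕ (u ⊕ u′)) ⊕ (v ⊕ v′)) ⊕ ((Y₁ ⊕ Y₂) ⊕ a))
    ⊜ ((((x ⊕ g) ⊕ (u ⊕ v)) ⊕ a) ⊕ ((Y₂ ⊕ v′) ⊕ (Y₁ ⊕ u′)))) ≈-refl

  gather-series : ∀ b a v ti gi tl gl →
    b * (a * a * a) * v * (ti * tl * (ti * tl) * (gi * gl))
    ≈ b * (a * a * a) * (tl * tl * gl) * (ti * ti * gi * v)
  gather-series = solve 7 (λ b a v ti gi tl gl →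
    (((b ⊕ ((a ⊕ a) ⊕ a)) ⊕ v) ⊕ (((ti ⊕ tl) ⊕ (ti ⊕ tl)) ⊕ (gi ⊕ gl)))
    ⊜ (((b ⊕ ((a ⊕ a) ⊕ a)) ⊕ ((tl ⊕ tl) ⊕ gl)) ⊕ (((ti ⊕ ti) ⊕ gi) ⊕ v))) ≈-refl

  gather-target : ∀ P D E t T g Gg H₃ s →
    P * D * E * (H₃ * ((s * t * T) * (s * t * T))) * (s * g * Gg)
    ≈ P * (s * s) * s * (E * (t * t * g)) * (D * (T * T * Gg * H₃))
  gather-target = solve 9 (λ P D E t T g Gg H₃ s →
    ((((P ⊕ D) ⊕ E) ⊕ (H₃ ⊕ (((s ⊕ t) ⊕ T) ⊕ ((s ⊕ t) ⊕ T)))) ⊕ ((s ⊕ g) ⊕ Gg))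
    ⊜ ((((P ⊕ (s ⊕ s)) ⊕ s) ⊕ (E ⊕ ((t ⊕ t) ⊕ g))) ⊕ (D ⊕ (((T ⊕ T) ⊕ Gg) ⊕ H₃)))) ≈-refl

-- Arithmetic modulo powers of p and the p-adic Gamma function

module PrimePowers (p : ℕ) (p-prime : Prime p) (p-odd : 2 ℕD.∤ p) where

  module ℤₚ′ = Padic p p-prime p-odd
  open ℤₚ′ using (ℤₚ; mkℤₚ; mk≈; residue; residue≡; coherent; ι; _⁻¹; ⁻¹-inverse; _/_; pochhammer; Γₚ; Γℕ; Γℕ-cong; reduce; mod-reduce;
    units; product-units-yes; product-units-no; p≢0; p^n≢0; p∣p^1+n; p∣-resp; p-coprime; 2<p; sum-syntax)
  open import Data.Integer.Base using (0ℤ; -1ℤ; _+_; _*_; _-_; -_)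
  open Hypergeometric
  open Congruences

  -- Units and inverses modulo powers of p

  U : ℤ → Set
  U x = p ℕD.∤ ∣ x ∣

  infix 4 _≡_[p^_]
  _≡_[p^_] : ℤ → ℤ → ℕ → Set
  a ≡ b [p^ k ] = a ≡ b [mod p ℕ.^ k ]

  lower : ∀ j k {a b} → a ≡ b [p^ j ℕ.+ k ] → a ≡ b [p^ j ]
  lower j k = mod-down (subst (p ℕ.^ j ℕD.∣_) (sym (ℕP.^-distribˡ-+-* p j k)) (ℕD.m∣m*n (p ℕ.^ k)))

  p^1 : p ℕ.^ 1 ≡ p
  p^1 = ℕP.*-identityʳ p

  U-resp : ∀ k {a b} → a ≡ b [p^ suc k ] → U a → U b
  U-resp k h u d = u (p∣-resp (mod-down (p∣p^1+n k) (mod-sym h)) d)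

  U-* : ∀ a b → U a → U b → U (a * b)
  U-* a b u v d with euclidsLemma ∣ a ∣ ∣ b ∣ p-prime (subst (p ℕD.∣_) (ℤP.abs-* a b) d)
  ... | inj₁ x = u x
  ... | inj₂ y = v y

  U-*⁻ʳ : ∀ a {b} → U (a * b) → U b
  U-*⁻ʳ a {b} u d = u (subst (p ℕD.∣_) (sym (ℤP.abs-* a b)) (ℕD.∣n⇒∣m*n ∣ a ∣ d))

  U-1 : U 1ℤ
  U-1 d = contradiction (ℕD.∣⇒≤ d) (ℕP.<⇒≱ (ℕP.<-trans (s≤s (s≤s z≤n)) (2<p)))

  U-neg : ∀ a → U a → U (- a)
  U-neg a = subst (p ℕD.∤_) (sym (ℤP.∣-i∣≡∣i∣ a))

  U-small : ∀ j → suc j ℕ.< p → U (+ suc j)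
  U-small j j<p d = ℕP.<⇒≱ j<p (ℕD.∣⇒≤ d)

  U-2 : U (+ 2)
  U-2 = U-small 1 (2<p)

  U-poch : ∀ x k → (∀ i → i ℕ.< k → U (x + + i)) → U (poch x k)
  U-poch x zero    h = U-1
  U-poch x (suc k) h = U-* (poch x k) (x + + k) (U-poch x k λ i i<k → h i (ℕP.m<n⇒m<1+n i<k)) (h k (ℕP.n<1+n k))

  -- The form to which a fifth power in the statement reduces.
  fifth : ℤ → ℤ
  fifth x = x * (x * (x * (x * (x * 1ℤ))))

  cancel : ∀ k c {a b} → U c → c * a ≡ c * b [p^ k ] → a ≡ b [p^ k ]
  cancel k c {a} {b} u h with coprime-inverse c (p ℕ.^ k) (p-coprime u k)
  ... | v , cv≡1 = mod-trans (mod-sym (s a)) (mod-trans (mod-*ˡ v h) (s b))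
    where
    s : ∀ a → v * (c * a) ≡ a [p^ k ]
    s a = combine a cv≡1 (e v c a)
      where e : ∀ v c a → v * (c * a) - a ≡ a * (c * v - 1ℤ)
            e = solve-∀

  opaque
    inv : ℤ → ℤ
    inv x = residue (ι x ⁻¹) 5

    inv-inverse : ∀ x → U x → x * inv x ≡ 1ℤ [p^ 5 ]
    inv-inverse x u = residue≡ (⁻¹-inverse (ι x) u) 5

  ≡0-* : ∀ j k {x y} → x ≡ 0ℤ [p^ j ] → y ≡ 0ℤ [p^ k ] → x * y ≡ 0ℤ [p^ j ℕ.+ k ]
  ≡0-* j k {x} {y} h h′ = subst (x * y ≡ 0ℤ [mod_]) (sym (ℕP.^-distribˡ-+-* p j k)) (mod-mul (p ℕ.^ j) (p ℕ.^ k) h h′)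

  ≡0-p : ∀ {x} → p ℕD.∣ ∣ x ∣ → x ≡ 0ℤ [p^ 1 ]
  ≡0-p {x} d = subst (x ≡ 0ℤ [mod_]) (sym p^1) (∣⇒≡0 (ℤS.∣ᵤ⇒∣ d))

  ≡0-p⁻ : ∀ {x} → x ≡ 0ℤ [p^ 1 ] → p ℕD.∣ ∣ x ∣
  ≡0-p⁻ {x} h = ℤS.∣⇒∣ᵤ (≡0⇒∣ (subst (x ≡ 0ℤ [mod_]) p^1 h))

  ≡0-*ˡ : ∀ k x {y} → y ≡ 0ℤ [p^ k ] → x * y ≡ 0ℤ [p^ k ]
  ≡0-*ˡ k x {y} h = mod-trans (mod-*ˡ x h) (≡-to-mod (ℤP.*-zeroʳ x))

  ≡0-*ʳ : ∀ k {x} y → x ≡ 0ℤ [p^ k ] → x * y ≡ 0ℤ [p^ k ]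
  ≡0-*ʳ k {x} y h = mod-trans (mod-*ʳ y h) (≡-to-mod (ℤP.*-zeroˡ y))

  -- Functions affine in x² and y² modulo p⁴

  record Even (f : ℤ → ℤ → ℤ) : Set where
    field
      c₀ c₁ c₂ : ℤ
      expansion : ∀ {x y} → x ≡ 0ℤ [p^ 1 ] → y ≡ 0ℤ [p^ 1 ] → f x y ≡ c₀ + c₁ * (x * x) + c₂ * (y * y) [p^ 4 ]

  open Even

  Even-const : ∀ c → Even (λ _ _ → c)
  Even-const c = record { c₀ = c ; c₁ = 0ℤ ; c₂ = 0ℤ ; expansion = λ {x} {y} _ _ → ≡-to-mod (e c x y) }
    where e : ∀ c x y → c ≡ c + 0ℤ * (x * x) + 0ℤ * (y * y)
          e = solve-∀

  Even-+ : ∀ {f g} → Even f → Even g → Even (λ x y → f x y + g x y)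
  Even-+ F G = record { c₀ = c₀ F + c₀ G ; c₁ = c₁ F + c₁ G ; c₂ = c₂ F + c₂ G ; expansion = λ {x} {y} h k →
    mod-trans (mod-+ (expansion F h k) (expansion G h k)) (≡-to-mod (e (c₀ F) (c₁ F) (c₂ F) (c₀ G) (c₁ G) (c₂ G) (x * x) (y * y))) }
    where e : ∀ a b c a′ b′ c′ x y → a + b * x + c * y + (a′ + b′ * x + c′ * y) ≡ a + a′ + (b + b′) * x + (c + c′) * y
          e = solve-∀

  -- In the product of two expansions, the terms in x⁴, x²y² and y⁴ vanish modulo p⁴ because p
  -- divides x and y.
  Even-* : ∀ {f g} → Even f → Even g → Even (λ x y → f x y * g x y)
  Even-* F G = record
    { c₀ = c₀ F * c₀ G ; c₁ = c₀ F * c₁ G + c₁ F * c₀ G ; c₂ = c₀ F * c₂ G + c₂ F * c₀ G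
    ; expansion = λ {x} {y} h k → mod-trans (mod-* (expansion F h k) (expansion G h k))
        (mod-trans (≡-to-mod (e (c₀ F) (c₁ F) (c₂ F) (c₀ G) (c₁ G) (c₂ G) (x * x) (y * y)))
          (mod-trans (mod-+ˡ (main (x * x) (y * y)) (mod-+ (mod-+ (quartic (c₁ F * c₁ G) (sq h) (sq h)) (quartic (c₁ F * c₂ G + c₂ F * c₁ G) (sq h) (sq k))) (quartic (c₂ F * c₂ G) (sq k) (sq k))))
            (≡-to-mod (ℤP.+-identityʳ (main (x * x) (y * y)))))) }
    where
    main : ℤ → ℤ → ℤ
    main X Y = c₀ F * c₀ G + (c₀ F * c₁ G + c₁ F * c₀ G) * X + (c₀ F * c₂ G + c₂ F * c₀ G) * Y
    sq : ∀ {x} → x ≡ 0ℤ [p^ 1 ] → x * x ≡ 0ℤ [p^ 2 ]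
    sq h = ≡0-* 1 1 h h
    quartic : ∀ c {X Y} → X ≡ 0ℤ [p^ 2 ] → Y ≡ 0ℤ [p^ 2 ] → c * (X * Y) ≡ 0ℤ [p^ 4 ]
    quartic c {X} {Y} h k = ≡0-*ˡ 4 c {X * Y} (≡0-* 2 2 {X} {Y} h k)
    e : ∀ a b c a′ b′ c′ x y → (a + b * x + c * y) * (a′ + b′ * x + c′ * y)
        ≡ a * a′ + (a * b′ + b * a′) * x + (a * c′ + c * a′) * y + (b * b′ * (x * x) + (b * c′ + c * b′) * (x * y) + c * c′ * (y * y))
    e = solve-∀

  Even-≗ : ∀ {f g} → (∀ x y → f x y ≡ g x y) → Even f → Even g
  Even-≗ h F = record { c₀ = c₀ F ; c₁ = c₁ F ; c₂ = c₂ F ; expansion = λ {x} {y} hx hy → mod-trans (≡-to-mod (sym (h x y))) (expansion F hx hy) }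

  Even-pair-x : ∀ c → Even (λ x _ → (c + x) * (c - x))
  Even-pair-x c = record { c₀ = c * c ; c₁ = -1ℤ ; c₂ = 0ℤ ; expansion = λ {x} {y} _ _ → ≡-to-mod (e c x y) }
    where e : ∀ c x y → (c + x) * (c - x) ≡ c * c + -1ℤ * (x * x) + 0ℤ * (y * y)
          e = solve-∀

  Even-swap : ∀ {f} → Even f → Even (λ x y → f y x)
  Even-swap F = record { c₀ = c₀ F ; c₁ = c₂ F ; c₂ = c₁ F ; expansion = λ {x} {y} h k → mod-trans (expansion F k h) (≡-to-mod (e (c₀ F) (c₁ F) (c₂ F) (x * x) (y * y))) }
    where e : ∀ a b c x y → a + b * y + c * x ≡ a + c * x + b * y
          e = solve-∀

  Even-poch : ∀ c j → Even (λ x _ → poch (c + x) j * poch (c - x) j)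
  Even-poch c zero    = Even-const 1ℤ
  Even-poch c (suc j) = Even-≗ (λ x y → e (poch (c + x) j) (poch (c - x) j) c x (+ j)) (Even-* (Even-poch c j) (Even-pair-x (c + + j)))
    where e : ∀ u v c x j → u * v * ((c + j + x) * (c + j - x)) ≡ u * (c + x + j) * (v * (c - x + j))
          e = solve-∀

  Even-binSum : ∀ n {f : ℕ → ℕ → ℤ → ℤ → ℤ} → (∀ i l → Even (f i l)) → Even (λ x y → binSum n (λ i l → f i l x y))
  Even-binSum zero    h = h 0 0
  Even-binSum (suc n) h = Even-+ (Even-binSum n λ i l → h (suc i) l) (Even-binSum n λ i l → h i (suc l))

  module _ {f} (F : Even f) where

    private
      0≡0 : 0ℤ ≡ 0ℤ [p^ 1 ]
      0≡0 = mod-refl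

    Even-00 : f 0ℤ 0ℤ ≡ c₀ F [p^ 4 ]
    Even-00 = mod-trans (expansion F 0≡0 0≡0) (≡-to-mod (e (c₀ F) (c₁ F) (c₂ F)))
      where e : ∀ a b c → a + b * 0ℤ + c * 0ℤ ≡ a
            e = solve-∀

    Even-x0 : ∀ {x} → x ≡ 0ℤ [p^ 1 ] → f x 0ℤ ≡ c₀ F + c₁ F * (x * x) [p^ 4 ]
    Even-x0 {x} h = mod-trans (expansion F h 0≡0) (≡-to-mod (e (c₀ F) (c₁ F) (c₂ F) (x * x)))
      where e : ∀ a b c x → a + b * x + c * 0ℤ ≡ a + b * x
            e = solve-∀

    Even-0y : ∀ {y} → y ≡ 0ℤ [p^ 1 ] → f 0ℤ y ≡ c₀ F + c₂ F * (y * y) [p^ 4 ]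
    Even-0y {y} h = mod-trans (expansion F 0≡0 h) (≡-to-mod (e (c₀ F) (c₁ F) (c₂ F) (y * y)))
      where e : ∀ a b c x → a + b * 0ℤ + c * x ≡ a + c * x
            e = solve-∀

  -- The Gamma function modulo p⁵ and its reflection formula

  opaque
    G : ℤ → ℤ
    G x = Γℕ (reduce x 5)

    G-ℕ : ∀ x m → x ≡ + m [p^ 5 ] → G x ≡ Γℕ m [p^ 5 ]
    G-ℕ x m h = Γℕ-cong 5 (mod-trans (mod-sym (mod-reduce x 5)) h)

    residue-Γₚ : ∀ x → residue (Γₚ x) 5 ≡ G (residue x 5)
    residue-Γₚ x = refl

    representative : ∀ x → ∃[ m ] x ≡ + m [p^ 5 ]
    representative x = reduce x 5 , mod-reduce x 5

  G-cong : ∀ {x y} → x ≡ y [p^ 5 ] → G x ≡ G y [p^ 5 ]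
  G-cong {x} {y} h with representative y
  ... | m , y≡m = mod-trans (G-ℕ x m (mod-trans h y≡m)) (mod-sym (G-ℕ y m y≡m))

  Γℕ-unit : ∀ m → U (Γℕ m)
  Γℕ-unit m = U-* (-1ℤ ℤ.^ m) (+ product (units m)) (pow m) (prod m)
    where
    pow : ∀ m → U (-1ℤ ℤ.^ m)
    pow zero    = U-1
    pow (suc m) = U-* -1ℤ (-1ℤ ℤ.^ m) U-1 (pow m)
    prod : ∀ m → U (+ product (units m))
    prod zero    = U-1
    prod (suc m) with p ℕD.∣? m
    ... | yes d = subst (λ t → U (+ t)) (sym (product-units-no m d)) (prod m)
    ... | no  u = subst U (trans (sym (ℤP.pos-* (product (units m)) m)) (cong +_ (sym (product-units-yes m u)))) (U-* (+ product (units m)) (+ m) (prod m) u)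

  Γℕ-suc : ∀ m → p ℕD.∤ m → Γℕ (suc m) ≡ - + m * Γℕ m
  Γℕ-suc m u = trans (cong (-1ℤ ℤ.^ suc m *_) (trans (cong +_ (product-units-yes m u)) (ℤP.pos-* (product (units m)) m)))
    (e (-1ℤ ℤ.^ m) (+ product (units m)) (+ m))
    where e : ∀ s t m → -1ℤ * s * (t * m) ≡ - m * (s * t)
          e = solve-∀

  Γℕ-suc-nonunit : ∀ m → p ℕD.∣ m → Γℕ (suc m) ≡ - Γℕ m
  Γℕ-suc-nonunit m d = trans (cong (λ t → -1ℤ ℤ.^ suc m * + t) (product-units-no m d)) (e (-1ℤ ℤ.^ m) (+ product (units m)))
    where e : ∀ s t → -1ℤ * s * t ≡ - (s * t)
          e = solve-∀

  G-unit : ∀ x → U (G x)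
  G-unit x with representative x
  ... | m , x≡m = U-resp 4 (mod-sym (G-ℕ x m x≡m)) (Γℕ-unit m)

  G-suc : ∀ x → U x → G (1ℤ + x) ≡ - x * G x [p^ 5 ]
  G-suc x u with representative x
  ... | m , x≡m = mod-trans (G-ℕ (1ℤ + x) (suc m) (mod-+ˡ 1ℤ x≡m))
    (mod-trans (≡-to-mod (Γℕ-suc m (U-resp 4 x≡m u))) (mod-* (mod-neg (mod-sym x≡m)) (mod-sym (G-ℕ x m x≡m))))

  G-suc-nonunit : ∀ x → x ≡ 0ℤ [p^ 1 ] → G (1ℤ + x) ≡ - G x [p^ 5 ]
  G-suc-nonunit x h with representative x
  ... | m , x≡m = mod-trans (G-ℕ (1ℤ + x) (suc m) (mod-+ˡ 1ℤ x≡m))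
    (mod-trans (≡-to-mod (Γℕ-suc-nonunit m (≡0-p⁻ (mod-trans (mod-sym (lower 1 4 x≡m)) h)))) (mod-neg (mod-sym (G-ℕ x m x≡m))))

  -- Every factor has to be a unit: a step at a multiple of p multiplies Γ by -1 instead of -x.
  G-poch : ∀ x k → (∀ i → i ℕ.< k → U (x + + i)) → G (x + + k) ≡ sgn k * poch x k * G x [p^ 5 ]
  G-poch x zero    h = mod-trans (≡-to-mod (cong G (ℤP.+-identityʳ x))) (≡-to-mod (e (G x)))
    where e : ∀ g → g ≡ 1ℤ * 1ℤ * g
          e = solve-∀
  G-poch x (suc k) h = mod-trans (≡-to-mod (cong G (e₁ x (+ k)))) (mod-trans (G-suc (x + + k) (h k (ℕP.n<1+n k)))
    (mod-trans (mod-*ˡ (- (x + + k)) (G-poch x k λ i i<k → h i (ℕP.m<n⇒m<1+n i<k))) (≡-to-mod (e₂ (sgn k) (poch x k) (G x) (x + + k)))))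
    where
    e₁ : ∀ x k → x + (1ℤ + k) ≡ 1ℤ + (x + k)
    e₁ = solve-∀
    e₂ : ∀ s q g z → - z * (s * q * g) ≡ - s * (q * z) * g
    e₂ = solve-∀

  refl-product : ℤ → ℤ
  refl-product x = G x * G (1ℤ - x)

  refl-cong : ∀ {x y} → x ≡ y [p^ 5 ] → refl-product x ≡ refl-product y [p^ 5 ]
  refl-cong {x} {y} h = mod-* (G-cong h) (G-cong {1ℤ - x} {1ℤ - y} (mod-+ˡ 1ℤ (mod-neg h)))

  refl-suc : ∀ x → U x → refl-product (1ℤ + x) ≡ - refl-product x [p^ 5 ]
  refl-suc x u = mod-trans (mod-*ʳ (G (1ℤ - (1ℤ + x))) (G-suc x u)) (mod-trans (≡-to-mod (trans (cong (λ t → - x * G x * G t) (e₁ x)) (e₂ x (G x) (G (- x)))))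
    (mod-trans (mod-*ˡ (- G x) (mod-sym (G-suc (- x) (U-neg x u)))) (≡-to-mod (sym (ℤP.neg-distribˡ-* (G x) (G (1ℤ - x)))))))
    where
    e₁ : ∀ x → 1ℤ - (1ℤ + x) ≡ - x
    e₁ = solve-∀
    e₂ : ∀ x g h → - x * g * h ≡ - g * (- (- x) * h)
    e₂ = solve-∀

  neg-≡0 : ∀ k {x} → x ≡ 0ℤ [p^ k ] → - x ≡ 0ℤ [p^ k ]
  neg-≡0 k h = mod-neg h

  refl-suc-nonunit : ∀ x → x ≡ 0ℤ [p^ 1 ] → refl-product (1ℤ + x) ≡ refl-product x [p^ 5 ]
  refl-suc-nonunit x h = mod-trans (mod-*ʳ (G (1ℤ - (1ℤ + x))) (G-suc-nonunit x h)) (mod-trans (≡-to-mod (trans (cong (λ t → - G x * G t) (e₁ x)) (e₂ (G x) (G (- x)))))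
    (mod-*ˡ (G x) (mod-sym (G-suc-nonunit (- x) (neg-≡0 1 h)))))
    where
    e₁ : ∀ x → 1ℤ - (1ℤ + x) ≡ - x
    e₁ = solve-∀
    e₂ : ∀ g h → - g * h ≡ g * - h
    e₂ = solve-∀

  -- The step out of z ≡ 0 preserves the reflection product, and each of the j steps after it starts
  -- at a unit and changes the sign.
  refl-steps : ∀ {z} → z ≡ 0ℤ [p^ 1 ] → ∀ j → j ℕ.< p → refl-product (z + + suc j) ≡ sgn j * refl-product z [p^ 5 ]
  refl-steps {z} h zero    _   = mod-trans (≡-to-mod (cong refl-product (ℤP.+-comm z 1ℤ))) (mod-trans (refl-suc-nonunit z h) (≡-to-mod (sym (ℤP.*-identityˡ (refl-product z)))))
  refl-steps {z} h (suc j) j<p = mod-trans (≡-to-mod (cong refl-product (e z (+ j))))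
    (mod-trans (refl-suc (z + + suc j) u)
      (mod-trans (mod-neg (refl-steps h j (ℕP.<-trans (ℕP.n<1+n j) j<p))) (≡-to-mod (ℤP.neg-distribˡ-* (sgn j) (refl-product z)))))
    where
    e : ∀ z j → z + (1ℤ + (1ℤ + j)) ≡ 1ℤ + (z + (1ℤ + j))
    e = solve-∀
    u : U (z + + suc j)
    u = U-resp 0 {+ suc j} (mod-trans (≡-to-mod (sym (ℤP.+-identityˡ (+ suc j)))) (mod-+ʳ (+ suc j) (mod-sym h))) (U-small j j<p)

  p-odd-sgn : ∀ q → suc q ≡ p → sgn q ≡ 1ℤ
  p-odd-sgn q e = go q (subst (2 ℕD.∤_) (sym e) p-odd)
    where
    go : ∀ q → 2 ℕD.∤ suc q → sgn q ≡ 1ℤ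
    go zero          _ = refl
    go (suc zero)    h = contradiction ℕD.∣-refl h
    go (suc (suc q)) h = trans (ℤP.neg-involutive (sgn q)) (go q λ d → h (ℕD.∣m∣n⇒∣m+n ℕD.∣-refl d))

  -- Between consecutive multiples of p there is one step that preserves the product and p - 1, an
  -- even number, that change its sign. At 0 the value is Γ(0) Γ(1) = -1.
  refl-multiple : ∀ c → refl-product (+ (c ℕ.* p)) ≡ -1ℤ [p^ 5 ]
  refl-multiple zero = mod-trans (mod-*ˡ (G 0ℤ) (G-suc-nonunit (0ℤ) mod-refl)) (mod-trans (mod-* G0 (mod-neg G0)) mod-refl)
    where
    G0 : G 0ℤ ≡ 1ℤ [p^ 5 ]
    G0 = G-ℕ 0ℤ 0 mod-refl
  refl-multiple (suc c) = mod-trans (≡-to-mod (cong refl-product (trans (cong +_ (ℕP.+-comm p (c ℕ.* p))) (cong (λ t → + (c ℕ.* p) + + t) (sym q+1)))))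
    (mod-trans (refl-steps {+ (c ℕ.* p)} (≡0-p (ℕD.n∣m*n c)) (ℕ.pred p) (ℕP.≤-reflexive q+1))
      (mod-trans (≡-to-mod (trans (cong (_* refl-product (+ (c ℕ.* p))) (p-odd-sgn (ℕ.pred p) q+1)) (ℤP.*-identityˡ (refl-product (+ (c ℕ.* p)))))) (refl-multiple c)))
    where
    q+1 : suc (ℕ.pred p) ≡ p
    q+1 = ℕP.suc-pred p

  refl-divisible : ∀ {m} → p ℕD.∣ m → refl-product (+ m) ≡ -1ℤ [p^ 5 ]
  refl-divisible (ℕD.divides c refl) = refl-multiple c

  refl-nonunit : ∀ {z} → z ≡ 0ℤ [p^ 1 ] → refl-product z ≡ -1ℤ [p^ 5 ]
  refl-nonunit {z} h = mod-trans (refl-cong z≡m) (refl-divisible (≡0-p⁻ (mod-trans (mod-sym (lower 1 4 z≡m)) h)))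
    where z≡m = proj₂ (representative z)

  -- For p dividing z, Γ(1 - z) = -Γ(-z), which turns the reflection value -1 into 1.
  G-opposite : ∀ {z} → z ≡ 0ℤ [p^ 1 ] → G z * G (- z) ≡ 1ℤ [p^ 5 ]
  G-opposite {z} h = mod-trans (≡-to-mod (e (G z) (G (- z)))) (mod-trans (mod-neg (mod-*ˡ (G z) (mod-sym (G-suc-nonunit (- z) (neg-≡0 1 h))))) (mod-neg (refl-nonunit h)))
    where e : ∀ x y → x * y ≡ - (x * - y)
          e = solve-∀

  -- By the functional equation Γ(m + z) Γ(m - z) is, for p ∣ z, the product of u² - z² over the units u < m.

  Even-resp : ∀ {f g} → (∀ {x y} → x ≡ 0ℤ [p^ 1 ] → y ≡ 0ℤ [p^ 1 ] → f x y ≡ g x y [p^ 4 ]) → Even g → Even f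
  Even-resp h F = record { c₀ = c₀ F ; c₁ = c₁ F ; c₂ = c₂ F ; expansion = λ hx hy → mod-trans (h hx hy) (expansion F hx hy) }

  G-even : ∀ m → Even (λ z _ → G (+ m + z) * G (+ m - z))
  G-even zero = Even-resp (λ {z} h _ → base z h) (Even-const 1ℤ)
    where
    base : ∀ z → z ≡ 0ℤ [p^ 1 ] → G (0ℤ + z) * G (0ℤ - z) ≡ 1ℤ [p^ 4 ]
    base z h = lower 4 1 (mod-trans (≡-to-mod (cong₂ (λ s t → G s * G t) (ℤP.+-identityˡ z) (ℤP.+-identityˡ (- z)))) (G-opposite h))
  G-even (suc m) = go (p ℕD.∣? m)
    where
    near : ∀ z → z ≡ 0ℤ [p^ 1 ] → + m ≡ + m + z [p^ 1 ]
    near z h = mod-trans (≡-to-mod (sym (ℤP.+-identityʳ (+ m)))) (mod-+ˡ (+ m) (mod-sym h))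
    shift : ∀ z → G (+ suc m + z) ≡ G (1ℤ + (+ m + z))
    shift z = cong G (ℤP.+-assoc 1ℤ (+ m) z)
    go : Dec (p ℕD.∣ m) → Even (λ z _ → G (+ suc m + z) * G (+ suc m - z))
    go (yes d) = Even-resp (λ {z} h _ → both z h) (G-even m)
      where
      step : ∀ z → z ≡ 0ℤ [p^ 1 ] → G (+ suc m + z) ≡ - G (+ m + z) [p^ 5 ]
      step z h = mod-trans (≡-to-mod (shift z)) (G-suc-nonunit (+ m + z) (mod-trans (mod-sym (near z h)) (≡0-p {+ m} d)))
      e : ∀ x y → - x * - y ≡ x * y
      e = solve-∀
      both : ∀ z → z ≡ 0ℤ [p^ 1 ] → G (+ suc m + z) * G (+ suc m - z) ≡ G (+ m + z) * G (+ m - z) [p^ 4 ]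
      both z h = lower 4 1 (mod-trans (mod-* (step z h) (step (- z) (neg-≡0 1 h))) (≡-to-mod (e (G (+ m + z)) (G (+ m - z)))))
    go (no u) = Even-resp (λ {z} h _ → both z h) (Even-* (Even-pair-x (+ m)) (G-even m))
      where
      step : ∀ z → z ≡ 0ℤ [p^ 1 ] → G (+ suc m + z) ≡ - (+ m + z) * G (+ m + z) [p^ 5 ]
      step z h = mod-trans (≡-to-mod (shift z)) (G-suc (+ m + z) (U-resp 0 {+ m} {+ m + z} (near z h) u))
      e : ∀ m x g h → - (m + x) * g * (- (m - x) * h) ≡ (m + x) * (m - x) * (g * h)
      e = solve-∀
      both : ∀ z → z ≡ 0ℤ [p^ 1 ] → G (+ suc m + z) * G (+ suc m - z) ≡ (+ m + z) * (+ m - z) * (G (+ m + z) * G (+ m - z)) [p^ 4 ]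
      both z h = lower 4 1 (mod-trans (mod-* (step z h) (step (- z) (neg-≡0 1 h))) (≡-to-mod (e (+ m) z (G (+ m + z)) (G (+ m - z)))))

  -- From p-adic integers to residues modulo p⁵

  bar : ℤₚ → ℤ
  bar x = residue x 5

  coherent-+ : ∀ x j k → residue x (k ℕ.+ j) ≡ residue x j [p^ j ]
  coherent-+ x j zero    = mod-refl
  coherent-+ x j (suc k) = mod-trans (mod-down (subst (p ℕ.^ j ℕD.∣_) (sym (ℕP.^-distribˡ-+-* p k j)) (ℕD.n∣m*n (p ℕ.^ k))) (coherent x (k ℕ.+ j))) (coherent-+ x j k)

  bar-unit : ∀ y c → bar y ≡ c [p^ 5 ] → U c → ℤₚ′.Unit y
  bar-unit y c h u = U-resp 0 (mod-trans (mod-sym (lower 1 4 h)) (coherent-+ y 1 4)) u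

  bar-⁻¹-inverse : ∀ y c → bar y ≡ c [p^ 5 ] → U c → c * bar (y ⁻¹) ≡ 1ℤ [p^ 5 ]
  bar-⁻¹-inverse y c h u = mod-trans (mod-*ʳ (bar (y ⁻¹)) (mod-sym h)) (residue≡ (⁻¹-inverse y (bar-unit y c h u)) 5)

  bar-⁻¹ : ∀ y c → bar y ≡ c [p^ 5 ] → U c → bar (y ⁻¹) ≡ inv c [p^ 5 ]
  bar-⁻¹ y c h u = unique-inverse c c (bar (y ⁻¹)) (inv c) mod-refl (bar-⁻¹-inverse y c h u) (inv-inverse c u)

  bar-fraction′ : ∀ c d → U d → d * bar (ι c / ι d) ≡ c [p^ 5 ]
  bar-fraction′ c d u = mod-trans (≡-to-mod (e c d (bar (ι d ⁻¹)))) (mod-trans (mod-*ˡ c (bar-⁻¹-inverse (ι d) d mod-refl u)) (≡-to-mod (ℤP.*-identityʳ c)))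
    where e : ∀ c d v → d * (c * v) ≡ c * (d * v)
          e = solve-∀

  bar-fraction : ∀ c d t → U d → d * t ≡ c [p^ 5 ] → bar (ι c / ι d) ≡ t [p^ 5 ]
  bar-fraction c d t u h = cancel 5 d u (mod-trans (bar-fraction′ c d u) (mod-sym h))

  bar-pochhammer : ∀ x t k → bar x ≡ t [p^ 5 ] → bar (pochhammer x k) ≡ poch t k [p^ 5 ]
  bar-pochhammer x t zero    h = mod-refl
  bar-pochhammer x t (suc k) h = mod-* (bar-pochhammer x t k h) (mod-+ʳ (+ k) h)

  bar-Γ : ∀ x t → bar x ≡ t [p^ 5 ] → bar (ℤₚ′.Γₚ x) ≡ G t [p^ 5 ]
  bar-Γ x t h = mod-trans (≡-to-mod (residue-Γₚ x)) (G-cong h)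

  bar-sum : ∀ n (f : Fin (suc n) → ℤₚ) (g : ℕ → ℤ) → (∀ i → bar (f i) ≡ g (toℕ i) [p^ 5 ]) →
    bar (sum-syntax (suc n) f) ≡ diagSum n (λ i _ → g i) [p^ 5 ]
  bar-sum zero    f g h = mod-trans (≡-to-mod (ℤP.+-identityʳ (bar (f Fin.zero)))) (h Fin.zero)
  bar-sum (suc n) f g h = mod-+ (h Fin.zero) (bar-sum n (λ i → f (Fin.suc i)) (λ i → g (suc i)) (λ i → h (Fin.suc i)))

  bar-sum-< : ∀ q n → suc n ≡ q → (f : Fin q → ℤₚ) (g : ℕ → ℤ) → (∀ i → bar (f i) ≡ g (toℕ i) [p^ 5 ]) →
    bar (sum-syntax q f) ≡ diagSum n (λ i _ → g i) [p^ 5 ]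
  bar-sum-< _ n refl f g h = bar-sum n f g h

  -- A p-adic integer divisible by p⁵ is divided by shifting its residues by five places.
  divisible : ∀ {w z} → (∀ n → residue w n ≡ + (p ℕ.^ 5)) → bar z ≡ 0ℤ [p^ 5 ] → w ℤₚ′.∣ z
  divisible {w} {z} w≡ h = record { quotient = mkℤₚ q coh ; equality = mk≈ λ n → mod-trans (≡-to-mod (trans (cong (q n *_) (w≡ n)) (sym (q-eq n)))) (shifted n) }
    where
    P : ℤ
    P = + (p ℕ.^ 5)
    div : ∀ n → P ℤS.∣ residue z (n ℕ.+ 5)
    div n = ≡0⇒∣ (mod-trans (coherent-+ z 5 n) h)
    q : ℕ → ℤ
    q n = ℤS._∣_.quotient (div n)
    q-eq : ∀ n → residue z (n ℕ.+ 5) ≡ q n * P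
    q-eq n = ℤS._∣_.equality (div n)
    shifted : ∀ n → residue z (n ℕ.+ 5) ≡ residue z n [p^ n ]
    shifted n = subst (λ k → residue z k ≡ residue z n [p^ n ]) (ℕP.+-comm 5 n) (coherent-+ z n 5)
    instance
      P≢0 : ℕ.NonZero (p ℕ.^ 5)
      P≢0 = p^n≢0 5
    coh : ∀ n → q (suc n) ≡ q n [p^ n ]
    -- Coherence of `z` at level n + 5 gives divisibility by p^n p⁵, from which p⁵ is cancelled.
    coh n = mod (ℤS.*-cancelʳ-∣ P (subst₂ ℤS._∣_ (trans (cong +_ (ℕP.^-distribˡ-+-* p n 5)) (ℤP.pos-* (p ℕ.^ n) (p ℕ.^ 5)))
      (trans (cong₂ _-_ (q-eq (suc n)) (q-eq n)) (e (q (suc n)) (q n) P)) (divides-difference (coherent z (n ℕ.+ 5)))))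
      where e : ∀ a b c → a * c - b * c ≡ (a - b) * c
            e = solve-∀

  p⁵ : fifth (+ p) ≡ + (p ℕ.^ 5)
  p⁵ = sym (trans (ℤP.pos-* p (p ℕ.^ 4)) (cong (+ p *_) (trans (ℤP.pos-* p (p ℕ.^ 3)) (cong (+ p *_) (trans (ℤP.pos-* p (p ℕ.^ 2)) (cong (+ p *_)
    (trans (ℤP.pos-* p (p ℕ.^ 1)) (cong (+ p *_) (ℤP.pos-* p 1)))))))))

  difference-≡0 : ∀ {a b} → a ≡ b [p^ 5 ] → a - b ≡ 0ℤ [p^ 5 ]
  difference-≡0 {a} {b} h = combine 1ℤ h (e a b)
    where e : ∀ a b → a - b - 0ℤ ≡ 1ℤ * (a - b)
          e = solve-∀

-- The supercongruence in terms of integers modulo p⁵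

odd-half : ∀ q → 2 ℕD.∤ q → ∃[ r ] q ≡ suc (r ℕ.+ r)
odd-half zero          h = contradiction (2 ℕD.∣0) h
odd-half (suc zero)    h = 0 , refl
odd-half (suc (suc q)) h with odd-half q (λ d → h (ℕD.∣m∣n⇒∣m+n ℕD.∣-refl d))
... | r , e = suc r , cong (λ t → suc t) (trans (cong suc e) (cong suc (sym (ℕP.+-suc r r))))

-- Here N = (1 - r)/2, n = N + d = (p - r)/5, and a lifts r/5.
module Evaluation (p : ℕ) (p-prime : Prime p) (p-odd : 2 ℕD.∤ p) (N d m a : ℕ) (n≡2m : N ℕ.+ d ≡ m ℕ.+ m)
  (size : suc (5 ℕ.* (N ℕ.+ d)) ≡ p ℕ.+ 2 ℕ.* N) (small : suc (3 ℕ.* (N ℕ.+ d)) ℕ.≤ p) (p∤5 : p ℕD.∤ 5)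
  (5a : + 5 ℤ.* + a ≡ 1ℤ ℤ.- + 2 ℤ.* + N [mod p ℕ.^ 5 ]) where

  open import Data.Integer.Base using (0ℤ; -1ℤ; _+_; _*_; _-_; -_)
  open Padic p p-prime p-odd using (ℤₚ; ι; _⁻¹; _/_; pochhammer; Γₚ; p≢0; 2<p; sum-syntax)
    renaming (_+_ to _⊞_; _-_ to _⊟_)
  open Monomial ℤP.*-1-commutativeMonoid
  open Hypergeometric
  open Congruences
  open PrimePowers p p-prime p-odd

  n h : ℕ
  n = N ℕ.+ d
  h = a ℕ.+ a ℕ.+ N

  -- Lifts of r/5, p/5, 1/2 - r/10 and 1/2 + r/10.
  A π H k : ℤ
  A = + a
  π = A + + n
  H = + h
  k = 1ℤ - H

  module R = SetoidReasoning (mod-setoid (p ℕ.^ 5))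

  -- Since p and r are odd, n = (p - r)/5 is even; this removes every sign (-1)^n below.
  sgn-n : sgn n ≡ 1ℤ
  sgn-n = trans (cong sgn n≡2m) (trans (sgn-+ m m) (sgn² m))

  size′ : 1ℤ + + 5 * + n ≡ + p + + 2 * + N
  size′ = trans (cong (λ t → 1ℤ + t) (sym (ℤP.pos-* 5 n))) (trans (cong +_ size) (cong (λ t → + p + t) (ℤP.pos-* 2 N)))

  5π≡p : + 5 * π ≡ + p [p^ 5 ]
  5π≡p = combine 1ℤ 5a (trans (cong (λ t → + 5 * π - t) p≡) (e A (+ n) (+ N)))
    where
    p≡ : + p ≡ 1ℤ + + 5 * + n - + 2 * + N
    p≡ = trans (e₀ (+ p) (+ 2 * + N)) (cong (_- + 2 * + N) (sym size′))
      where e₀ : ∀ p x → p ≡ p + x - x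
            e₀ = solve-∀
    e : ∀ A n N → + 5 * (A + n) - (1ℤ + + 5 * n - + 2 * N) ≡ 1ℤ * (+ 5 * A - (1ℤ - + 2 * N))
    e = solve-∀

  π≡0 : π ≡ 0ℤ [p^ 1 ]
  π≡0 = cancel 1 (+ 5) p∤5 (mod-trans (lower 1 4 5π≡p) (mod-trans (≡0-p {+ p} ℕD.∣-refl) (≡-to-mod (sym (ℤP.*-zeroʳ (+ 5))))))

  2H : + 2 * H ≡ 1ℤ - A [p^ 5 ]
  2H = combine 1ℤ 5a (e A (+ N))
    where e : ∀ A N → + 2 * (A + A + N) - (1ℤ - A) ≡ 1ℤ * (+ 5 * A - (1ℤ - + 2 * N))
          e = solve-∀

  -- Units among the arguments

  below : ∀ {i n} → i ℕ.< n → ∃[ j ] n ≡ i ℕ.+ suc j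
  below {i} {n} i<n = n ℕ.∸ suc i , trans (sym (ℕP.m+[n∸m]≡n i<n)) (sym (ℕP.+-suc i (n ℕ.∸ suc i)))

  -- Each unit condition is reduced to a residue strictly between 0 and p. The multiplier c, one of
  -- ±1 and ±2, clears the denominator 2 of H and adjusts the sign.
  U-near : ∀ c x j → suc j ℕ.< p → c * x ≡ + suc j [p^ 1 ] → U x
  U-near c x j j<p e = U-*⁻ʳ c (U-resp 0 (mod-sym e) (U-small j j<p))

  n<p : n ℕ.< p
  n<p = ℕP.≤-trans (s≤s (ℕP.m≤m+n n (n ℕ.+ (n ℕ.+ 0)))) small

  2n<p : n ℕ.+ n ℕ.< p
  2n<p = ℕP.≤-trans (s≤s (ℕP.+-monoʳ-≤ n (ℕP.m≤m+n n (n ℕ.+ 0)))) small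

  U-[y-n] : ∀ {y} → y ≡ 0ℤ [p^ 1 ] → ∀ i → i ℕ.< n → U (y - + n + + i)
  U-[y-n] {y} hy i i<n with below i<n
  ... | j , n≡ = U-near -1ℤ (y - + n + + i) j (ℕP.≤-<-trans (subst (suc j ℕ.≤_) (sym n≡) (ℕP.m≤n+m (suc j) i)) n<p)
    (combine -1ℤ hy (trans (cong (λ t → -1ℤ * (y - t + + i) - + suc j) (cong +_ n≡)) (e y (+ i) (+ suc j))))
    where e : ∀ y i j → -1ℤ * (y - (i + j) + i) - j ≡ -1ℤ * (y - 0ℤ)
          e = solve-∀

  U-[A] : ∀ i → i ℕ.< n → U (A + + i)
  U-[A] i i<n = subst U (e A (+ n) (+ i)) (U-[y-n] π≡0 i i<n)
    where e : ∀ A n i → A + n - n + i ≡ A + i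
          e = solve-∀

  U-[1+y] : ∀ {y} → y ≡ 0ℤ [p^ 1 ] → ∀ i → i ℕ.< n → U (1ℤ + y + + i)
  U-[1+y] {y} hy i i<n = U-near 1ℤ (1ℤ + y + + i) i (ℕP.≤-<-trans i<n n<p) (combine 1ℤ hy (e y (+ i)))
    where e : ∀ y i → 1ℤ * (1ℤ + y + i) - (1ℤ + i) ≡ 1ℤ * (y - 0ℤ)
          e = solve-∀

  -- As A ≡ -n modulo p, the negative is congruent to 2n - i, which lies between n + 1 and 2n.
  U-[2A+y] : ∀ {y} → y ≡ 0ℤ [p^ 1 ] → ∀ i → i ℕ.< n → U (A + A + y + + i)
  U-[2A+y] {y} hy i i<n with below i<n
  ... | j , n≡ = U-near -1ℤ (A + A + y + + i) (n ℕ.+ j) bound (combine₂ (- + 2) -1ℤ π≡0 hy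
      (trans (cong (λ t → -1ℤ * (A + A + y + + i) - t) (cong +_ (sym (ℕP.+-suc n j))))
        (trans (cong (λ t → -1ℤ * (A + A + y + + i) - (t + + suc j)) (cong +_ n≡))
          (trans (e A y (+ i) (+ suc j)) (cong (λ t → - + 2 * (A + t - 0ℤ) + -1ℤ * (y - 0ℤ)) (cong +_ (sym n≡)))))))
    where
    bound : suc (n ℕ.+ j) ℕ.< p
    bound = ℕP.≤-<-trans (subst (ℕ._≤ n ℕ.+ n) (ℕP.+-suc n j) (ℕP.+-monoʳ-≤ n (subst (suc j ℕ.≤_) (sym n≡) (ℕP.m≤n+m (suc j) i)))) 2n<p
    e : ∀ A y i j → -1ℤ * (A + A + y + i) - (i + j + j) ≡ - + 2 * (A + (i + j) - 0ℤ) + -1ℤ * (y - 0ℤ)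
    e = solve-∀

  -- 2 (k + i) ≡ 1 - n + 2 i is odd and smaller than p in absolute value.
  U-[k] : ∀ i → i ℕ.< n → U (k + + i)
  U-[k] i i<n with i ℕP.<? m
  ... | yes i<m with below i<m
  ...   | j , m≡ = U-near (- + 2) (k + + i) (j ℕ.+ j) bound (combine₂ 1ℤ -1ℤ (lower 1 4 2H) π≡0
          (trans (e A H (+ i) (+ j)) (cong (λ t → 1ℤ * (+ 2 * H - (1ℤ - A)) + -1ℤ * (A + t - 0ℤ)) (cong +_ (sym (trans n≡2m (cong₂ ℕ._+_ m≡ m≡)))))))
    where
    bound : suc (j ℕ.+ j) ℕ.< p
    bound = ℕP.≤-<-trans (subst (suc (j ℕ.+ j) ℕ.≤_) (sym n≡2m) (ℕP.+-mono-≤ (subst (suc j ℕ.≤_) (sym m≡) (ℕP.m≤n+m (suc j) i))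
              (ℕP.≤-trans (ℕP.n≤1+n j) (subst (suc j ℕ.≤_) (sym m≡) (ℕP.m≤n+m (suc j) i))))) n<p
    e : ∀ A H i j → - + 2 * (1ℤ - H + i) - (1ℤ + (j + j)) ≡ 1ℤ * (+ 2 * H - (1ℤ - A)) + -1ℤ * (A + (i + (1ℤ + j) + (i + (1ℤ + j))) - 0ℤ)
    e = solve-∀
  U-[k] i i<n | no i≮m = U-near (+ 2) (k + + i) (j ℕ.+ j) bound (combine₂ -1ℤ 1ℤ (lower 1 4 2H) π≡0
      (trans (cong (λ t → + 2 * (k + t) - + suc (j ℕ.+ j)) (cong +_ i≡)) (trans (e A H (+ m) (+ j)) (cong (λ t → -1ℤ * (+ 2 * H - (1ℤ - A)) + 1ℤ * (A + t - 0ℤ)) (cong +_ (sym n≡2m))))))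
    where
    j = i ℕ.∸ m
    i≡ : i ≡ m ℕ.+ j
    i≡ = sym (ℕP.m+[n∸m]≡n (ℕP.≮⇒≥ i≮m))
    j<m : j ℕ.< m
    j<m = ℕP.+-cancelˡ-< m j m (subst₂ ℕ._<_ i≡ n≡2m i<n)
    bound : suc (j ℕ.+ j) ℕ.< p
    bound = ℕP.≤-<-trans (subst (suc (j ℕ.+ j) ℕ.≤_) (sym n≡2m) (ℕP.+-mono-≤ j<m (ℕP.<⇒≤ j<m))) n<p
    e : ∀ A H m j → + 2 * (1ℤ - H + (m + j)) - (1ℤ + (j + j)) ≡ -1ℤ * (+ 2 * H - (1ℤ - A)) + 1ℤ * (A + (m + m) - 0ℤ)
    e = solve-∀

  -- Twice the argument is 1 + n + 2i modulo p, which grows up to 3n - 1. Here the bound 3n < p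
  -- enters; the other unit conditions rest on n < p or 2n < p.
  U-[H-π] : ∀ i → i ℕ.< n → U (H - π + + i)
  U-[H-π] i i<n = U-near (+ 2) (H - π + + i) (n ℕ.+ (i ℕ.+ i)) bound (combine₂ 1ℤ (- + 3) (lower 1 4 2H) π≡0 (e A H (+ n) (+ i)))
    where
    bound : suc (n ℕ.+ (i ℕ.+ i)) ℕ.< p
    bound = ℕP.≤-trans (s≤s (subst (ℕ._≤ 3 ℕ.* n) (ℕP.+-suc n (i ℕ.+ i))
      (ℕP.+-monoʳ-≤ n (ℕP.+-mono-≤ i<n (ℕP.≤-trans (ℕP.<⇒≤ i<n) (ℕP.m≤m+n n 0)))))) small
    e : ∀ A H n i → + 2 * (H - (A + n) + i) - (1ℤ + (n + (i + i))) ≡ 1ℤ * (+ 2 * H - (1ℤ - A)) + - + 3 * (A + n - 0ℤ)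
    e = solve-∀

  -- The terminating series and its ₄F₃

  ratio : ℕ → ℤ
  ratio i = poch A i * inv (poch 1ℤ i)

  pairRatio : ℤ → ℕ → ℤ
  pairRatio y i = poch (A + y) i * poch (A - y) i * inv (poch (1ℤ + y) i * poch (1ℤ - y) i)

  -- F y is the terminating series F(π, y), and J 0 0 the numerator of the ₄F₃ in the theorem.
  F : ℤ → ℤ
  F y = diagSum n (λ i _ → (A + + 2 * + i) * ratio i * pairRatio π i * pairRatio y i)

  J : ℤ → ℤ → ℤ
  J x y = M N A (A + y) (A - y) A (k + x) (k - x)

  -- The choice k = 1 - 2A - N makes J balanced. Sears with A fixed sends A ± y to k ∓ y and k ± x
  -- to A ∓ x; reversing the sum then restores the shape of J with x and y exchanged.
  J-sym : ∀ x y → J x y ≡ J y x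
  J-sym x y = begin
    M N A (A + y) (A - y) A (k + x) (k - x)
      ≡⟨ sears N A (A + y) (A - y) A (k + x) (k - x) (e₀ A x y (+ N)) ⟩
    M N A (1ℤ - + N - A - (A + y)) (1ℤ - + N - A - (A - y)) A (1ℤ - + N - A - (k + x)) (1ℤ - + N - A - (k - x))
      ≡⟨ M-cong N refl (e₁ A y (+ N)) (e₂ A y (+ N)) refl (e₃ A x (+ N)) (e₄ A x (+ N)) ⟩
    M N A (k - y) (k + y) A (A - x) (A + x)
      ≡⟨ binSum-flip N _ ⟩
    binSum N (λ i l → poch A l * poch (k - y) l * poch (k + y) l * (poch A i * poch (A - x) i * poch (A + x) i))
      ≡⟨ binSum-cong N (λ i l _ → e₅ (poch A l) (poch (k - y) l) (poch (k + y) l) (poch A i) (poch (A - x) i) (poch (A + x) i)) ⟩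
    M N A (A + x) (A - x) A (k + y) (k - y) ∎
    where
    open ≡-Reasoning
    e₀ : ∀ A x y N → A + (A + y) + (A - y) + A + (1ℤ - (A + A + N) + x) + (1ℤ - (A + A + N) - x) ≡ + 2 - + 2 * N
    e₀ = solve-∀
    e₁ : ∀ A y N → 1ℤ - N - A - (A + y) ≡ 1ℤ - (A + A + N) - y
    e₁ = solve-∀
    e₂ : ∀ A y N → 1ℤ - N - A - (A - y) ≡ 1ℤ - (A + A + N) + y
    e₂ = solve-∀
    e₃ : ∀ A x N → 1ℤ - N - A - (1ℤ - (A + A + N) + x) ≡ A - x
    e₃ = solve-∀
    e₄ : ∀ A x N → 1ℤ - N - A - (1ℤ - (A + A + N) - x) ≡ A + x
    e₄ = solve-∀
    e₅ : ∀ a u v b w z → a * u * v * (b * w * z) ≡ b * z * w * (a * v * u)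
    e₅ = solve-∀

  J-even : Even J
  J-even = Even-binSum N λ i l → Even-≗ (λ x y → e (poch A i) (poch (A + y) i) (poch (A - y) i) (poch A l) (poch (k + x) l) (poch (k - x) l))
    (Even-* (Even-const (poch A i * poch A l)) (Even-* (Even-swap (Even-poch A i)) (Even-poch k l)))
    where e : ∀ a u v b w z → a * b * (u * v * (w * z)) ≡ a * u * v * (b * w * z)
          e = solve-∀

  U-1i : ∀ i → i ℕ.≤ n → U (poch 1ℤ i)
  U-1i i i≤n = U-poch 1ℤ i λ j j<i → subst U (cong (_+ + j) (ℤP.+-identityʳ 1ℤ)) (U-[1+y] {0ℤ} mod-refl j (ℕP.<-≤-trans j<i i≤n))

  U-1yi : ∀ y → y ≡ 0ℤ [p^ 1 ] → ∀ i → i ℕ.≤ n → U (poch (1ℤ + y) i)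
  U-1yi y hy i i≤n = U-poch (1ℤ + y) i λ j j<i → U-[1+y] hy j (ℕP.<-≤-trans j<i i≤n)

  pairDen-inv : ∀ y → y ≡ 0ℤ [p^ 1 ] → ∀ i → i ℕ.≤ n → poch (1ℤ + y) i * poch (1ℤ - y) i * inv (poch (1ℤ + y) i * poch (1ℤ - y) i) ≡ 1ℤ [p^ 5 ]
  pairDen-inv y hy i i≤n = inv-inverse (poch (1ℤ + y) i * poch (1ℤ - y) i) (U-* (poch (1ℤ + y) i) (poch (1ℤ - y) i) (U-1yi y hy i i≤n) (U-1yi (- y) (neg-≡0 1 hy) i i≤n))

  opaque
    -- The additional parameter k of W satisfies 1 + A - k ≡ k modulo p⁵, so its factors amount to
    -- the constant (k)_n. As A - π = -n, the factor (A - π)_i / i! of F supplies the signed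
    -- binomial coefficient.
    F-W : ∀ y → y ≡ 0ℤ [p^ 1 ] →
      poch k n * (poch (1ℤ + π) n * poch (1ℤ - π) n) * (poch (1ℤ + y) n * poch (1ℤ - y) n) * F y ≡ W n A (A + y) (A - y) (A + π) k [p^ 5 ]
    F-W y hy = mod-trans (≡-to-mod (sym (diagSum-* n C (λ i _ → (A + + 2 * + i) * ratio i * pairRatio π i * pairRatio y i))))
      (mod-trans (diagSum-mod n term) (≡-to-mod (sym (binSum-diagSum n w))))
      where
      C : ℤ
      C = poch k n * (poch (1ℤ + π) n * poch (1ℤ - π) n) * (poch (1ℤ + y) n * poch (1ℤ - y) n)
      w : ℕ → ℕ → ℤ
      w i l = wp A i l * (wpPair A (A + π) i l * wpPair A k i l) * (wpPair A (A + y) i l * wpPair A (A - y) i l)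
      term : ∀ i l → i ℕ.+ l ≡ n → C * ((A + + 2 * + i) * ratio i * pairRatio π i * pairRatio y i) ≡ binom i l * w i l [p^ 5 ]
      term i l il≡n = begin
        C * ((A + + 2 * + i) * ratio i * pairRatio π i * pairRatio y i)
          ≡⟨ cong₂ (λ s t → poch k n * s * t * ((A + + 2 * + i) * ratio i * pairRatio π i * pairRatio y i))
               (cong₂ _*_ (split (1ℤ + π)) (split (1ℤ - π))) (cong₂ _*_ (split (1ℤ + y)) (split (1ℤ - y))) ⟩
        poch k n * (pi * pl * (mi * ml)) * (ui * ul * (vi * vl)) * (z * (q * w₁) * (b * c * w₂) * (s * t * w₃))
          ≡⟨ gather-inverses (poch k n) pi pl mi ml ui ul vi vl z q w₁ b c w₂ s t w₃ ⟩
        poch k n * rest * (c * w₁) * ((pi * mi * w₂) * (ui * vi * w₃))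
          ≈⟨ mod-*ˡ (poch k n * rest * (c * w₁)) (mod-* (pairDen-inv π π≡0 i i≤n) (pairDen-inv y hy i i≤n)) ⟩
        poch k n * rest * (c * w₁) * 1ℤ
          ≡⟨ ℤP.*-identityʳ (poch k n * rest * (c * w₁)) ⟩
        poch k n * rest * (c * w₁)
          ≈⟨ mod-* (mod-*ʳ rest (mod-sym k-pair)) (mod-sym binom-c) ⟩
        poch k i * poch (1ℤ + A - k + + i) l * rest * (binom i l * sgn i)
          ≡⟨ well-poised-order (poch k i) (poch (1ℤ + A - k + + i) l) pl ml ul vl z q b s t (binom i l) (sgn i) ⟩
        binom i l * (sgn i * z * q * pl * (b * ml * (poch k i * poch (1ℤ + A - k + + i) l)) * (s * vl * (t * ul)))
          ≡⟨ cong₂ (λ x y → binom i l * (sgn i * z * q * x * (b * y * wpPair A k i l) * (s * vl * (t * ul))))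
               (poch-cong l pl≡) (poch-cong l (e₃ A π (+ i))) ⟩
        binom i l * (wp A i l * (wpPair A (A + π) i l * wpPair A k i l) * (s * vl * (t * ul)))
          ≡⟨ cong₂ (λ x y → binom i l * (wp A i l * (wpPair A (A + π) i l * wpPair A k i l) * (s * x * (t * y))))
               (poch-cong l (e₃ A y (+ i))) (poch-cong l (e₄ A y (+ i))) ⟩
        binom i l * w i l ∎
        where
        open R
        i≤n : i ℕ.≤ n
        i≤n = subst (i ℕ.≤_) il≡n (ℕP.m≤m+n i l)
        z q b c s t pi mi ui vi pl ml ul vl w₁ w₂ w₃ rest : ℤ
        z = A + + 2 * + i
        q = poch A i
        b = poch (A + π) i
        c = poch (A - π) i
        s = poch (A + y) i
        t = poch (A - y) i
        pi = poch (1ℤ + π) i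
        mi = poch (1ℤ - π) i
        ui = poch (1ℤ + y) i
        vi = poch (1ℤ - y) i
        pl = poch (1ℤ + π + + i) l
        ml = poch (1ℤ - π + + i) l
        ul = poch (1ℤ + y + + i) l
        vl = poch (1ℤ - y + + i) l
        rest = pl * ml * ul * vl * z * q * b * s * t
        w₁ = inv (poch 1ℤ i)
        w₂ = inv (pi * mi)
        w₃ = inv (ui * vi)
        split : ∀ x → poch x n ≡ poch x i * poch (x + + i) l
        split x = poch-shift x i n l (sym il≡n)
        k-pair : poch k i * poch (1ℤ + A - k + + i) l ≡ poch k n [p^ 5 ]
        k-pair = mod-trans (mod-*ˡ (poch k i) (poch-mod l (mod-+ʳ (+ i) 1+A-k≡k))) (≡-to-mod (sym (split k)))
          where
          1+A-k≡k : 1ℤ + A - k ≡ k [p^ 5 ]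
          1+A-k≡k = combine 1ℤ 2H (e A H)
            where e : ∀ A H → 1ℤ + A - (1ℤ - H) - (1ℤ - H) ≡ 1ℤ * (+ 2 * H - (1ℤ - A))
                  e = solve-∀
        binom-c : binom i l * sgn i ≡ c * w₁ [p^ 5 ]
        binom-c = mod-trans (≡-to-mod (e (binom i l) (sgn i))) (mod-trans (mod-*ˡ (binom i l * sgn i) (mod-sym (inv-inverse (poch 1ℤ i) (U-1i i i≤n))))
          (≡-to-mod (trans (e′ (binom i l) (sgn i) (poch 1ℤ i) w₁) (trans (cong (λ t → sgn i * t * w₁) (binom-poch i l n il≡n))
            (trans (e″ (sgn i) (poch (- + n) i) w₁) (trans (cong₂ (λ r t → r * (t * w₁)) (sgn² i) (poch-cong i (e‴ A (+ n)))) (ℤP.*-identityˡ (c * w₁))))))))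
          where
          e : ∀ x y → x * y ≡ x * y * 1ℤ
          e = solve-∀
          e′ : ∀ b s q w → b * s * (q * w) ≡ s * (b * q) * w
          e′ = solve-∀
          e″ : ∀ s q w → s * (s * q) * w ≡ s * s * (q * w)
          e″ = solve-∀
          e‴ : ∀ A n → - n ≡ A - (A + n)
          e‴ = solve-∀
        pl≡ : 1ℤ + π + + i ≡ A + + 2 * + i + + l + 1ℤ
        pl≡ = trans (cong (λ t → 1ℤ + (A + + t) + + i) (sym il≡n)) (e A (+ i) (+ l))
          where e : ∀ A i l → 1ℤ + (A + (i + l)) + i ≡ A + + 2 * i + l + 1ℤ
                e = solve-∀
        e₃ : ∀ A y i → 1ℤ - y + i ≡ 1ℤ + A - (A + y) + i
        e₃ = solve-∀
        e₄ : ∀ A y i → 1ℤ + y + i ≡ 1ℤ + A - (A - y) + i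
        e₄ = solve-∀

  M-reverse : ∀ n a b c x y z → M n a b c x y z ≡ M n c b a x y z
  M-reverse n a b c x y z = binSum-cong n λ i l _ → cong (_* (poch x l * poch y l * poch z l)) (e (poch a i) (poch b i) (poch c i))
    where e : ∀ a b c → a * b * c ≡ c * b * a
          e = solve-∀

  -- The ₄F₃ delivered by `whipple-sears`, with -N moved to the front as `M-exchange` requires.
  series : ℤ → ℤ
  series y = M n (- + N) A (A + π) (A - + d) (k - y - + d) (k + y - + d)

  W-series : ∀ y → W n A (A + y) (A - y) (A + π) k ≡ poch A n * (π * poch (1ℤ + π) n) * series y
  W-series y = trans (whipple-sears n A (A + y) (A - y) (A + π) k) (cong₂ _*_ factor
    (trans (M-cong n refl (e₁ A (+ n)) (e₂ A y (+ n) (+ N)) (e₃ A (+ N) (+ d)) (e₄ A y (+ N) (+ d)) (e₅ A y (+ N) (+ d)))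
      (M-reverse n (A + π) A (- + N) (A - + d) (k - y - + d) (k + y - + d))))
    where
    factor : poch A (suc (n ℕ.+ n)) ≡ poch A n * (π * poch (1ℤ + π) n)
    factor = trans (poch-shift A n (suc (n ℕ.+ n)) (suc n) (sym (ℕP.+-suc n n))) (cong (poch A n *_) (poch-suc π n))
    e₁ : ∀ A n → A + (A + n) - A - n ≡ A
    e₁ = solve-∀
    e₂ : ∀ A y n N → A + y + (A - y) + (A + (A + n)) + (1ℤ - (A + A + N)) - 1ℤ - + 2 * A - n ≡ - N
    e₂ = solve-∀
    e₃ : ∀ A N d → 1ℤ + A - (A + (A + (N + d))) - (1ℤ - (A + A + N)) ≡ A - d
    e₃ = solve-∀
    e₄ : ∀ A y N d → 1ℤ + A - (A + y) - (A + (A + (N + d))) ≡ 1ℤ - (A + A + N) - y - d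
    e₄ = solve-∀
    e₅ : ∀ A y N d → 1ℤ + A - (A - y) - (A + (A + (N + d))) ≡ 1ℤ - (A + A + N) + y - d
    e₅ = solve-∀

  -- After the exchange -n = A - π is a numerator parameter, and A, A + π, A - π are those of J with
  -- second argument π.
  J-M : ∀ y → M N (- + n) A (A + π) A (k - y) (k + y) ≡ J y π
  J-M y = binSum-cong N λ i l _ → trans (cong (λ t → poch t i * poch A i * poch (A + π) i * (poch A l * poch (k - y) l * poch (k + y) l)) (e₁ A (+ n)))
      (e₂ (poch (A - π) i) (poch A i) (poch (A + π) i) (poch A l) (poch (k - y) l) (poch (k + y) l))
    where
    e₁ : ∀ A n → - n ≡ A - (A + n)
    e₁ = solve-∀
    e₂ : ∀ x a y b u v → x * a * y * (b * u * v) ≡ a * y * x * (b * v * u)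
    e₂ = solve-∀

  poch-k-N : ∀ y → poch (k - y) N ≡ sgn N * poch (A + A + y) N
  poch-k-N y = poch-reflect′ (k - y) (A + A + y) N (e A y (+ N))
    where e : ∀ A y N → 1ℤ - (A + A + N) - y + (A + A + y) ≡ 1ℤ - N
          e = solve-∀

  poch-k-n : ∀ y → poch (k - y - + d) n ≡ poch (A + A + y) n
  poch-k-n y = trans (poch-reflect′ (k - y - + d) (A + A + y) n (e A y (+ N) (+ d)))
    (trans (cong (_* poch (A + A + y) n) sgn-n) (ℤP.*-identityˡ (poch (A + A + y) n)))
    where e : ∀ A y N d → 1ℤ - (A + A + N) - y - d + (A + A + y) ≡ 1ℤ - (N + d)
          e = solve-∀

  flip-sign : ∀ k y → k + y ≡ k - - y
  flip-sign = solve-∀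

  poch-k+N : ∀ y → poch (k + y) N ≡ sgn N * poch (A + A - y) N
  poch-k+N y = trans (poch-cong N (flip-sign k y)) (poch-k-N (- y))

  poch-k+n : ∀ y → poch (k + y - + d) n ≡ poch (A + A - y) n
  poch-k+n y = trans (poch-cong n (cong (_- + d) (flip-sign k y))) (poch-k-n (- y))

  -- The sum of length n becomes J, of length N. The Pochhammer symbols are rewritten with arguments
  -- A, H - π and 2A ± y, where their factors are known to be units.
  series-J : ∀ y → series y * (poch A N * (poch (A + A + y) N * poch (A + A - y) N))
    ≡ J y π * (poch (H - π) n * (poch (A + A + y) n * poch (A + A - y) n))
  series-J y = begin
    series y * (poch A N * (Bp * Bm))
      ≡⟨ e₁ (series y) (poch A N) Bp Bm ⟩
    1ℤ * (series y * (poch A N * Bp * Bm))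
      ≡⟨ cong (_* (series y * (poch A N * Bp * Bm))) (sgn² N) ⟨
    sgn N * sgn N * (series y * (poch A N * Bp * Bm))
      ≡⟨ e₂ (sgn N) (series y) (poch A N) Bp Bm ⟩
    series y * (poch A N * (sgn N * Bp) * (sgn N * Bm))
      ≡⟨ cong₂ (λ s t → series y * (poch A N * s * t)) (poch-k-N y) (poch-k+N y) ⟨
    series y * (poch A N * poch (k - y) N * poch (k + y) N)
      ≡⟨ M-exchange N d A (A + π) A (k - y) (k + y) ⟩
    M N (- + n) A (A + π) A (k - y) (k + y) * (poch (A - + d) n * poch (k - y - + d) n * poch (k + y - + d) n)
      ≡⟨ cong₂ _*_ (J-M y) (cong₂ _*_ (cong₂ _*_ (poch-cong n (e₃ A (+ N) (+ d))) (poch-k-n y)) (poch-k+n y)) ⟩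
    J y π * (poch (H - π) n * poch (A + A + y) n * poch (A + A - y) n)
      ≡⟨ cong (J y π *_) (ℤP.*-assoc (poch (H - π) n) (poch (A + A + y) n) (poch (A + A - y) n)) ⟩
    J y π * (poch (H - π) n * (poch (A + A + y) n * poch (A + A - y) n)) ∎
    where
    open ≡-Reasoning
    Bp Bm : ℤ
    Bp = poch (A + A + y) N
    Bm = poch (A + A - y) N
    e₁ : ∀ s a b c → s * (a * (b * c)) ≡ 1ℤ * (s * (a * b * c))
    e₁ = solve-∀
    e₂ : ∀ g s a b c → g * g * (s * (a * b * c)) ≡ s * (a * (g * b) * (g * c))
    e₂ = solve-∀
    e₃ : ∀ A N d → A - d ≡ A + A + N - (A + (N + d))
    e₃ = solve-∀

  U-pochA : ∀ j → j ℕ.≤ n → U (poch A j)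
  U-pochA j j≤n = U-poch A j λ i i<j → U-[A] i (ℕP.<-≤-trans i<j j≤n)

  1-π : poch (1ℤ - π) n ≡ poch A n
  1-π = trans (poch-reflect′ (1ℤ - π) A n (e A (+ n))) (trans (cong (_* poch A n) sgn-n) (ℤP.*-identityˡ (poch A n)))
    where e : ∀ A n → 1ℤ - (A + n) + A ≡ 1ℤ - n
          e = solve-∀

  -- This is where the factor p of the theorem appears: (A)_{2n+1} = (A)_n π (1 + π)_n, and its unit
  -- part (A)_n (1 + π)_n cancels against the left side because (1 - π)_n = (A)_n.
  F-series : ∀ y → y ≡ 0ℤ [p^ 1 ] → poch k n * (poch (1ℤ + y) n * poch (1ℤ - y) n) * F y ≡ π * series y [p^ 5 ]
  F-series y hy = cancel 5 (P₁ * PA) (U-* P₁ PA (U-1yi π π≡0 n ℕP.≤-refl) (U-pochA n ℕP.≤-refl)) (mod-trans (≡-to-mod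
      (trans (e₁ P₁ PA (poch k n) (poch (1ℤ + y) n * poch (1ℤ - y) n) (F y)) (cong (λ t → poch k n * (P₁ * t) * (poch (1ℤ + y) n * poch (1ℤ - y) n) * F y) (sym 1-π))))
    (mod-trans (F-W y hy) (≡-to-mod (trans (W-series y) (e₂ PA P₁ π (series y))))))
    where
    P₁ PA : ℤ
    P₁ = poch (1ℤ + π) n
    PA = poch A n
    e₁ : ∀ P Q k Y F → P * Q * (k * Y * F) ≡ k * (P * Q) * Y * F
    e₁ = solve-∀
    e₂ : ∀ Q P π S → Q * (π * P) * S ≡ P * Q * (π * S)
    e₂ = solve-∀

  F-J : ∀ y → y ≡ 0ℤ [p^ 1 ] →
    poch k n * (poch (1ℤ + y) n * poch (1ℤ - y) n) * F y * (poch A N * (poch (A + A + y) N * poch (A + A - y) N))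
    ≡ π * J y π * (poch (H - π) n * (poch (A + A + y) n * poch (A + A - y) n)) [p^ 5 ]
  F-J y hy = mod-trans (mod-*ʳ B (F-series y hy)) (≡-to-mod (trans (ℤP.*-assoc π (series y) B) (trans (cong (π *_) (series-J y)) (sym (ℤP.*-assoc π (J y π) C)))))
    where
    B C : ℤ
    B = poch A N * (poch (A + A + y) N * poch (A + A - y) N)
    C = poch (H - π) n * (poch (A + A + y) n * poch (A + A - y) n)

  -- From 2H ≡ 1 - A ≡ 1 + 2m it follows that H ≡ j + 1 modulo p with j = m + (p - 1)/2. Since j + N
  -- = 6m, the sign (-1)^j is (-1)^N.
  refl-H : refl-product H ≡ - sgn N [p^ 5 ]
  refl-H with odd-half p p-odd
  ... | r , p≡ = mod-trans (≡-to-mod (cong refl-product (e₀ H (+ suc j)))) (mod-trans (refl-steps z≡0 j j<p)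
      (mod-trans (mod-*ˡ (sgn j) (refl-nonunit z≡0)) (≡-to-mod (trans (e₁ (sgn j)) (cong -_ sgn-j)))))
    where
    j : ℕ
    j = m ℕ.+ r
    e₀ : ∀ H s → H ≡ H - s + s
    e₀ = solve-∀
    e₁ : ∀ s → s * -1ℤ ≡ - s
    e₁ = solve-∀
    m≤r : m ℕ.≤ r
    m≤r with m ℕP.≤? r
    ... | yes q = q
    ... | no  q = contradiction n<p (ℕP.≤⇒≯ (subst₂ ℕ._≤_ (sym p≡) (sym n≡2m) (ℕP.≤-trans (ℕP.n≤1+n (suc (r ℕ.+ r))) (subst (ℕ._≤ m ℕ.+ m) (cong suc (ℕP.+-suc r r)) (ℕP.+-mono-≤ (ℕP.≰⇒> q) (ℕP.≰⇒> q))))))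
    j<p : j ℕ.< p
    j<p = subst (j ℕ.<_) (sym p≡) (s≤s (ℕP.+-monoˡ-≤ r m≤r))
    z≡0 : H - + suc j ≡ 0ℤ [p^ 1 ]
    z≡0 = cancel 1 (+ 2) U-2 (combine₂ 1ℤ -1ℤ (lower 1 4 2H) (mod-+ π≡0 (≡0-p {+ p} ℕD.∣-refl))
      (trans (e A H (+ m) (+ r)) (cong₂ (λ s t → 1ℤ * (+ 2 * H - (1ℤ - A)) + -1ℤ * (A + s + t - (0ℤ + 0ℤ))) (cong +_ (sym n≡2m)) (cong +_ (sym p≡)))))
      where
      e : ∀ A H m r → + 2 * (H - (1ℤ + (m + r))) - + 2 * 0ℤ ≡ 1ℤ * (+ 2 * H - (1ℤ - A)) + -1ℤ * (A + (m + m) + (1ℤ + (r + r)) - (0ℤ + 0ℤ))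
      e = solve-∀
    r+N : r ℕ.+ N ≡ 5 ℕ.* m
    r+N = ℕP.*-cancelˡ-≡ (r ℕ.+ N) (5 ℕ.* m) 2 (ℕP.suc-injective (trans (cong suc (trans (ℕP.*-distribˡ-+ 2 r N) (cong (λ t → r ℕ.+ t ℕ.+ 2 ℕ.* N) (ℕP.+-identityʳ r))))
      (trans (cong (ℕ._+ 2 ℕ.* N) (sym p≡)) (trans (sym size) (cong suc (trans (cong (5 ℕ.*_) n≡2m) (trans (ℕP.*-distribˡ-+ 5 m m) (cong (5 ℕ.* m ℕ.+_) (sym (ℕP.+-identityʳ (5 ℕ.* m)))))))))))
    sgn-double : ∀ i → sgn (i ℕ.+ i) ≡ 1ℤ
    sgn-double i = trans (sgn-+ i i) (sgn² i)
    sgn-j : sgn j ≡ sgn N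
    sgn-j = begin
      sgn j                   ≡⟨ ℤP.*-identityʳ (sgn j) ⟨
      sgn j * 1ℤ              ≡⟨ cong (sgn j *_) (sgn² N) ⟨
      sgn j * (sgn N * sgn N) ≡⟨ ℤP.*-assoc (sgn j) (sgn N) (sgn N) ⟨
      sgn j * sgn N * sgn N   ≡⟨ cong (_* sgn N) (trans (sym (sgn-+ j N)) (trans (cong sgn (trans (ℕP.+-assoc m r N) (trans (cong (m ℕ.+_) r+N) six))) (sgn-double (3 ℕ.* m)))) ⟩
      1ℤ * sgn N              ≡⟨ ℤP.*-identityˡ (sgn N) ⟩
      sgn N                   ∎
      where
      open ≡-Reasoning
      six : m ℕ.+ 5 ℕ.* m ≡ 3 ℕ.* m ℕ.+ 3 ℕ.* m
      six = ℕP.*-distribʳ-+ m 3 3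

  -- Pochhammer symbols as quotients of Gamma values

  q : ℤ → ℤ
  q z = G (A + z) * G (A - z)

  θ : ℤ → ℤ
  θ z = G (H + z) * G (H - z)

  -- From y - n = A - (π - y), n steps lead to y; their factors y - n, ..., y - 1 are those of (1 -
  -- y)_n up to the sign (-1)^n = 1.
  G-base : ∀ y → y ≡ 0ℤ [p^ 1 ] → G y ≡ poch (1ℤ - y) n * G (A - (π - y)) [p^ 5 ]
  G-base y hy = mod-trans (≡-to-mod (cong G (e₁ y (+ n)))) (mod-trans (G-poch (y - + n) n (U-[y-n] hy))
    (≡-to-mod (cong₂ _*_ (sym (poch-reflect′ (1ℤ - y) (y - + n) n (e₂ y (+ n)))) (cong G (e₃ A y (+ n))))))
    where
    e₁ : ∀ y n → y ≡ y - n + n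
    e₁ = solve-∀
    e₂ : ∀ y n → 1ℤ - y + (y - n) ≡ 1ℤ - n
    e₂ = solve-∀
    e₃ : ∀ A y n → y - n ≡ A - (A + n - y)
    e₃ = solve-∀

  -- By `G-base` this is Γ(y) Γ(-y) ≡ 1. It trades the symbols (1 ± y)_n for the halves Γ(A - (π ±
  -- y)) of q(π ± y).
  G-opposite-pair : ∀ y → y ≡ 0ℤ [p^ 1 ] → poch (1ℤ - y) n * G (A - (π - y)) * (poch (1ℤ + y) n * G (A - (π + y))) ≡ 1ℤ [p^ 5 ]
  G-opposite-pair y hy = mod-trans (mod-* (mod-sym (G-base y hy)) (mod-trans (≡-to-mod (cong₂ (λ s t → poch (1ℤ + s) n * G (A - (π + t))) (e y) (e y))) (mod-sym (G-base (- y) (neg-≡0 1 hy))))) (G-opposite hy)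
    where
    e : ∀ y → y ≡ - - y
    e = solve-∀

  G-2A : ∀ y → y ≡ 0ℤ [p^ 1 ] → G (A + (π + y)) ≡ poch (A + A + y) n * G (A + A + y) [p^ 5 ]
  G-2A y hy = mod-trans (≡-to-mod (cong G (e A y (+ n)))) (mod-trans (G-poch (A + A + y) n (U-[2A+y] hy))
    (≡-to-mod (trans (cong (λ s → s * poch (A + A + y) n * G (A + A + y)) sgn-n) (cong (_* G (A + A + y)) (ℤP.*-identityˡ (poch (A + A + y) n))))))
    where
    e : ∀ A y n → A + (A + n + y) ≡ A + A + y + n
    e = solve-∀

  G-H : ∀ y → y ≡ 0ℤ [p^ 1 ] → G (H + y) ≡ sgn N * poch (A + A + y) N * G (A + A + y) [p^ 5 ]
  G-H y hy = mod-trans (≡-to-mod (cong G (e A y (+ N)))) (G-poch (A + A + y) N λ i i<N → U-[2A+y] hy i (ℕP.<-≤-trans i<N (ℕP.m≤m+n N d)))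
    where
    e : ∀ A y N → A + A + N + y ≡ A + A + y + N
    e = solve-∀

  -- H - A is both (H - π) + n and A + N. Comparing this route with `G-H-A′` trades (H - π)_n Γ(H -
  -- π) for a signed (A)_N Γ(A).
  G-H-A : G (H - A) ≡ poch (H - π) n * G (H - π) [p^ 5 ]
  G-H-A = mod-trans (≡-to-mod (cong G (e A H (+ n)))) (mod-trans (G-poch (H - π) n U-[H-π])
    (≡-to-mod (trans (cong (λ s → s * poch (H - π) n * G (H - π)) sgn-n) (cong (_* G (H - π)) (ℤP.*-identityˡ (poch (H - π) n))))))
    where
    e : ∀ A H n → H - A ≡ H - (A + n) + n
    e = solve-∀

  G-H-A′ : G (H - A) ≡ sgn N * poch A N * G A [p^ 5 ]
  G-H-A′ = mod-trans (≡-to-mod (cong G (e A (+ N)))) (G-poch A N λ i i<N → U-[A] i (ℕP.<-≤-trans i<N (ℕP.m≤m+n N d)))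
    where
    e : ∀ A N → A + A + N - A ≡ A + N
    e = solve-∀

  G-H+π : G (H + π) ≡ poch k n * G k [p^ 5 ]
  G-H+π = mod-trans (G-cong {H + π} {k + + n} (combine 1ℤ 2H (e A H (+ n)))) (mod-trans (G-poch k n U-[k])
    (≡-to-mod (trans (cong (λ s → s * poch k n * G k) sgn-n) (cong (_* G k) (ℤP.*-identityˡ (poch k n))))))
    where
    e : ∀ A H n → H + (A + n) - (1ℤ - H + n) ≡ 1ℤ * (+ 2 * H - (1ℤ - A))
    e = solve-∀

  -- After multiplication by the unit (1 + y)_n (1 - y)_n (A)_N, the Pochhammer symbols of `F-J`
  -- combine with Gamma values whose arguments differ by n or N. The minus sign is that of `refl-H`,
  -- because Γ(H) Γ(k) is a reflection product.
  F-Γ : ∀ y → y ≡ 0ℤ [p^ 1 ] → F y * (G H * θ π * θ y) ≡ - (π * J y π * G A * (q (π + y)) * (q (π - y))) [p^ 5 ]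
  F-Γ y hy = cancel 5 (Y * poch A N) (U-* Y (poch A N) (U-* (poch (1ℤ + y) n) (poch (1ℤ - y) n) (U-1yi y hy n ℕP.≤-refl) (U-1yi (- y) (neg-≡0 1 hy) n ℕP.≤-refl)) (U-pochA N (ℕP.m≤m+n N d))) (begin
    Y * aN * (F y * (G H * θ π * θ y))
      ≡⟨ ℤP.*-comm (Y * aN) (F y * (G H * θ π * θ y)) ⟩
    F y * (G H * θ π * θ y) * (Y * aN)
      ≈⟨ mod-*ʳ (Y * aN) (mod-*ˡ (F y) (mod-* (mod-*ˡ (G H) (mod-*ʳ (G (H - π)) G-H+π)) (mod-* (G-H y hy) (G-H (- y) (neg-≡0 1 hy))))) ⟩
    F y * (G H * (poch k n * G k * G (H - π)) * (sgn N * Bp * gp * (sgn N * Bm * gm))) * (Y * aN)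
      ≡⟨ gather-Γ (F y) (G H) (poch k n) (G k) (G (H - π)) (sgn N) Bp gp Bm gm Y aN ⟩
    refl-product H * (sgn N * sgn N) * (poch k n * Y * F y * (aN * (Bp * Bm))) * (G (H - π) * gp * gm)
      ≈⟨ mod-*ʳ (G (H - π) * gp * gm) (mod-* (mod-* refl-H (≡-to-mod (sgn² N))) (F-J y hy)) ⟩
    - sgn N * 1ℤ * (π * J y π * (poch (H - π) n * (Cp * Cm))) * (G (H - π) * gp * gm)
      ≡⟨ pair-Γ (- sgn N * 1ℤ) (π * J y π) (poch (H - π) n) Cp Cm (G (H - π)) gp gm ⟩
    - sgn N * 1ℤ * (π * J y π) * (poch (H - π) n * G (H - π)) * ((Cp * gp) * (Cm * gm))
      ≈⟨ mod-* (mod-*ˡ (- sgn N * 1ℤ * (π * J y π)) (mod-trans (mod-sym G-H-A) G-H-A′)) (mod-* (mod-sym (G-2A y hy)) (mod-sym (G-2A (- y) (neg-≡0 1 hy)))) ⟩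
    - sgn N * 1ℤ * (π * J y π) * (sgn N * aN * G A) * (G (A + (π + y)) * G (A + (π - y)))
      ≡⟨ e₁ (sgn N) (π * J y π) aN (G A) (G (A + (π + y)) * G (A + (π - y))) ⟩
    sgn N * sgn N * - (π * J y π * G A * (G (A + (π + y)) * G (A + (π - y))) * aN)
      ≡⟨ trans (cong (_* X) (sgn² N)) (ℤP.*-identityˡ X) ⟩
    X
      ≡⟨ cong -_ (sym (ℤP.*-identityʳ (π * J y π * G A * (G (A + (π + y)) * G (A + (π - y))) * aN))) ⟩
    - (π * J y π * G A * (G (A + (π + y)) * G (A + (π - y))) * aN * 1ℤ)
      ≈⟨ mod-neg (mod-*ˡ (π * J y π * G A * (G (A + (π + y)) * G (A + (π - y))) * aN) (mod-sym (G-opposite-pair y hy))) ⟩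
    - (π * J y π * G A * (G (A + (π + y)) * G (A + (π - y))) * aN * (poch (1ℤ - y) n * G (A - (π - y)) * (poch (1ℤ + y) n * G (A - (π + y)))))
      ≡⟨ cong -_ (spread-Γ (π * J y π) (G A) (G (A + (π + y))) (G (A - (π + y))) (G (A + (π - y))) (G (A - (π - y))) (poch (1ℤ + y) n) (poch (1ℤ - y) n) aN) ⟨
    - (π * J y π * G A * q (π + y) * q (π - y) * (Y * aN))
      ≡⟨ trans (ℤP.neg-distribˡ-* (π * J y π * G A * q (π + y) * q (π - y)) (Y * aN)) (ℤP.*-comm (- (π * J y π * G A * q (π + y) * q (π - y))) (Y * aN)) ⟩
    Y * aN * - (π * J y π * G A * q (π + y) * q (π - y)) ∎)
    where
    open R
    Y aN Bp Bm gp gm Cp Cm X : ℤ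
    Y = poch (1ℤ + y) n * poch (1ℤ - y) n
    aN = poch A N
    Bp = poch (A + A + y) N
    Bm = poch (A + A - y) N
    gp = G (A + A + y)
    gm = G (A + A - y)
    Cp = poch (A + A + y) n
    Cm = poch (A + A - y) n
    X = - (π * J y π * G A * (G (A + (π + y)) * G (A + (π - y))) * aN)
    e₁ : ∀ s x a g u → - s * 1ℤ * x * (s * a * g) * u ≡ s * s * - (x * g * u * a)
    e₁ = solve-∀

  -- Reduction of F(0, 0) to terminating series

  invSquares : ℤ → ℕ → ℤ
  invSquares x zero    = 0ℤ
  invSquares x (suc i) = invSquares x i + inv (x + + i) * inv (x + + i)

  π²≡0 : π * π ≡ 0ℤ [p^ 2 ]
  π²≡0 = ≡0-* 1 1 {π} {π} π≡0 π≡0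

  -- The left side is the product of the factors (x + j)² - π², expanded to first order in π².
  pair-expansion : ∀ x i → (∀ j → j ℕ.< i → U (x + + j)) →
    poch (x + π) i * poch (x - π) i ≡ poch x i * poch x i * (1ℤ - π * π * invSquares x i) [p^ 3 ]
  pair-expansion x zero    u = ≡-to-mod (e π)
    where e : ∀ z → 1ℤ * 1ℤ ≡ 1ℤ * 1ℤ * (1ℤ - z * z * 0ℤ)
          e = solve-∀
  pair-expansion x (suc i) u = begin
    poch (x + π) i * (x + π + + i) * (poch (x - π) i * (x - π + + i))
      ≡⟨ e₁ (poch (x + π) i) (poch (x - π) i) x π (+ i) ⟩
    poch (x + π) i * poch (x - π) i * (X * X - π * π * (1ℤ * 1ℤ))
      -- Here 1 is replaced by x + i times its inverse, so that (x + i)² can be factored out.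
      ≈⟨ mod-* (pair-expansion x i λ j j<i → u j (ℕP.m<n⇒m<1+n j<i)) (mod-- (mod-refl {a = X * X}) (mod-*ˡ (π * π) (mod-* X-inv X-inv))) ⟩
    Q * Q * (1ℤ - π * π * s) * (X * X - π * π * (X * v * (X * v)))
      ≡⟨ e₂ Q X (π * π) s v ⟩
    Q * X * (Q * X) * (1ℤ - π * π * (s + v * v)) + Q * X * (Q * X) * s * (v * v) * (π * π * (π * π))
      ≈⟨ mod-+ˡ (Q * X * (Q * X) * (1ℤ - π * π * (s + v * v))) (≡0-*ˡ 3 (Q * X * (Q * X) * s * (v * v)) (lower 3 1 (≡0-* 2 2 {π * π} {π * π} π²≡0 π²≡0))) ⟩
    Q * X * (Q * X) * (1ℤ - π * π * (s + v * v)) + 0ℤ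
      ≡⟨ ℤP.+-identityʳ (Q * X * (Q * X) * (1ℤ - π * π * (s + v * v))) ⟩
    Q * X * (Q * X) * (1ℤ - π * π * (s + v * v)) ∎
    where
    open SetoidReasoning (mod-setoid (p ℕ.^ 3))
    Q X s v : ℤ
    Q = poch x i
    X = x + + i
    s = invSquares x i
    v = inv X
    X-inv : 1ℤ ≡ X * v [p^ 3 ]
    X-inv = lower 3 2 (mod-sym (inv-inverse X (u i (ℕP.n<1+n i))))
    e₁ : ∀ P Q x z i → P * (x + z + i) * (Q * (x - z + i)) ≡ P * Q * ((x + i) * (x + i) - z * z * (1ℤ * 1ℤ))
    e₁ = solve-∀
    e₂ : ∀ Q X z s v → Q * Q * (1ℤ - z * s) * (X * X - z * (X * v * (X * v)))
      ≡ Q * X * (Q * X) * (1ℤ - z * (s + v * v)) + Q * X * (Q * X) * s * (v * v) * (z * z)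
    e₂ = solve-∀

  ratio-poch : ∀ i → i ℕ.≤ n → ratio i * poch 1ℤ i ≡ poch A i [p^ 5 ]
  ratio-poch i i≤n = combine (poch A i) (inv-inverse (poch 1ℤ i) (U-1i i i≤n)) (e (poch A i) (poch 1ℤ i) (inv (poch 1ℤ i)))
    where e : ∀ a q v → a * v * q - a ≡ a * (q * v - 1ℤ)
          e = solve-∀

  pairRatio-0 : ∀ i → i ℕ.≤ n → pairRatio 0ℤ i ≡ ratio i * ratio i [p^ 5 ]
  pairRatio-0 i i≤n = cancel 5 D (U-* (poch (1ℤ + 0ℤ) i) (poch (1ℤ - 0ℤ) i) (U-1yi 0ℤ mod-refl i i≤n) (U-1yi (- 0ℤ) mod-refl i i≤n)) (begin
    D * (poch (A + 0ℤ) i * poch (A - 0ℤ) i * inv D)  ≡⟨ e₁ D (poch (A + 0ℤ) i) (poch (A - 0ℤ) i) (inv D) ⟩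
    poch (A + 0ℤ) i * poch (A - 0ℤ) i * (D * inv D)  ≈⟨ mod-*ˡ (poch (A + 0ℤ) i * poch (A - 0ℤ) i) (pairDen-inv 0ℤ mod-refl i i≤n) ⟩
    poch (A + 0ℤ) i * poch (A - 0ℤ) i * 1ℤ           ≡⟨ cong₂ (λ s t → poch s i * poch t i * 1ℤ) (ℤP.+-identityʳ A) (ℤP.+-identityʳ A) ⟩
    poch A i * poch A i * 1ℤ                         ≈⟨ mod-*ʳ 1ℤ (mod-* (mod-sym (ratio-poch i i≤n)) (mod-sym (ratio-poch i i≤n))) ⟩
    ratio i * poch 1ℤ i * (ratio i * poch 1ℤ i) * 1ℤ ≡⟨ e₂ (ratio i) (poch 1ℤ i) ⟩
    D * (ratio i * ratio i)                          ∎)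
    where
    open R
    D = poch (1ℤ + 0ℤ) i * poch (1ℤ - 0ℤ) i
    e₁ : ∀ D a b v → D * (a * b * v) ≡ a * b * (D * v)
    e₁ = solve-∀
    e₂ : ∀ r q → r * q * (r * q) * 1ℤ ≡ q * q * (r * r)
    e₂ = solve-∀

  -- The coefficient of π² in `pairRatio π i`, whose constant term is the square of `ratio i`.
  defect : ℕ → ℤ
  defect i = ratio i * ratio i * (invSquares 1ℤ i - invSquares A i)

  pairRatio-π : ∀ i → i ℕ.≤ n → pairRatio π i - ratio i * ratio i ≡ π * π * defect i [p^ 3 ]
  pairRatio-π i i≤n = cancel 3 D (U-* (poch (1ℤ + π) i) (poch (1ℤ - π) i) (U-1yi π π≡0 i i≤n) (U-1yi (- π) (neg-≡0 1 π≡0) i i≤n)) (begin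
    D * (Nu * inv D - e * e)                ≡⟨ e₁ D Nu (inv D) e ⟩
    Nu * (D * inv D) - D * (e * e)          ≈⟨ mod-- (mod-*ˡ Nu (lower 3 2 (pairDen-inv π π≡0 i i≤n))) (mod-*ʳ (e * e) D≡) ⟩
    Nu * 1ℤ - P * P * (1ℤ - Z * β) * (e * e)  ≈⟨ mod-+ʳ (- (P * P * (1ℤ - Z * β) * (e * e))) (mod-*ʳ 1ℤ (pair-expansion A i λ j j<i → U-[A] j (ℕP.<-≤-trans j<i i≤n))) ⟩
    poch A i * poch A i * (1ℤ - Z * α) * 1ℤ - P * P * (1ℤ - Z * β) * (e * e)
      ≈⟨ mod-+ʳ (- (P * P * (1ℤ - Z * β) * (e * e))) (mod-*ʳ 1ℤ (mod-*ʳ (1ℤ - Z * α) (mod-* (mod-sym eP) (mod-sym eP)))) ⟩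
    e * P * (e * P) * (1ℤ - Z * α) * 1ℤ - P * P * (1ℤ - Z * β) * (e * e)
      ≡⟨ e₂ e P Z α β ⟩
    P * P * (1ℤ - Z * β) * (Z * (e * e * (β - α))) + P * P * β * (e * e * (β - α)) * (Z * Z)
      ≈⟨ mod-+ (mod-*ʳ (Z * defect i) (mod-sym D≡)) (≡0-*ˡ 3 (P * P * β * (e * e * (β - α))) (lower 3 1 (≡0-* 2 2 {Z} {Z} π²≡0 π²≡0))) ⟩
    D * (Z * defect i) + 0ℤ                 ≡⟨ ℤP.+-identityʳ (D * (Z * defect i)) ⟩
    D * (Z * defect i)                      ∎)
    where
    open SetoidReasoning (mod-setoid (p ℕ.^ 3))
    D Nu e P Z α β : ℤ
    D = poch (1ℤ + π) i * poch (1ℤ - π) i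
    Nu = poch (A + π) i * poch (A - π) i
    e = ratio i
    P = poch 1ℤ i
    Z = π * π
    α = invSquares A i
    β = invSquares 1ℤ i
    D≡ : D ≡ P * P * (1ℤ - Z * β) [p^ 3 ]
    D≡ = pair-expansion 1ℤ i λ j j<i → subst U (cong (_+ + j) (ℤP.+-identityʳ 1ℤ)) (U-[1+y] {0ℤ} mod-refl j (ℕP.<-≤-trans j<i i≤n))
    eP : e * P ≡ poch A i [p^ 3 ]
    eP = lower 3 2 (ratio-poch i i≤n)
    e₁ : ∀ D N v e → D * (N * v - e * e) ≡ N * (D * v) - D * (e * e)
    e₁ = solve-∀
    e₂ : ∀ e P Z α β → e * P * (e * P) * (1ℤ - Z * α) * 1ℤ - P * P * (1ℤ - Z * β) * (e * e)
      ≡ P * P * (1ℤ - Z * β) * (Z * (e * e * (β - α))) + P * P * β * (e * e * (β - α)) * (Z * Z)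
    e₂ = solve-∀

  A≡-n : A ≡ - + n [p^ 1 ]
  A≡-n = combine 1ℤ π≡0 (e A (+ n))
    where e : ∀ A n → A - - n ≡ 1ℤ * (A + n - 0ℤ)
          e = solve-∀

  module _ (i l : ℕ) (il≡n : i ℕ.+ l ≡ n) where

    i≤n : i ℕ.≤ n
    i≤n = subst (i ℕ.≤_) il≡n (ℕP.m≤m+n i l)

    -- Modulo p, A ≡ -n makes `ratio i` the signed binomial coefficient (-1)^i n! / (i! l!), here
    -- multiplied out.
    ratio-factorial : ratio i * poch 1ℤ i * poch 1ℤ l ≡ sgn i * poch 1ℤ n [p^ 1 ]
    ratio-factorial = mod-trans (mod-*ʳ (poch 1ℤ l) (mod-trans (lower 1 4 (ratio-poch i i≤n)) (poch-mod i A≡-n)))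
      (≡-to-mod (begin
        poch (- + n) i * poch 1ℤ l               ≡⟨ cong (_* poch 1ℤ l) (poch-reflect′ (- + n) (1ℤ + + l) i (trans (cong (λ t → - + t + (1ℤ + + l)) (sym il≡n)) (e₁ (+ i) (+ l)))) ⟩
        sgn i * poch (1ℤ + + l) i * poch 1ℤ l    ≡⟨ e₂ (sgn i) (poch (1ℤ + + l) i) (poch 1ℤ l) ⟩
        sgn i * (poch 1ℤ l * poch (1ℤ + + l) i)  ≡⟨ cong (sgn i *_) (sym (poch-shift 1ℤ l n i (trans (sym il≡n) (ℕP.+-comm i l)))) ⟩
        sgn i * poch 1ℤ n                        ∎))
      where
      open ≡-Reasoning
      e₁ : ∀ i l → - (i + l) + (1ℤ + l) ≡ 1ℤ - i
      e₁ = solve-∀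
      e₂ : ∀ s x y → s * x * y ≡ s * (y * x)
      e₂ = solve-∀

  -- Signed binomial coefficients of an even n are symmetric.
  ratio-sym : ∀ i l → i ℕ.+ l ≡ n → ratio i ≡ ratio l [p^ 1 ]
  ratio-sym i l il = cancel 1 (poch 1ℤ i * poch 1ℤ l) (U-* (poch 1ℤ i) (poch 1ℤ l) (U-1i i (i≤n i l il)) (U-1i l (i≤n l i li)))
    (mod-trans (≡-to-mod (e₁ (poch 1ℤ i) (poch 1ℤ l) (ratio i))) (mod-trans (ratio-factorial i l il) (mod-trans (≡-to-mod (cong (_* poch 1ℤ n) sgn-sym))
      (mod-trans (mod-sym (ratio-factorial l i li)) (≡-to-mod (e₂ (poch 1ℤ i) (poch 1ℤ l) (ratio l)))))))
    where
    li : l ℕ.+ i ≡ n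
    li = trans (ℕP.+-comm l i) il
    e₁ : ∀ x y r → x * y * r ≡ r * x * y
    e₁ = solve-∀
    e₂ : ∀ x y r → r * y * x ≡ x * y * r
    e₂ = solve-∀
    sgn-sym : sgn i ≡ sgn l
    sgn-sym = begin
      sgn i                   ≡⟨ ℤP.*-identityʳ (sgn i) ⟨
      sgn i * 1ℤ              ≡⟨ cong (sgn i *_) (sgn² l) ⟨
      sgn i * (sgn l * sgn l) ≡⟨ ℤP.*-assoc (sgn i) (sgn l) (sgn l) ⟨
      sgn i * sgn l * sgn l   ≡⟨ cong (_* sgn l) (trans (sym (sgn-+ i l)) (trans (cong sgn il) sgn-n)) ⟩
      1ℤ * sgn l              ≡⟨ ℤP.*-identityˡ (sgn l) ⟩
      sgn l                   ∎
      where open ≡-Reasoning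

  -- Modulo p, A + j ≡ -(n - j); so the i terms 1/(A + j)² are those of 1/1², ..., 1/n² that follow
  -- the initial l.
  invSquares-sum : ∀ i l → i ℕ.+ l ≡ n → invSquares A i + invSquares 1ℤ l ≡ invSquares 1ℤ n [p^ 1 ]
  invSquares-sum zero    l il = ≡-to-mod (trans (ℤP.+-identityˡ (invSquares 1ℤ l)) (cong (invSquares 1ℤ) il))
  invSquares-sum (suc i) l il = mod-trans (mod-+ʳ (invSquares 1ℤ l) (mod-+ˡ (invSquares A i) v²≡w²))
    (mod-trans (≡-to-mod (e (invSquares A i) (w * w) (invSquares 1ℤ l))) (invSquares-sum i (suc l) (trans (ℕP.+-suc i l) il)))
    where
    x y v w : ℤ
    x = A + + i
    y = 1ℤ + + l
    v = inv x
    w = inv y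
    e : ∀ a s b → a + s + b ≡ a + (b + s)
    e = solve-∀
    i<n : i ℕ.< n
    i<n = subst (suc i ℕ.≤_) il (ℕP.m≤m+n (suc i) l)
    l<n : l ℕ.< n
    l<n = subst (suc l ℕ.≤_) il (s≤s (ℕP.m≤n+m l i))
    xv : x * v ≡ 1ℤ [p^ 1 ]
    xv = lower 1 4 (inv-inverse x (U-[A] i i<n))
    yw : y * w ≡ 1ℤ [p^ 1 ]
    yw = lower 1 4 (inv-inverse y (subst U (cong (_+ + l) (ℤP.+-identityʳ 1ℤ)) (U-[1+y] {0ℤ} mod-refl l l<n)))
    x≡-y : x ≡ - y [p^ 1 ]
    x≡-y = combine 1ℤ π≡0 (trans (e′ A (+ i) (+ l)) (cong (λ t → 1ℤ * (A + + t - 0ℤ)) il))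
      where e′ : ∀ A i l → A + i - - (1ℤ + l) ≡ 1ℤ * (A + (1ℤ + i + l) - 0ℤ)
            e′ = solve-∀
    v≡-w : v ≡ - w [p^ 1 ]
    v≡-w = unique-inverse x (- y) v (- w) x≡-y xv (mod-trans (≡-to-mod (e′ y w)) yw)
      where e′ : ∀ y w → - y * - w ≡ y * w
            e′ = solve-∀
    v²≡w² : v * v ≡ w * w [p^ 1 ]
    v²≡w² = mod-trans (mod-* v≡-w v≡-w) (≡-to-mod (e′ w))
      where e′ : ∀ w → - w * - w ≡ w * w
            e′ = solve-∀

  defect-sym : ∀ i l → i ℕ.+ l ≡ n → defect i ≡ defect l [p^ 1 ]
  defect-sym i l il = mod-* (mod-* (ratio-sym i l il) (ratio-sym i l il))
    (combine₂ -1ℤ 1ℤ (invSquares-sum i l il) (invSquares-sum l i (trans (ℕP.+-comm l i) il)) (e (invSquares 1ℤ i) (invSquares A i) (invSquares 1ℤ l) (invSquares A l) (invSquares 1ℤ n)))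
    where e : ∀ b a b′ a′ s → b - a - (b′ - a′) ≡ -1ℤ * (a + b′ - s) + 1ℤ * (a′ + b - s)
          e = solve-∀

  weight : ℕ → ℤ
  weight i = (A + + 2 * + i) * ratio i

  -- Modulo p the reversal i ↦ n - i fixes the ratio and the defect and negates A + 2 i.
  weight-defect : diagSum n (λ i _ → weight i * (defect i * defect i)) ≡ 0ℤ [p^ 1 ]
  weight-defect = cancel 1 (+ 2) U-2 (begin
    + 2 * diagSum n w                          ≡⟨ e₀ (diagSum n w) ⟩
    diagSum n w + diagSum n w                  ≡⟨ cong (λ t → diagSum n w + t) (diagSum-flip n w) ⟩
    diagSum n w + diagSum n (λ i l → w l i)    ≈⟨ mod-+ˡ (diagSum n w) (diagSum-mod n antisym) ⟩
    diagSum n w + diagSum n (λ i l → -1ℤ * w i l)  ≡⟨ cong (λ t → diagSum n w + t) (diagSum-* n -1ℤ w) ⟩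
    diagSum n w + -1ℤ * diagSum n w            ≡⟨ e₁ (diagSum n w) ⟩
    + 2 * 0ℤ                                   ∎)
    where
    open SetoidReasoning (mod-setoid (p ℕ.^ 1))
    w : ℕ → ℕ → ℤ
    w i _ = weight i * (defect i * defect i)
    e₀ : ∀ x → + 2 * x ≡ x + x
    e₀ = solve-∀
    e₁ : ∀ x → x + -1ℤ * x ≡ + 2 * 0ℤ
    e₁ = solve-∀
    antisym : ∀ i l → i ℕ.+ l ≡ n → w l i ≡ -1ℤ * w i l [p^ 1 ]
    antisym i l il = mod-trans (mod-* (mod-* lin (mod-sym (ratio-sym i l il))) (mod-* (mod-sym (defect-sym i l il)) (mod-sym (defect-sym i l il))))
      (≡-to-mod (e₂ (A + + 2 * + i) (ratio i) (defect i)))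
      where
      e₂ : ∀ z r x → - z * r * (x * x) ≡ -1ℤ * (z * r * (x * x))
      e₂ = solve-∀
      lin : A + + 2 * + l ≡ - (A + + 2 * + i) [p^ 1 ]
      lin = combine (+ 2) π≡0 (trans (e A (+ i) (+ l)) (cong (λ t → + 2 * (A + + t - 0ℤ)) il))
        where e : ∀ A i l → A + + 2 * l - - (A + + 2 * i) ≡ + 2 * (A + (i + l) - 0ℤ)
              e = solve-∀

  F₀ : ℤ
  F₀ = diagSum n (λ i _ → weight i * (ratio i * ratio i * (ratio i * ratio i)))

  -- Termwise E² + c² = 2cE + (c - E)², and the squares sum to π⁴ times the sum in `weight-defect`.
  F₀-F : F₀ + F π ≡ + 2 * F 0ℤ [p^ 5 ]
  F₀-F = begin
    F₀ + F π
      ≡⟨ diagSum-+ n (λ i _ → weight i * (ratio i * ratio i * (ratio i * ratio i))) (λ i _ → weight i * pairRatio π i * pairRatio π i) ⟨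
    diagSum n (λ i _ → weight i * (ratio i * ratio i * (ratio i * ratio i)) + weight i * pairRatio π i * pairRatio π i)
      ≈⟨ diagSum-mod n (λ i l il → term i (i≤n i l il)) ⟩
    diagSum n (λ i _ → + 2 * (weight i * pairRatio π i * pairRatio 0ℤ i) + π * π * (π * π) * (weight i * (defect i * defect i)))
      ≡⟨ diagSum-+ n (λ i _ → + 2 * (weight i * pairRatio π i * pairRatio 0ℤ i)) (λ i _ → π * π * (π * π) * (weight i * (defect i * defect i))) ⟩
    diagSum n (λ i _ → + 2 * (weight i * pairRatio π i * pairRatio 0ℤ i)) + diagSum n (λ i _ → π * π * (π * π) * (weight i * (defect i * defect i)))
      ≡⟨ cong₂ _+_ (diagSum-* n (+ 2) (λ i _ → weight i * pairRatio π i * pairRatio 0ℤ i)) (diagSum-* n (π * π * (π * π)) (λ i _ → weight i * (defect i * defect i))) ⟩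
    + 2 * F 0ℤ + π * π * (π * π) * diagSum n (λ i _ → weight i * (defect i * defect i))
      ≈⟨ mod-+ˡ (+ 2 * F 0ℤ) (≡0-* 4 1 {π * π * (π * π)} (≡0-* 2 2 {π * π} {π * π} π²≡0 π²≡0) weight-defect) ⟩
    + 2 * F 0ℤ + 0ℤ
      ≡⟨ ℤP.+-identityʳ (+ 2 * F 0ℤ) ⟩
    + 2 * F 0ℤ ∎
    where
    open R
    term : ∀ i → i ℕ.≤ n → weight i * (ratio i * ratio i * (ratio i * ratio i)) + weight i * pairRatio π i * pairRatio π i
      ≡ + 2 * (weight i * pairRatio π i * pairRatio 0ℤ i) + π * π * (π * π) * (weight i * (defect i * defect i)) [p^ 5 ]
    term i i≤n = begin
      t * (E * E) + t * c * c                                    ≡⟨ e₁ t E c ⟩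
      + 2 * (t * c * E) + t * (δ * δ)                            ≈⟨ mod-+ (mod-*ˡ (+ 2) (mod-*ˡ (t * c) (mod-sym (pairRatio-0 i i≤n)))) (mod-*ˡ t δ²) ⟩
      + 2 * (t * c * pairRatio 0ℤ i) + t * (Z * τ * (Z * τ))     ≡⟨ cong (λ s → + 2 * (t * c * pairRatio 0ℤ i) + s) (e₂ t Z τ) ⟩
      + 2 * (t * c * pairRatio 0ℤ i) + Z * Z * (t * (τ * τ))     ∎
      where
      t E c δ Z τ : ℤ
      t = weight i
      E = ratio i * ratio i
      c = pairRatio π i
      δ = c - E
      Z = π * π
      τ = defect i
      e₁ : ∀ t E c → t * (E * E) + t * c * c ≡ + 2 * (t * c * E) + t * ((c - E) * (c - E))
      e₁ = solve-∀
      e₂ : ∀ t Z τ → t * (Z * τ * (Z * τ)) ≡ Z * Z * (t * (τ * τ))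
      e₂ = solve-∀
      δ≡ : δ ≡ Z * τ [p^ 3 ]
      δ≡ = pairRatio-π i i≤n
      Zτ≡0 : Z * τ ≡ 0ℤ [p^ 2 ]
      Zτ≡0 = ≡0-*ʳ 2 {Z} τ π²≡0
      -- Both numbers are divisible by p² and they agree modulo p³; hence their squares agree modulo
      -- p⁵.
      δ² : δ * δ ≡ Z * τ * (Z * τ) [p^ 5 ]
      δ² = combine 1ℤ (≡0-* 3 2 {δ - Z * τ} {δ + Z * τ}
          (combine 1ℤ δ≡ (e₃ δ (Z * τ))) (combine₂ 1ℤ (+ 2) (lower 2 1 δ≡) Zτ≡0 (e₄ δ (Z * τ)))) (e₅ δ (Z * τ))
        where
        e₃ : ∀ x y → x - y - 0ℤ ≡ 1ℤ * (x - y)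
        e₃ = solve-∀
        e₄ : ∀ x y → x + y - 0ℤ ≡ 1ℤ * (x - y) + + 2 * (y - 0ℤ)
        e₄ = solve-∀
        e₅ : ∀ x y → x * x - y * y ≡ 1ℤ * ((x - y) * (x + y) - 0ℤ)
        e₅ = solve-∀

  -- Modulo p⁴, the values at t = 0, 1, 2 of an affine function of t with slope in p².

  record Progression (x₀ x₁ x₂ : ℤ) : Set where
    constructor progression
    field
      near     : x₁ ≡ x₀ [p^ 2 ]
      balanced : x₂ + x₀ ≡ + 2 * x₁ [p^ 4 ]

  open Progression

  step² : ∀ {x₀ x₁ x₂ y₀ y₁ y₂} → Progression x₀ x₁ x₂ → Progression y₀ y₁ y₂ → (x₁ - x₀) * (y₁ - y₀) ≡ 0ℤ [p^ 4 ]
  step² {x₀} {x₁} {x₂} {y₀} {y₁} {y₂} P Q = ≡0-* 2 2 {x₁ - x₀} {y₁ - y₀} (combine 1ℤ (near P) (e x₁ x₀)) (combine 1ℤ (near Q) (e y₁ y₀))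
    where e : ∀ a b → a - b - 0ℤ ≡ 1ℤ * (a - b)
          e = solve-∀

  Progression-* : ∀ {x₀ x₁ x₂ y₀ y₁ y₂} → Progression x₀ x₁ x₂ → Progression y₀ y₁ y₂ → Progression (x₀ * y₀) (x₁ * y₁) (x₂ * y₂)
  Progression-* {x₀} {x₁} {x₂} {y₀} {y₁} {y₂} P Q = progression (mod-* (near P) (near Q))
    (mod-trans (combine₂ y₂ (+ 2 * x₁ - x₀) (balanced P) (balanced Q) (e x₀ x₁ x₂ y₀ y₁ y₂)) (combine (+ 2) (step² P Q) (e′ x₀ x₁ y₀ y₁)))
    where
    e : ∀ x₀ x₁ x₂ y₀ y₁ y₂ → x₂ * y₂ + x₀ * y₀ - ((+ 2 * x₁ - x₀) * (+ 2 * y₁ - y₀) + x₀ * y₀)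
      ≡ y₂ * (x₂ + x₀ - + 2 * x₁) + (+ 2 * x₁ - x₀) * (y₂ + y₀ - + 2 * y₁)
    e = solve-∀
    e′ : ∀ x₀ x₁ y₀ y₁ → (+ 2 * x₁ - x₀) * (+ 2 * y₁ - y₀) + x₀ * y₀ - + 2 * (x₁ * y₁) ≡ + 2 * ((x₁ - x₀) * (y₁ - y₀) - 0ℤ)
    e′ = solve-∀

  -- The progression property of the quotients without division: if y₁² = y₀ y₂ is a unit, dividing
  -- by it gives 2 x₁/y₁ ≡ x₂/y₂ + x₀/y₀.
  Progression-cross : ∀ {x₀ x₁ x₂ y₀ y₁ y₂} → Progression x₀ x₁ x₂ → Progression y₀ y₁ y₂ → + 2 * (x₁ * y₁) ≡ x₂ * y₀ + x₀ * y₂ [p^ 4 ]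
  Progression-cross {x₀} {x₁} {x₂} {y₀} {y₁} {y₂} P Q =
    mod-trans (combine (+ 2) (step² P Q) (e x₀ x₁ y₀ y₁)) (mod-sym (combine₂ y₀ x₀ (balanced P) (balanced Q) (e′ x₀ x₁ x₂ y₀ y₁ y₂)))
    where
    e : ∀ x₀ x₁ y₀ y₁ → + 2 * (x₁ * y₁) - ((+ 2 * x₁ - x₀) * y₀ + x₀ * (+ 2 * y₁ - y₀)) ≡ + 2 * ((x₁ - x₀) * (y₁ - y₀) - 0ℤ)
    e = solve-∀
    e′ : ∀ x₀ x₁ x₂ y₀ y₁ y₂ → x₂ * y₀ + x₀ * y₂ - ((+ 2 * x₁ - x₀) * y₀ + x₀ * (+ 2 * y₁ - y₀)) ≡ y₀ * (x₂ + x₀ - + 2 * x₁) + x₀ * (y₂ + y₀ - + 2 * y₁)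
    e′ = solve-∀

  -- Extrapolation from (π, 0) and (π, π) to (0, 0)

  module _ {f} (E : Even f) where

    open Even E

    Even-near : ∀ {x} → x ≡ 0ℤ [p^ 1 ] → f x 0ℤ ≡ f 0ℤ 0ℤ [p^ 2 ]
    Even-near {x} hx = mod-trans (lower 2 2 (Even-x0 E hx)) (mod-trans (mod-+ˡ c₀ (≡0-*ˡ 2 c₁ {x * x} (≡0-* 1 1 {x} {x} hx hx)))
      (mod-trans (≡-to-mod (ℤP.+-identityʳ c₀)) (lower 2 2 (mod-sym (Even-00 E)))))

    Even-double : ∀ {x} → x ≡ 0ℤ [p^ 1 ] → f (x + x) 0ℤ + + 3 * f 0ℤ 0ℤ ≡ + 4 * f x 0ℤ [p^ 4 ]
    Even-double {x} hx = mod-trans (mod-+ (Even-x0 E {x + x} (mod-+ hx hx)) (mod-*ˡ (+ 3) (Even-00 E))) (mod-trans (≡-to-mod (e c₀ c₁ x)) (mod-*ˡ (+ 4) (mod-sym (Even-x0 E hx))))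
      where e : ∀ c c₁ x → c + c₁ * ((x + x) * (x + x)) + + 3 * c ≡ + 4 * (c + c₁ * (x * x))
            e = solve-∀

    Even-mixed : ∀ {x y} → x ≡ 0ℤ [p^ 1 ] → y ≡ 0ℤ [p^ 1 ] → f x y + f 0ℤ 0ℤ ≡ f x 0ℤ + f 0ℤ y [p^ 4 ]
    Even-mixed {x} {y} hx hy = mod-trans (mod-+ (expansion hx hy) (Even-00 E)) (mod-trans (≡-to-mod (e c₀ (c₁ * (x * x)) (c₂ * (y * y)))) (mod-+ (mod-sym (Even-x0 E hx)) (mod-sym (Even-0y E hy))))
      where e : ∀ c u v → c + u + v + c ≡ c + u + (c + v)
            e = solve-∀

  q₀ θ₀ : ℤ
  q₀ = q 0ℤ
  θ₀ = θ 0ℤ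

  -- J separates additively in x² and y² modulo p⁴, and by symmetry its two mixed values agree.
  J-progression : Progression (J 0ℤ 0ℤ) (J 0ℤ π) (J π π)
  J-progression = progression (mod-trans (≡-to-mod (J-sym 0ℤ π)) (Even-near J-even π≡0))
    (mod-trans (Even-mixed J-even π≡0 π≡0) (≡-to-mod (trans (cong (λ t → t + J 0ℤ π) (J-sym π 0ℤ)) (e (J 0ℤ π)))))
    where e : ∀ x → x + x ≡ + 2 * x
          e = solve-∀

  -- These are the values of q(x + y) q(x - y) at (0, 0), (π, 0) and (π, π). The balance holds
  -- because (q(π) - q(0))² ≡ 0 reduces both sides to 4 q(π) q(0) - 2 q(0)².
  q-progression : Progression (q₀ * q₀) (q π * q π) (q (π + π) * q₀)
  q-progression = progression (mod-* q-near q-near)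
    (mod-trans (combine q₀ (Even-double (G-even a) π≡0) (e q₀ (q π) (q (π + π)))) (mod-sym (combine (+ 2) square (e′ q₀ (q π)))))
    where
    q-near : q π ≡ q₀ [p^ 2 ]
    q-near = Even-near (G-even a) π≡0
    e : ∀ x y z → z * x + x * x - (+ 4 * y * x - + 2 * (x * x)) ≡ x * (z + + 3 * x - + 4 * y)
    e = solve-∀
    square : (q π - q₀) * (q π - q₀) ≡ 0ℤ [p^ 4 ]
    square = ≡0-* 2 2 {q π - q₀} {q π - q₀} d≡0 d≡0
      where
      d≡0 : q π - q₀ ≡ 0ℤ [p^ 2 ]
      d≡0 = combine 1ℤ q-near (e″ (q π) q₀)
        where e″ : ∀ a b → a - b - 0ℤ ≡ 1ℤ * (a - b)
              e″ = solve-∀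
    e′ : ∀ x y → + 2 * (y * y) - (+ 4 * y * x - + 2 * (x * x)) ≡ + 2 * ((y - x) * (y - x) - 0ℤ)
    e′ = solve-∀

  -- The values of the denominator θ(x) θ(y) at the same points; the square of the middle one is the
  -- product of the outer two.
  θ-progression : Progression (θ₀ * θ₀) (θ₀ * θ π) (θ π * θ π)
  θ-progression = progression (mod-*ˡ θ₀ θ-near) (combine 1ℤ (≡0-* 2 2 {θ π - θ₀} {θ π - θ₀} d≡0 d≡0) (e′ θ₀ (θ π)))
    where
    θ-near : θ π ≡ θ₀ [p^ 2 ]
    θ-near = Even-near (G-even h) π≡0
    d≡0 : θ π - θ₀ ≡ 0ℤ [p^ 2 ]
    d≡0 = combine 1ℤ θ-near (e″ (θ π) θ₀)
      where e″ : ∀ a b → a - b - 0ℤ ≡ 1ℤ * (a - b)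
            e″ = solve-∀
    e′ : ∀ x y → y * y + x * x - + 2 * (x * y) ≡ 1ℤ * ((y - x) * (y - x) - 0ℤ)
    e′ = solve-∀

  F-0 : F 0ℤ * (G H * θ π * θ₀) ≡ - (π * (G A * (J 0ℤ π * (q π * q π)))) [p^ 5 ]
  F-0 = mod-trans (F-Γ 0ℤ mod-refl) (≡-to-mod (cong -_ (trans (cong₂ (λ s t → π * J 0ℤ π * G A * q s * q t) (ℤP.+-identityʳ π) (ℤP.+-identityʳ π)) (e π (J 0ℤ π) (G A) (q π)))))
    where e : ∀ z j g x → z * j * g * x * x ≡ z * (g * (j * (x * x)))
          e = solve-∀

  F-π : F π * (G H * θ π * θ π) ≡ - (π * (G A * (J π π * (q (π + π) * q₀)))) [p^ 5 ]
  F-π = mod-trans (F-Γ π π≡0) (≡-to-mod (cong -_ (trans (cong (λ t → π * J π π * G A * q (π + π) * q t) (ℤP.+-inverseʳ π)) (e π (J π π) (G A) (q (π + π)) q₀))))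
    where e : ∀ z j g x y → z * j * g * x * y ≡ z * (g * (j * (x * y)))
          e = solve-∀

  -- The values at (π, 0) and (π, π) are brought to the common denominator θ(π)², a unit. The cross
  -- relation holds modulo p⁴ only; the factor π in front lifts it to p⁵.
  F₀-Γ : F₀ * (G H * (θ₀ * θ₀)) ≡ - (π * (G A * (J 0ℤ 0ℤ * (q₀ * q₀)))) [p^ 5 ]
  F₀-Γ = cancel 5 (θ π * θ π) (U-* (θ π) (θ π) U-θ U-θ) (begin
    Θ * Θ * (F₀ * (g * (θ₀ * θ₀)))
      ≈⟨ mod-*ˡ (Θ * Θ) (mod-*ʳ (g * (θ₀ * θ₀)) F₀≡) ⟩
    Θ * Θ * ((+ 2 * F 0ℤ - F π) * (g * (θ₀ * θ₀)))
      ≡⟨ e₁ Θ θ₀ g (F 0ℤ) (F π) ⟩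
    + 2 * (F 0ℤ * (g * Θ * θ₀) * (θ₀ * Θ)) - F π * (g * Θ * Θ) * (θ₀ * θ₀)
      ≈⟨ mod-- (mod-*ˡ (+ 2) (mod-*ʳ (θ₀ * Θ) F-0)) (mod-*ʳ (θ₀ * θ₀) F-π) ⟩
    + 2 * (- (π * (G A * X₁)) * (θ₀ * Θ)) - - (π * (G A * X₂)) * (θ₀ * θ₀)
      ≡⟨ e₂ π (G A) X₁ X₂ (θ₀ * Θ) (θ₀ * θ₀) ⟩
    - G A * (π * (+ 2 * (X₁ * (θ₀ * Θ)) - X₂ * (θ₀ * θ₀)))
      ≈⟨ mod-*ˡ (- G A) (combine 1ℤ (≡0-* 1 4 {π} {+ 2 * (X₁ * (θ₀ * Θ)) - X₂ * (θ₀ * θ₀) - X₀ * (Θ * Θ)} π≡0 cross) (e₃ π (+ 2 * (X₁ * (θ₀ * Θ)) - X₂ * (θ₀ * θ₀)) (X₀ * (Θ * Θ)))) ⟩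
    - G A * (π * (X₀ * (Θ * Θ)))
      ≡⟨ e₄ (G A) π X₀ (Θ * Θ) ⟩
    Θ * Θ * - (π * (G A * X₀)) ∎)
    where
    open R
    g Θ X₀ X₁ X₂ : ℤ
    g = G H
    Θ = θ π
    X₀ = J 0ℤ 0ℤ * (q₀ * q₀)
    X₁ = J 0ℤ π * (q π * q π)
    X₂ = J π π * (q (π + π) * q₀)
    U-θ : U (θ π)
    U-θ = U-* (G (H + π)) (G (H - π)) (G-unit (H + π)) (G-unit (H - π))
    F₀≡ : F₀ ≡ + 2 * F 0ℤ - F π [p^ 5 ]
    F₀≡ = combine 1ℤ F₀-F (e F₀ (F π) (F 0ℤ))
      where e : ∀ a b c → a - (+ 2 * c - b) ≡ 1ℤ * (a + b - + 2 * c)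
            e = solve-∀
    cross : + 2 * (X₁ * (θ₀ * Θ)) - X₂ * (θ₀ * θ₀) - X₀ * (Θ * Θ) ≡ 0ℤ [p^ 4 ]
    cross = combine 1ℤ (Progression-cross (Progression-* J-progression q-progression) θ-progression) (e (+ 2 * (X₁ * (θ₀ * Θ))) (X₂ * (θ₀ * θ₀)) (X₀ * (Θ * Θ)))
      where e : ∀ a b c → a - b - c - 0ℤ ≡ 1ℤ * (a - (b + c))
            e = solve-∀
    e₁ : ∀ Θ t g a b → Θ * Θ * ((+ 2 * a - b) * (g * (t * t))) ≡ + 2 * (a * (g * Θ * t) * (t * Θ)) - b * (g * Θ * Θ) * (t * t)
    e₁ = solve-∀
    e₂ : ∀ z g x y s t → + 2 * (- (z * (g * x)) * s) - - (z * (g * y)) * t ≡ - g * (z * (+ 2 * (x * s) - y * t))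
    e₂ = solve-∀
    e₃ : ∀ z u v → z * u - z * v ≡ 1ℤ * (z * (u - v) - 0ℤ)
    e₃ = solve-∀
    e₄ : ∀ g z x t → - g * (z * (x * t)) ≡ t * - (z * (g * x))
    e₄ = solve-∀

  θ₀≡ : θ₀ ≡ G H * G H
  θ₀≡ = cong₂ (λ s t → G s * G t) (ℤP.+-identityʳ H) (ℤP.+-identityʳ H)

  q₀≡ : q₀ ≡ G A * G A
  q₀≡ = cong₂ (λ s t → G s * G t) (ℤP.+-identityʳ A) (ℤP.+-identityʳ A)

  F₀-value : + 5 * F₀ * (G H * (G H * G H * (G H * G H))) ≡ - (+ p * (G A * (J 0ℤ 0ℤ * (G A * G A * (G A * G A))))) [p^ 5 ]
  F₀-value = begin
    + 5 * F₀ * (G H * (G H * G H * (G H * G H)))   ≡⟨ cong (λ t → + 5 * F₀ * (G H * (t * t))) (sym θ₀≡) ⟩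
    + 5 * F₀ * (G H * (θ₀ * θ₀))                   ≡⟨ ℤP.*-assoc (+ 5) F₀ (G H * (θ₀ * θ₀)) ⟩
    + 5 * (F₀ * (G H * (θ₀ * θ₀)))                 ≈⟨ mod-*ˡ (+ 5) F₀-Γ ⟩
    + 5 * - (π * (G A * (J 0ℤ 0ℤ * (q₀ * q₀))))    ≡⟨ e (+ 5) π (G A * (J 0ℤ 0ℤ * (q₀ * q₀))) ⟩
    - (+ 5 * π * (G A * (J 0ℤ 0ℤ * (q₀ * q₀))))    ≈⟨ mod-neg (mod-*ʳ (G A * (J 0ℤ 0ℤ * (q₀ * q₀))) 5π≡p) ⟩
    - (+ p * (G A * (J 0ℤ 0ℤ * (q₀ * q₀))))        ≡⟨ cong (λ t → - (+ p * (G A * (J 0ℤ 0ℤ * (t * t))))) q₀≡ ⟩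
    - (+ p * (G A * (J 0ℤ 0ℤ * (G A * G A * (G A * G A))))) ∎
    where
    open R
    e : ∀ c z x → c * - (z * x) ≡ - (c * z * x)
    e = solve-∀

  -- The two sides of the theorem modulo p⁵

  U-1<p : ∀ i → i ℕ.< p → U (poch 1ℤ i)
  U-1<p i i<p = U-poch 1ℤ i λ j j<i → U-small j (ℕP.≤-<-trans j<i i<p)

  U-fifth : ∀ x → U x → U (fifth x)
  U-fifth x u = U-* x (x * (x * (x * (x * 1ℤ)))) u (U-* x (x * (x * (x * 1ℤ))) u (U-* x (x * (x * 1ℤ)) u (U-* x (x * 1ℤ) u (U-* x 1ℤ u U-1))))

  inv-fifth : ∀ x → U x → inv (fifth x) ≡ inv x * (inv x * inv x * (inv x * inv x)) [p^ 5 ]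
  inv-fifth x u = unique-inverse (fifth x) (fifth x) (inv (fifth x)) (inv x * (inv x * inv x * (inv x * inv x))) mod-refl (inv-inverse (fifth x) (U-fifth x u))
    (mod-trans (≡-to-mod (e x (inv x))) (mod-trans (mod-* xv (mod-* (mod-* xv xv) (mod-* xv xv))) mod-refl))
    where
    xv = inv-inverse x u
    e : ∀ x v → x * (x * (x * (x * (x * 1ℤ)))) * (v * (v * v * (v * v))) ≡ x * v * (x * v * (x * v) * (x * v * (x * v)))
    e = solve-∀

  left-term : ℤ → ℕ → ℤ
  left-term r i = (+ 10 * + i + r) * (fifth (poch A i) * inv (fifth (poch 1ℤ i)))

  -- For i > n the symbol (A)_i contains A + n = π, so its fifth power vanishes modulo p⁵ and the
  -- sum stops at n.
  left-sum : ∀ r e → r ≡ + 5 * A [p^ 5 ] → n ℕ.+ e ℕ.< p → diagSum (n ℕ.+ e) (λ i _ → left-term r i) ≡ + 5 * F₀ [p^ 5 ]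
  left-sum r e r≡ n+e<p = mod-trans (diagSum-truncate-mod e n (λ i _ → left-term r i) (λ i _ → vanish i))
    (mod-trans (diagSum-mod n (λ i l il → term i (subst (i ℕ.≤_) il (ℕP.m≤m+n i l)))) (≡-to-mod (diagSum-* n (+ 5) (λ i _ → weight i * (ratio i * ratio i * (ratio i * ratio i))))))
    where
    vanish : ∀ i → left-term r (suc (n ℕ.+ i)) ≡ 0ℤ [p^ 5 ]
    vanish i = ≡0-*ˡ 5 (+ 10 * + suc (n ℕ.+ i) + r) (≡0-*ʳ 5 (inv (fifth (poch 1ℤ (suc (n ℕ.+ i)))))
        (≡0-* 1 4 {z} z≡0 (≡0-* 1 3 {z} z≡0 (≡0-* 1 2 {z} z≡0 (≡0-* 1 1 {z} z≡0 (≡0-*ʳ 1 1ℤ z≡0))))))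
      where
      z : ℤ
      z = poch A (suc (n ℕ.+ i))
      z≡0 : z ≡ 0ℤ [p^ 1 ]
      z≡0 = mod-trans (≡-to-mod (trans (poch-shift A n (suc (n ℕ.+ i)) (suc i) (sym (ℕP.+-suc n i))) (cong (poch A n *_) (poch-suc π i))))
        (≡0-*ˡ 1 (poch A n) (≡0-*ʳ 1 {π} (poch (1ℤ + π) i) π≡0))
    term : ∀ i → i ℕ.≤ n → left-term r i ≡ + 5 * (weight i * (ratio i * ratio i * (ratio i * ratio i))) [p^ 5 ]
    term i i≤n = mod-trans (mod-* (mod-+ˡ (+ 10 * + i) r≡) (mod-*ˡ (fifth (poch A i)) (inv-fifth (poch 1ℤ i) (U-1i i i≤n))))
      (≡-to-mod (e′ (+ i) A (poch A i) (inv (poch 1ℤ i))))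
      where e′ : ∀ i A q v → (+ 10 * i + + 5 * A) * (q * (q * (q * (q * (q * 1ℤ)))) * (v * (v * v * (v * v))))
                 ≡ + 5 * ((A + + 2 * i) * (q * v) * (q * v * (q * v) * (q * v * (q * v))))
            e′ = solve-∀

  -- A lift of 1/2 + 3r/10: ten times it is congruent to 10 - 10N - 2r, and this is 5 + 3r because
  -- 2N = 1 - r.
  g₀ : ℤ
  g₀ = 1ℤ - + N - A

  U-[g₀] : ∀ i → i ℕ.< N → U (g₀ + + i)
  U-[g₀] i i<N with below i<N
  ... | j , N≡ = subst U (trans (e A (+ i) (+ j)) (cong (λ t → 1ℤ - + t - A + + i) (sym N≡))) (U-neg (A + + j) (U-[A] j (ℕP.<-≤-trans (subst (suc j ℕ.≤_) (sym N≡) (ℕP.m≤n+m (suc j) i)) (ℕP.m≤m+n N d))))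
    where e : ∀ A i j → - (A + j) ≡ 1ℤ - (i + (1ℤ + j)) - A + i
          e = solve-∀

  right-den : ℕ → ℤ
  right-den i = poch 1ℤ i * (poch (A + A) i * (poch (A + A) i * 1ℤ)) * poch g₀ i

  right-term : ℕ → ℤ
  right-term i = poch (- + N) i * (poch A i * (poch A i * (poch A i * 1ℤ))) * inv (right-den i)

  U-2A : ∀ i → i ℕ.≤ N → U (poch (A + A) i)
  U-2A i i≤N = U-poch (A + A) i λ j j<i → subst U (cong (_+ + j) (ℤP.+-identityʳ (A + A))) (U-[2A+y] {0ℤ} mod-refl j (ℕP.<-≤-trans j<i (ℕP.≤-trans i≤N (ℕP.m≤m+n N d))))

  U-g₀ : ∀ i → i ℕ.≤ N → U (poch g₀ i)
  U-g₀ i i≤N = U-poch g₀ i λ j j<i → U-[g₀] j (ℕP.<-≤-trans j<i i≤N)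

  U-right-den : ∀ i → i ℕ.≤ N → U (right-den i)
  U-right-den i i≤N = U-* (poch 1ℤ i * (poch (A + A) i * (poch (A + A) i * 1ℤ))) (poch g₀ i)
    (U-* (poch 1ℤ i) (poch (A + A) i * (poch (A + A) i * 1ℤ)) (U-1i i (ℕP.≤-trans i≤N (ℕP.m≤m+n N d)))
      (U-* (poch (A + A) i) (poch (A + A) i * 1ℤ) (U-2A i i≤N) (U-* (poch (A + A) i) 1ℤ (U-2A i i≤N) U-1)))
    (U-g₀ i i≤N)

  right-sum : ℤ
  right-sum = diagSum N (λ i _ → right-term i)

  -- In the i-th term the common denominator leaves the upper factors (2A + i)_l, twice, and (g₀ +
  -- i)_l. They reflect to (k)_l and (A)_l, while (-N)_i / i! is a signed binomial coefficient; the
  -- result is the summand of J.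
  right-sum-J : right-sum * (poch (A + A) N * poch (A + A) N * poch g₀ N) ≡ sgn N * J 0ℤ 0ℤ [p^ 5 ]
  right-sum-J = begin
    right-sum * C                                     ≡⟨ ℤP.*-comm right-sum C ⟩
    C * right-sum                                     ≡⟨ diagSum-* N C (λ i _ → right-term i) ⟨
    diagSum N (λ i _ → C * right-term i)              ≈⟨ diagSum-mod N term ⟩
    diagSum N (λ i l → sgn N * (binom i l * j i l))   ≡⟨ diagSum-* N (sgn N) (λ i l → binom i l * j i l) ⟩
    sgn N * diagSum N (λ i l → binom i l * j i l)     ≡⟨ cong (sgn N *_) (binSum-diagSum N j) ⟨
    sgn N * J 0ℤ 0ℤ                                   ∎
    where
    open R
    C : ℤ
    C = poch (A + A) N * poch (A + A) N * poch g₀ N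
    j : ℕ → ℕ → ℤ
    j i l = poch A i * poch (A + 0ℤ) i * poch (A - 0ℤ) i * (poch A l * poch (k + 0ℤ) l * poch (k - 0ℤ) l)
    term : ∀ i l → i ℕ.+ l ≡ N → C * right-term i ≡ sgn N * (binom i l * j i l) [p^ 5 ]
    term i l il = cancel 5 o (U-1i i (ℕP.≤-trans i≤N (ℕP.m≤m+n N d))) (begin
      o * (C * (b * (x * (x * (x * 1ℤ))) * v))
        ≡⟨ cong (λ c → o * (c * (b * (x * (x * (x * 1ℤ))) * v))) (cong₂ _*_ (cong₂ _*_ (split (A + A)) (split (A + A))) (split g₀)) ⟩
      o * (t * tl * (t * tl) * (u * ul) * (b * (x * (x * (x * 1ℤ))) * v))
        ≡⟨ e₀ o (t * tl * (t * tl) * (u * ul)) b x v ⟩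
      b * (x * x * x) * (o * v) * (t * tl * (t * tl) * (u * ul))
        ≡⟨ gather-series b x (o * v) t u tl ul ⟩
      b * (x * x * x) * (tl * tl * ul) * (t * t * u * (o * v))
        ≈⟨ mod-*ˡ (b * (x * x * x) * (tl * tl * ul)) (mod-trans (≡-to-mod (e₁ t u o v)) (inv-inverse (right-den i) (U-right-den i i≤N))) ⟩
      b * (x * x * x) * (tl * tl * ul) * 1ℤ
        ≡⟨ cong₂ (λ s r → b * (x * x * x) * (s * s * r) * 1ℤ) (poch-reflect′ (A + A + + i) k l (trans (cong (λ q → A + A + + i + (1ℤ - (A + A + + q))) (sym il)) (e₂ A (+ i) (+ l))))
             (poch-reflect′ (g₀ + + i) A l (trans (cong (λ q → 1ℤ - + q - A + + i + A) (sym il)) (e₃ A (+ i) (+ l)))) ⟩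
      b * (x * x * x) * (sgn l * y * (sgn l * y) * (sgn l * z)) * 1ℤ
        ≡⟨ e₄ b (x * x * x) (sgn l) y z ⟩
      sgn l * sgn l * (sgn l * b * (x * x * x * (z * y * y)))
        ≡⟨ trans (cong (_* (sgn l * b * (x * x * x * (z * y * y)))) (sgn² l)) (ℤP.*-identityˡ (sgn l * b * (x * x * x * (z * y * y)))) ⟩
      sgn l * b * (x * x * x * (z * y * y))
        ≡⟨ cong (λ s → s * b * (x * x * x * (z * y * y))) sgn-l ⟩
      sgn N * sgn i * b * (x * x * x * (z * y * y))
        ≡⟨ cong (_* (x * x * x * (z * y * y))) (trans (ℤP.*-assoc (sgn N) (sgn i) b) (cong (sgn N *_) (sym (binom-poch i l N il)))) ⟩
      sgn N * (binom i l * o) * (x * x * x * (z * y * y))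
        ≡⟨ e₅ (sgn N) (binom i l) o (x * x * x * (z * y * y)) ⟩
      o * (sgn N * (binom i l * (x * x * x * (z * y * y))))
        ≡⟨ cong (λ s → o * (sgn N * (binom i l * s))) (cong₂ _*_ (cong₂ (λ s r → x * poch s i * poch r i) (sym (ℤP.+-identityʳ A)) (sym (ℤP.+-identityʳ A)))
              (cong₂ (λ s r → z * poch s l * poch r l) (sym (ℤP.+-identityʳ k)) (sym (ℤP.+-identityʳ k)))) ⟩
      o * (sgn N * (binom i l * j i l)) ∎)
      where
      i≤N : i ℕ.≤ N
      i≤N = subst (i ℕ.≤_) il (ℕP.m≤m+n i l)
      split : ∀ w → poch w N ≡ poch w i * poch (w + + i) l
      split w = poch-shift w i N l (sym il)
      o b x v t u tl ul y z : ℤ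
      o = poch 1ℤ i
      b = poch (- + N) i
      x = poch A i
      v = inv (right-den i)
      t = poch (A + A) i
      u = poch g₀ i
      tl = poch (A + A + + i) l
      ul = poch (g₀ + + i) l
      y = poch k l
      z = poch A l
      sgn-l : sgn l ≡ sgn N * sgn i
      sgn-l = trans (sym (ℤP.*-identityˡ (sgn l))) (trans (cong (_* sgn l) (sym (sgn² i))) (trans (e (sgn i) (sgn l)) (cong (_* sgn i) (trans (sym (sgn-+ i l)) (cong sgn il)))))
        where e : ∀ s r → s * s * r ≡ s * r * s
              e = solve-∀
      e₀ : ∀ o c b x v → o * (c * (b * (x * (x * (x * 1ℤ))) * v)) ≡ b * (x * x * x) * (o * v) * c
      e₀ = solve-∀
      e₁ : ∀ t u o v → t * t * u * (o * v) ≡ o * (t * (t * 1ℤ)) * u * v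
      e₁ = solve-∀
      e₂ : ∀ A i l → A + A + i + (1ℤ - (A + A + (i + l))) ≡ 1ℤ - l
      e₂ = solve-∀
      e₃ : ∀ A i l → 1ℤ - (i + l) - A + i + A ≡ 1ℤ - l
      e₃ = solve-∀
      e₄ : ∀ b x s y z → b * x * (s * y * (s * y) * (s * z)) * 1ℤ ≡ s * s * (s * b * (x * (z * y * y)))
      e₄ = solve-∀
      e₅ : ∀ s b o x → s * (b * o) * x ≡ o * (s * (b * x))
      e₅ = solve-∀

  -- Going n steps from A to π and from 1 - π to 1 - A produces the same factor (A)_n = (1 - π)_n,
  -- so the product equals the one at π, a multiple of p.
  refl-A : refl-product A ≡ -1ℤ [p^ 5 ]
  refl-A = mod-trans (mod-*ˡ (G A) g≡) (mod-trans (≡-to-mod (e (G A) (poch A n) (G (1ℤ - π)))) (mod-trans (mod-*ʳ (G (1ℤ - π)) (mod-sym Gπ)) (refl-nonunit π≡0)))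
    where
    e : ∀ g q h → g * (q * h) ≡ q * g * h
    e = solve-∀
    Gπ : G π ≡ poch A n * G A [p^ 5 ]
    Gπ = mod-trans (G-poch A n U-[A]) (≡-to-mod (cong (_* G A) (trans (cong (_* poch A n) sgn-n) (ℤP.*-identityˡ (poch A n)))))
    g≡ : G (1ℤ - A) ≡ poch A n * G (1ℤ - π) [p^ 5 ]
    g≡ = mod-trans (≡-to-mod (cong G (e′ A (+ n)))) (mod-trans (G-poch (1ℤ - π) n (U-[1+y] { - π} (neg-≡0 1 π≡0)))
      (≡-to-mod (cong (_* G (1ℤ - π)) (trans (cong₂ _*_ sgn-n 1-π) (ℤP.*-identityˡ (poch A n))))))
      where e′ : ∀ A n → 1ℤ - A ≡ 1ℤ - (A + n) + n
            e′ = solve-∀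

  -- Two of the five factors Γ(H) and the auxiliary Γ(1 - A) are traded for Γ(2A), twice, and Γ(g₀).
  -- The Pochhammer symbols this creates clear the denominators of `right-sum`, and the Gamma values
  -- together with Γ(H)³ cancel `D`. By `refl-A` the product Γ(A) Γ(1 - A) is -1.
  right-value : ∀ D → G (A + A) * (G (A + A) * 1ℤ) * G g₀ * (G H * (G H * (G H * 1ℤ))) * D ≡ 1ℤ [p^ 5 ] →
    + p * (G A * (G A * (G A * (G A * 1ℤ)))) * D * right-sum * (G H * (G H * G H * (G H * G H)))
    ≡ - (+ p * (G A * (J 0ℤ 0ℤ * (G A * G A * (G A * G A))))) [p^ 5 ]
  right-value D hD = cancel 5 (G (1ℤ - A)) (G-unit (1ℤ - A)) (begin
    G (1ℤ - A) * (P * D * right-sum * (G H * (G H * G H * (G H * G H))))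
      ≡⟨ e₁ (G (1ℤ - A)) (P * D * right-sum) (G H) ⟩
    P * D * right-sum * (H₃ * (G H * G H)) * G (1ℤ - A)
      ≈⟨ mod-* (mod-*ˡ (P * D * right-sum) (mod-*ˡ H₃ (mod-* GH GH))) G1-A ⟩
    P * D * right-sum * (H₃ * (s * t * T * (s * t * T))) * (s * u * G g₀)
      ≡⟨ gather-target P D right-sum t T u (G g₀) H₃ s ⟩
    P * (s * s) * s * (right-sum * (t * t * u)) * (D * (T * T * G g₀ * H₃))
      ≈⟨ mod-* (mod-* (≡-to-mod (cong (λ q → P * q * s) (sgn² N))) right-sum-J) (mod-trans (≡-to-mod (e₂ D T (G g₀) (G H))) hD) ⟩
    P * 1ℤ * s * (s * J 0ℤ 0ℤ) * 1ℤ
      ≡⟨ e₃ P s (J 0ℤ 0ℤ) ⟩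
    s * s * (P * J 0ℤ 0ℤ)
      ≡⟨ trans (cong (_* (P * J 0ℤ 0ℤ)) (sgn² N)) (e₄ (P * J 0ℤ 0ℤ)) ⟩
    - (P * J 0ℤ 0ℤ * -1ℤ)
      ≈⟨ mod-neg (mod-*ˡ (P * J 0ℤ 0ℤ) (mod-sym refl-A)) ⟩
    - (P * J 0ℤ 0ℤ * (G A * G (1ℤ - A)))
      ≡⟨ e₅ (+ p) (G A) (J 0ℤ 0ℤ) (G (1ℤ - A)) ⟩
    G (1ℤ - A) * - (+ p * (G A * (J 0ℤ 0ℤ * (G A * G A * (G A * G A))))) ∎)
    where
    open R
    P H₃ s t T u : ℤ
    P = + p * (G A * (G A * (G A * (G A * 1ℤ))))
    H₃ = G H * G H * G H
    s = sgn N
    t = poch (A + A) N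
    T = G (A + A)
    u = poch g₀ N
    GH : G H ≡ s * t * T [p^ 5 ]
    GH = mod-trans (≡-to-mod (cong G (sym (ℤP.+-identityʳ H)))) (mod-trans (G-H 0ℤ mod-refl) (≡-to-mod (cong (λ w → s * poch w N * G w) (ℤP.+-identityʳ (A + A)))))
    G1-A : G (1ℤ - A) ≡ s * u * G g₀ [p^ 5 ]
    G1-A = mod-trans (≡-to-mod (cong G (e A (+ N)))) (G-poch g₀ N U-[g₀])
      where e : ∀ A N → 1ℤ - A ≡ 1ℤ - N - A + N
            e = solve-∀
    e₁ : ∀ y x h → y * (x * (h * (h * h * (h * h)))) ≡ x * (h * h * h * (h * h)) * y
    e₁ = solve-∀
    e₂ : ∀ D T g h → D * (T * T * g * (h * h * h)) ≡ T * (T * 1ℤ) * g * (h * (h * (h * 1ℤ))) * D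
    e₂ = solve-∀
    e₃ : ∀ P s j → P * 1ℤ * s * (s * j) * 1ℤ ≡ s * s * (P * j)
    e₃ = solve-∀
    e₄ : ∀ x → 1ℤ * x ≡ - (x * -1ℤ)
    e₄ = solve-∀
    e₅ : ∀ p g j h → - (p * (g * (g * (g * (g * 1ℤ)))) * j * (g * h)) ≡ h * - (p * (g * (j * (g * g * (g * g)))))
    e₅ = solve-∀

  -- Residues of the p-adic expressions in the statement

  module Sides (r : ℤ) (r≡ : r ≡ 1ℤ - + 2 * + N) (r/5≡a : bar (ι r / ι (+ 5)) ≡ A [p^ 5 ]) where

    5A≡r : + 5 * A ≡ r [p^ 5 ]
    5A≡r = mod-trans 5a (≡-to-mod (sym r≡))

    U-10 : U (+ 10)
    U-10 = U-* (+ 2) (+ 5) U-2 p∤5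

    ρ 2ρ γ η β : ℤₚ
    ρ = ι r / ι (+ 5)
    2ρ = ι (+ 2 * r) / ι (+ 5)
    γ = ι 1ℤ / ι (+ 2) ⊞ ι (+ 3 * r) / ι (+ 10)
    η = ι 1ℤ / ι (+ 2) ⊟ ι r / ι (+ 10)
    β = ι (r - 1ℤ) / ι (+ 2)

    bar-2ρ : bar 2ρ ≡ A + A [p^ 5 ]
    bar-2ρ = bar-fraction (+ 2 * r) (+ 5) (A + A) p∤5 (combine (+ 2) 5A≡r (e A r))
      where e : ∀ A r → + 5 * (A + A) - + 2 * r ≡ + 2 * (+ 5 * A - r)
            e = solve-∀

    bar-γ : bar γ ≡ g₀ [p^ 5 ]
    bar-γ = cancel 5 (+ 10) U-10 (begin
      + 10 * (u + v)              ≡⟨ e₁ u v ⟩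
      + 5 * (+ 2 * u) + + 10 * v  ≈⟨ mod-+ (mod-*ˡ (+ 5) (bar-fraction′ 1ℤ (+ 2) U-2)) (bar-fraction′ (+ 3 * r) (+ 10) U-10) ⟩
      + 5 * 1ℤ + + 3 * r          ≡⟨ cong (λ t → + 5 * 1ℤ + + 3 * t) r≡ ⟩
      + 5 * 1ℤ + + 3 * (1ℤ - + 2 * + N)        ≈⟨ combine (+ 2) 5a (e₂ A (+ N)) ⟩
      + 10 * (1ℤ - + N - A) ∎)
      where
      open R
      u v : ℤ
      u = bar (ι 1ℤ / ι (+ 2))
      v = bar (ι (+ 3 * r) / ι (+ 10))
      e₁ : ∀ u v → + 10 * (u + v) ≡ + 5 * (+ 2 * u) + + 10 * v
      e₁ = solve-∀
      e₂ : ∀ A N → + 5 * 1ℤ + + 3 * (1ℤ - + 2 * N) - + 10 * (1ℤ - N - A) ≡ + 2 * (+ 5 * A - (1ℤ - + 2 * N))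
      e₂ = solve-∀

    bar-η : bar η ≡ H [p^ 5 ]
    bar-η = cancel 5 (+ 10) U-10 (begin
      + 10 * (u - v)              ≡⟨ e₁ u v ⟩
      + 5 * (+ 2 * u) - + 10 * v  ≈⟨ mod-- (mod-*ˡ (+ 5) (bar-fraction′ 1ℤ (+ 2) U-2)) (bar-fraction′ r (+ 10) U-10) ⟩
      + 5 * 1ℤ - r                ≡⟨ cong (λ t → + 5 * 1ℤ - t) r≡ ⟩
      + 5 * 1ℤ - (1ℤ - + 2 * + N) ≈⟨ combine (- + 4) 5a (e₂ A (+ N)) ⟩
      + 10 * H                    ∎)
      where
      open R
      u v : ℤ
      u = bar (ι 1ℤ / ι (+ 2))
      v = bar (ι r / ι (+ 10))
      e₁ : ∀ u v → + 10 * (u - v) ≡ + 5 * (+ 2 * u) - + 10 * v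
      e₁ = solve-∀
      e₂ : ∀ A N → + 5 * 1ℤ - (1ℤ - + 2 * N) - + 10 * (A + A + N) ≡ - + 4 * (+ 5 * A - (1ℤ - + 2 * N))
      e₂ = solve-∀

    bar-β : bar β ≡ - + N [p^ 5 ]
    bar-β = bar-fraction (r - 1ℤ) (+ 2) (- + N) U-2 (≡-to-mod (trans (e (+ N)) (cong (_- 1ℤ) (sym r≡))))
      where e : ∀ N → + 2 * - N ≡ 1ℤ - + 2 * N - 1ℤ
            e = solve-∀

    fifth-mod : ∀ {x y} → x ≡ y [p^ 5 ] → fifth x ≡ fifth y [p^ 5 ]
    fifth-mod h = mod-* h (mod-* h (mod-* h (mod-* h (mod-*ʳ 1ℤ h))))

    bar-left : ∀ x y (k : Fin p) → bar x ≡ A [p^ 5 ] → bar y ≡ fifth (poch 1ℤ (toℕ k)) [p^ 5 ] →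
      (+ 10 * + toℕ k + r) * (fifth (bar (pochhammer x (toℕ k))) * bar (y ⁻¹)) ≡ left-term r (toℕ k) [p^ 5 ]
    bar-left x y k hx hy = mod-*ˡ (+ 10 * + toℕ k + r) (mod-* (fifth-mod (bar-pochhammer x A (toℕ k) hx))
      (bar-⁻¹ y (fifth (poch 1ℤ (toℕ k))) hy (U-fifth (poch 1ℤ (toℕ k)) (U-1<p (toℕ k) (toℕ<n k)))))

    bar-right : ∀ b x y i → i ℕ.≤ N → bar b ≡ - + N [p^ 5 ] → bar x ≡ A [p^ 5 ] → bar y ≡ right-den i [p^ 5 ] →
      bar (pochhammer b i) * (bar (pochhammer x i) * (bar (pochhammer x i) * (bar (pochhammer x i) * 1ℤ))) * bar (y ⁻¹) ≡ right-term i [p^ 5 ]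
    bar-right b x y i i≤N hb hx hy = mod-* (mod-* (bar-pochhammer b (- + N) i hb) (mod-* bA (mod-* bA (mod-*ʳ 1ℤ bA)))) (bar-⁻¹ y (right-den i) hy (U-right-den i i≤N))
      where
      bA = bar-pochhammer x A i hx

    bar-right-den : ∀ o x y i → bar o ≡ 1ℤ [p^ 5 ] → bar x ≡ A + A [p^ 5 ] → bar y ≡ g₀ [p^ 5 ] →
      bar (pochhammer o i) * (bar (pochhammer x i) * (bar (pochhammer x i) * 1ℤ)) * bar (pochhammer y i) ≡ right-den i [p^ 5 ]
    bar-right-den o x y i ho hx hy = mod-* (mod-* (bar-pochhammer o 1ℤ i ho) (mod-* b2A (mod-*ʳ 1ℤ b2A))) (bar-pochhammer y g₀ i hy)
      where
      b2A = bar-pochhammer x (A + A) i hx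

    Γ-den : ℤ
    Γ-den = G (A + A) * (G (A + A) * 1ℤ) * G g₀ * (G H * (G H * (G H * 1ℤ)))

    bar-Γ-den : bar (Γₚ 2ρ) * (bar (Γₚ 2ρ) * 1ℤ) * bar (Γₚ γ) * (bar (Γₚ η) * (bar (Γₚ η) * (bar (Γₚ η) * 1ℤ))) ≡ Γ-den [p^ 5 ]
    bar-Γ-den = mod-* (mod-* (mod-* Γ₂ (mod-*ʳ 1ℤ Γ₂)) (bar-Γ γ g₀ bar-γ)) (mod-* Γη (mod-* Γη (mod-*ʳ 1ℤ Γη)))
      where
      Γ₂ = bar-Γ 2ρ (A + A) bar-2ρ
      Γη = bar-Γ η H bar-η

    -- A sum over i ≤ N reduces to its term at 0, in which the numerator symbols have become 1, plus
    -- a sum over `Fin N`; the left side has this reduced form.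
    right-sum-split : ∀ (g : Fin N → ℤₚ) y → bar y ≡ right-den 0 [p^ 5 ] → (∀ i → bar (g i) ≡ right-term (suc (toℕ i)) [p^ 5 ]) →
      1ℤ * (1ℤ * (1ℤ * (1ℤ * 1ℤ))) * bar (y ⁻¹) + bar (sum-syntax N g) ≡ right-sum [p^ 5 ]
    right-sum-split g y hy hg = mod-trans (mod-+ (mod-*ˡ 1ℤ (bar-⁻¹ y (right-den 0) hy (U-right-den 0 z≤n))) mod-refl) (tail N g right-term hg)
      where
      tail : ∀ M (g : Fin M → ℤₚ) (t : ℕ → ℤ) → (∀ i → bar (g i) ≡ t (suc (toℕ i)) [p^ 5 ]) → t 0 + bar (sum-syntax M g) ≡ diagSum M (λ i _ → t i) [p^ 5 ]
      tail zero    g t h = ≡-to-mod (ℤP.+-identityʳ (t 0))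
      tail (suc M) g t h = mod-+ˡ (t 0) (bar-sum M g (λ i → t (suc i)) h)

    -- The p-adic summands are variables, to be found by unification: comparing two equal p-adic integers would
    -- compare their coherence proofs.
    evaluate : ∀ (f : Fin p → ℤₚ) (g : Fin N → ℤₚ) (y₀ y₁ : ℤₚ) →
      (∀ k → bar (f k) ≡ left-term r (toℕ k) [p^ 5 ]) →
      bar y₁ ≡ Γ-den [p^ 5 ] →
      bar y₀ ≡ right-den 0 [p^ 5 ] →
      (∀ i → bar (g i) ≡ right-term (suc (toℕ i)) [p^ 5 ]) →
      bar (sum-syntax p f) ≡ + p * (bar (Γₚ ρ) * (bar (Γₚ ρ) * (bar (Γₚ ρ) * (bar (Γₚ ρ) * 1ℤ)))) * bar (y₁ ⁻¹)
        * (1ℤ * (1ℤ * (1ℤ * (1ℤ * 1ℤ))) * bar (y₀ ⁻¹) + bar (sum-syntax N g)) [p^ 5 ]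
    -- Multiplied by the unit Γ(H)⁵, both sides become -p Γ(A)⁵ J(0, 0), by `F₀-value` and
    -- `right-value`.
    evaluate f g y₀ y₁ hf hy₁ hy₀ hg = cancel 5 X U-X (begin
      X * bar (sum-syntax p f)            ≈⟨ mod-*ˡ X (bar-sum-< p p′ p≡ f (left-term r) hf) ⟩
      X * diagSum p′ (λ i _ → left-term r i) ≡⟨ cong (λ t → X * diagSum t (λ i _ → left-term r i)) (sym n+e) ⟩
      X * diagSum (n ℕ.+ e) (λ i _ → left-term r i) ≈⟨ mod-*ˡ X (left-sum r e (mod-sym 5A≡r) (subst (ℕ._< p) (sym n+e) (ℕP.≤-reflexive p≡))) ⟩
      X * (+ 5 * F₀)                      ≡⟨ ℤP.*-comm X (+ 5 * F₀) ⟩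
      + 5 * F₀ * X                        ≈⟨ F₀-value ⟩
      - (+ p * (G A * (J 0ℤ 0ℤ * (G A * G A * (G A * G A)))))  ≈⟨ right-value D hD ⟨
      + p * (G A * (G A * (G A * (G A * 1ℤ)))) * D * right-sum * X ≡⟨ ℤP.*-comm (+ p * (G A * (G A * (G A * (G A * 1ℤ)))) * D * right-sum) X ⟩
      X * (+ p * (G A * (G A * (G A * (G A * 1ℤ)))) * D * right-sum)
        ≈⟨ mod-*ˡ X (mod-* (mod-*ʳ D (mod-*ˡ (+ p) (mod-* GA (mod-* GA (mod-* GA (mod-*ʳ 1ℤ GA)))))) (right-sum-split g y₀ hy₀ hg)) ⟨
      X * (+ p * (bar (Γₚ ρ) * (bar (Γₚ ρ) * (bar (Γₚ ρ) * (bar (Γₚ ρ) * 1ℤ)))) * D * (1ℤ * (1ℤ * (1ℤ * (1ℤ * 1ℤ))) * bar (y₀ ⁻¹) + bar (sum-syntax N g))) ∎)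
      where
      open R
      X D : ℤ
      X = G H * (G H * G H * (G H * G H))
      U-X : U X
      U-X = U-* (G H) (G H * G H * (G H * G H)) u (U-* (G H * G H) (G H * G H) (U-* (G H) (G H) u u) (U-* (G H) (G H) u u))
        where u = G-unit H
      p′ e : ℕ
      p′ = ℕ.pred p
      e = p′ ℕ.∸ n
      p≡ : suc p′ ≡ p
      p≡ = ℕP.suc-pred p {{p≢0}}
      n+e : n ℕ.+ e ≡ p′
      n+e = ℕP.m+[n∸m]≡n (ℕ.s≤s⁻¹ (subst (n ℕ.<_) (sym p≡) n<p))
      D = bar (y₁ ⁻¹)
      GA : bar (Γₚ ρ) ≡ G A [p^ 5 ]
      GA = bar-Γ ρ A r/5≡a
      U-Γ-den : U Γ-den
      U-Γ-den = U-* (G (A + A) * (G (A + A) * 1ℤ) * G g₀) (G H * (G H * (G H * 1ℤ)))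
        (U-* (G (A + A) * (G (A + A) * 1ℤ)) (G g₀) (U-* (G (A + A)) (G (A + A) * 1ℤ) (G-unit (A + A)) (U-* (G (A + A)) 1ℤ (G-unit (A + A)) U-1)) (G-unit g₀))
        (U-* (G H) (G H * (G H * 1ℤ)) (G-unit H) (U-* (G H) (G H * 1ℤ) (G-unit H) (U-* (G H) 1ℤ (G-unit H) U-1)))
      hD : Γ-den * D ≡ 1ℤ [p^ 5 ]
      hD = bar-⁻¹-inverse y₁ Γ-den hy₁ U-Γ-den

-- The parameters attached to r and p

odd-residue : ∀ r → r ℤ.≤ 1ℤ → ¬ (+ 2 ℤU.∣ r) → r ≡ 1ℤ ℤ.- + 2 ℤ.* + (∣ 1ℤ ℤ.- r ∣ div 2)
odd-residue r r≤1 r-odd = trans (e r) (cong (λ t → 1ℤ ℤ.- t) (trans (sym w≡) (trans (cong +_ 2N) (ℤP.pos-* 2 N))))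
  where
  w N : ℕ
  w = ∣ 1ℤ ℤ.- r ∣
  N = w div 2
  w≡ : + w ≡ 1ℤ ℤ.- r
  w≡ = ℤP.0≤i⇒+∣i∣≡i (ℤP.i≤j⇒0≤j-i r≤1)
  e : ∀ r → r ≡ 1ℤ ℤ.- (1ℤ ℤ.- r)
  e = solve-∀
  e′ : ∀ N → 1ℤ ℤ.- (1ℤ ℤ.+ N ℤ.* + 2) ≡ ℤ.- N ℤ.* + 2
  e′ = solve-∀
  split : w ≡ w % 2 ℕ.+ N ℕ.* 2
  split = m≡m%n+[m/n]*n w 2
  by-remainder : ∀ s → s ℕ.< 2 → w ≡ s ℕ.+ N ℕ.* 2 → w ≡ 2 ℕ.* N
  by-remainder zero          _ h = trans h (ℕP.*-comm N 2)
  -- Remainder 1 would mean 1 - r = 1 + 2N, hence r = -2N even.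
  by-remainder (suc zero)    _ h = contradiction (ℤS.∣⇒∣ᵤ (ℤS.divides (ℤ.- + N)
    (trans (e r) (trans (cong (λ t → 1ℤ ℤ.- t) (trans (sym w≡) (trans (cong +_ h) (cong (λ t → 1ℤ ℤ.+ t) (ℤP.pos-* N 2))))) (e′ (+ N)))))) r-odd
  by-remainder (suc (suc s)) (s≤s (s≤s ())) _
  2N : w ≡ 2 ℕ.* N
  2N = by-remainder (w % 2) (m%n<n w 2) split

-- A prime dividing 5 is 5 itself, and then r ≡ p ≡ 0 modulo 5 contradicts coprimality.
prime-∤5 : ∀ r → Coprime r (+ 5) → ∀ p → Prime p → 2 ℕ.< p → + p ≡ r [mod 5 ] → p ℕD.∤ 5
prime-∤5 r r⊥5 p p-prime 2<p p≡r p∣5 with prime⇒irreducible (from-yes (prime? 5)) p∣5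
... | inj₁ refl = contradiction 2<p λ { (s≤s ()) }
... | inj₂ refl with r⊥5 {5} (ℤS.∣⇒∣ᵤ (Congruences.≡0⇒∣ {5} {r} (mod-trans (mod-sym p≡r) (Congruences.∣⇒≡0 (ℤS.divides 1ℤ refl)))) , ℕD.∣-refl)
...   | ()

record Parameters (p N : ℕ) : Set where
  field
    d m   : ℕ
    n≡2m  : N ℕ.+ d ≡ m ℕ.+ m
    size  : suc (5 ℕ.* (N ℕ.+ d)) ≡ p ℕ.+ 2 ℕ.* N
    small : suc (3 ℕ.* (N ℕ.+ d)) ℕ.≤ p

even-half : ∀ {n} → 2 ℕD.∣ n → ∃[ m ] n ≡ m ℕ.+ m
even-half (ℕD.divides m refl) = m , e m
  where
  e : ∀ m → m ℕ.* 2 ≡ m ℕ.+ m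
  e = ℕSolver.solve-∀

-- With p - 1 = 2s, the bound 3N ≤ p - 1 gives N ≤ n, from 5N ≤ p - 1 + 2N = 5n, and also 3n ≤ p -
-- 1, from 15n = 3(p - 1) + 6N. Since 5n is even, so is n.
parameters-from : ∀ s N n → 5 ℕ.* n ≡ s ℕ.+ s ℕ.+ 2 ℕ.* N → 3 ℕ.* N ℕ.≤ s ℕ.+ s → Parameters (suc (s ℕ.+ s)) N
parameters-from s N n 5n 3N≤q with even-half 2∣n
  where
  2∣n : 2 ℕD.∣ n
  2∣n = ℕD.∣m+n∣m⇒∣n {2} {4 ℕ.* n} (subst (2 ℕD.∣_) (trans (e₁ s N) (trans (sym 5n) (e₂ n))) (ℕD.m∣m*n (s ℕ.+ N))) (ℕD.∣-trans (ℕD.divides 2 refl) (ℕD.m∣m*n {4} n))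
    where
    e₁ : ∀ s N → 2 ℕ.* (s ℕ.+ N) ≡ s ℕ.+ s ℕ.+ 2 ℕ.* N
    e₁ = ℕSolver.solve-∀
    e₂ : ∀ n → 5 ℕ.* n ≡ 4 ℕ.* n ℕ.+ n
    e₂ = ℕSolver.solve-∀
... | m , n≡ = record
  { d = n ℕ.∸ N ; m = m ; n≡2m = trans N+d n≡
  ; size = trans (cong (λ t → suc (5 ℕ.* t)) N+d) (cong suc 5n)
  ; small = s≤s (subst (λ t → 3 ℕ.* t ℕ.≤ q) (sym N+d) 3n≤q) }
  where
  q : ℕ
  q = s ℕ.+ s
  N≤n : N ℕ.≤ n
  N≤n = ℕP.*-cancelˡ-≤ 5 (ℕP.≤-trans (ℕP.≤-reflexive (e N)) (ℕP.≤-trans (ℕP.+-monoˡ-≤ (2 ℕ.* N) 3N≤q) (ℕP.≤-reflexive (sym 5n))))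
    where
    e : ∀ N → 5 ℕ.* N ≡ 3 ℕ.* N ℕ.+ 2 ℕ.* N
    e = ℕSolver.solve-∀
  N+d : N ℕ.+ (n ℕ.∸ N) ≡ n
  N+d = ℕP.m+[n∸m]≡n N≤n
  3n≤q : 3 ℕ.* n ℕ.≤ q
  3n≤q = ℕP.*-cancelˡ-≤ 5 (begin
    5 ℕ.* (3 ℕ.* n)                   ≡⟨ e₁ n ⟩
    3 ℕ.* (5 ℕ.* n)                   ≡⟨ cong (3 ℕ.*_) 5n ⟩
    3 ℕ.* (q ℕ.+ 2 ℕ.* N)             ≡⟨ e₂ q N ⟩
    3 ℕ.* q ℕ.+ 2 ℕ.* (3 ℕ.* N)       ≤⟨ ℕP.+-monoʳ-≤ (3 ℕ.* q) (ℕP.*-monoʳ-≤ 2 3N≤q) ⟩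
    3 ℕ.* q ℕ.+ 2 ℕ.* q               ≡⟨ e₃ q ⟩
    5 ℕ.* q                           ∎)
    where
    open ℕP.≤-Reasoning
    e₁ : ∀ n → 5 ℕ.* (3 ℕ.* n) ≡ 3 ℕ.* (5 ℕ.* n)
    e₁ = ℕSolver.solve-∀
    e₂ : ∀ q N → 3 ℕ.* (q ℕ.+ 2 ℕ.* N) ≡ 3 ℕ.* q ℕ.+ 2 ℕ.* (3 ℕ.* N)
    e₂ = ℕSolver.solve-∀
    e₃ : ∀ q → 3 ℕ.* q ℕ.+ 2 ℕ.* q ≡ 5 ℕ.* q
    e₃ = ℕSolver.solve-∀

opaque
  -- For r = 1 - 2N the hypothesis p ≥ (5 - 3r)/2 reads p ≥ 1 + 3N.
  parameters : ∀ p → 2 ℕD.∤ p → ∀ N → + p ≡ 1ℤ ℤ.- + 2 ℤ.* + N [mod 5 ] →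
    + 5 ℤ.- + 3 ℤ.* (1ℤ ℤ.- + 2 ℤ.* + N) ℤ.≤ + 2 ℤ.* + p → Parameters p N
  parameters p p-odd N p≡r bound with odd-half p p-odd
  ... | s , refl with 5∣q+2N
    where
    5∣q+2N : 5 ℕD.∣ s ℕ.+ s ℕ.+ 2 ℕ.* N
    5∣q+2N = ℤS.∣⇒∣ᵤ (subst (+ 5 ℤS.∣_) (trans (e (+ (s ℕ.+ s)) (+ N)) (cong (λ t → + (s ℕ.+ s) ℤ.+ t) (sym (ℤP.pos-* 2 N)))) (divides-difference p≡r))
      where
      e : ∀ q N → 1ℤ ℤ.+ q ℤ.- (1ℤ ℤ.- + 2 ℤ.* N) ≡ q ℤ.+ + 2 ℤ.* N
      e = solve-∀
  ...   | ℕD.divides n 5n = parameters-from s N n (trans (ℕP.*-comm 5 n) (sym 5n)) 3N≤q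
    where
    3N≤q : 3 ℕ.* N ℕ.≤ s ℕ.+ s
    3N≤q = ℕ.s≤s⁻¹ (ℕP.*-cancelˡ-≤ 2 (ℤP.drop‿+≤+ (subst₂ ℤ._≤_ (trans (e (+ N)) (sym cast)) (sym (ℤP.pos-* 2 (suc (s ℕ.+ s)))) bound)))
      where
      e : ∀ N → + 5 ℤ.- + 3 ℤ.* (1ℤ ℤ.- + 2 ℤ.* N) ≡ + 2 ℤ.* (1ℤ ℤ.+ + 3 ℤ.* N)
      e = solve-∀
      cast : + (2 ℕ.* suc (3 ℕ.* N)) ≡ + 2 ℤ.* (1ℤ ℤ.+ + 3 ℤ.* + N)
      cast = trans (ℤP.pos-* 2 (suc (3 ℕ.* N))) (cong (λ t → + 2 ℤ.* (1ℤ ℤ.+ t)) (ℤP.pos-* 3 N))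

theorem1p1 :
  (r : ℤ) → r ℤ.≤ 1ℤ → ¬ (+ 2 ℤU.∣ r) → Coprime r (+ 5) →
  (p : ℕ) (p-prime : Prime p) (p-odd : 2 ℕD.∤ p) →
  + p ≡ r [mod 5 ] → + 5 ℤ.- + 3 ℤ.* r ℤ.≤ + 2 ℤ.* + p →
  let open Padic p p-prime p-odd
      r/5 = ι r / ι (+ 5)
      2r/5 = ι (+ 2 ℤ.* r) / ι (+ 5)
      1/2+3r/10 = ι 1ℤ / ι (+ 2) + ι (+ 3 ℤ.* r) / ι (+ 10)
      1/2-r/10 = ι 1ℤ / ι (+ 2) - ι r / ι (+ 10)
      [r-1]/2 = ι (r ℤ.- 1ℤ) / ι (+ 2)
  in
  ∑[ k < p ]
    (ι (+ 10 ℤ.* + toℕ k ℤ.+ r)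
      * (pochhammer r/5 (toℕ k) ^ 5 / pochhammer 1# (toℕ k) ^ 5))
  ≡
  (ι (+ p) * Γₚ r/5 ^ 4 / (Γₚ 2r/5 ^ 2 * Γₚ 1/2+3r/10 * Γₚ 1/2-r/10 ^ 3))
  * ∑[ k ≤ ∣ 1ℤ ℤ.- r ∣ div 2 ]
      (pochhammer [r-1]/2 (toℕ k) * pochhammer r/5 (toℕ k) ^ 3
        / (pochhammer 1# (toℕ k) * pochhammer 2r/5 (toℕ k) ^ 2 * pochhammer 1/2+3r/10 (toℕ k)))
  [mod-p^ 5 ]
theorem1p1 r r≤1 r-odd r⊥5 p p-prime p-odd p≡r bound =
  -- Every residue of the modulus reduces to `fifth (+ p)`, and divisibility by p⁵ can be read off
  -- from the residue of the difference at level 5.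
  divisible (λ _ → p⁵) (difference-≡0 (E.evaluate _ _ _ _
    (λ k → E.bar-left _ _ k r/5≡a (E.fifth-mod (bar-pochhammer _ 1ℤ (toℕ k) mod-refl)))
    E.bar-Γ-den
    mod-refl
    (λ i → E.bar-right _ _ _ (suc (toℕ i)) (toℕ<n i) E.bar-β r/5≡a (E.bar-right-den _ _ _ (suc (toℕ i)) mod-refl E.bar-2ρ E.bar-γ))))
  where
  open Padic p p-prime p-odd using (2<p; ι; _/_)
  open PrimePowers p p-prime p-odd using (representative; bar; bar-pochhammer; bar-fraction′; divisible; p⁵; difference-≡0)
  N : ℕ
  N = ∣ 1ℤ ℤ.- r ∣ div 2
  r≡ : r ≡ 1ℤ ℤ.- + 2 ℤ.* + N
  r≡ = odd-residue r r≤1 r-odd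
  open Parameters (parameters p p-odd N (subst (λ t → + p ≡ t [mod 5 ]) r≡ p≡r) (subst (λ t → + 5 ℤ.- + 3 ℤ.* t ℤ.≤ + 2 ℤ.* + p) r≡ bound))
  p∤5 : p ℕD.∤ 5
  p∤5 = prime-∤5 r r⊥5 p p-prime 2<p p≡r
  -- The representative is taken in ℕ because `G-even` is an induction on a natural number and is
  -- applied at a and at h = 2a + N.
  a : ℕ
  a = proj₁ (representative (bar (ι r / ι (+ 5))))
  r/5≡a : bar (ι r / ι (+ 5)) ≡ + a [mod p ℕ.^ 5 ]
  r/5≡a = proj₂ (representative (bar (ι r / ι (+ 5))))
  5a : + 5 ℤ.* + a ≡ 1ℤ ℤ.- + 2 ℤ.* + N [mod p ℕ.^ 5 ]
  5a = mod-trans (Congruences.mod-*ˡ (+ 5) (mod-sym r/5≡a)) (mod-trans (bar-fraction′ r (+ 5) p∤5) (≡-to-mod r≡))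
  module E = Evaluation.Sides p p-prime p-odd N d m a n≡2m size small p∤5 5a r r≡ r/5≡a
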